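{- Let $m\ge2$, $r=\frac1{4m}$, and $\Phi_r(u)=u+\frac{r}{1-u}$, so $\partial_u\Phi_r(u)=1+\frac{r}{(1-u)^2}$. Let $H_k(x)=\sum_{j=k}^{m-1}G_j(x)$ for $0\le k\le m-1$. Then the limits $q_k(m):=\lim_{n\to\infty}[x^n]H_k(x)/[x^n]G(x)$ and $p_k(m):=\lim_{n\to\infty}g_n^{(k)}/g_n$ exist for $0\le k\le m-1$; one has $H_k(r)=\Phi_r(H_{k+1}(r))$ for $0\le k\le m-2$; and $$q_{m-1}(m)=p_{m-1}(m),\qquad q_k(m)=\bigl(\partial_u\Phi_r(H_{k+1}(r))\bigr)\,q_{k+1}(m),\qquad p_k(m)=q_k(m)-q_{k+1}(m)\qquad(0\le k\le m-2).$$
   Context: For an integer $m\ge2$ let $V_m=\{v_0<v_1<\cdots<v_{m-1}\}$ ($v_0=0$, $v_{m-1}=1$) be an $m$-element chain with Gödel implication $v_p\Rightarrow_G v_q=v_{m-1}$ if $p\le q$ and $v_p\Rightarrow_G v_q=v_q$ if $p>q$. For $n\ge1$, consider the $C_{n-1}$ full bracketings of $p_1\Rightarrow_G\cdots\Rightarrow_G p_n$ in $n$ distinct variables (full binary trees with $n$ ordered leaves), $C_k$ being the Catalan numbers. Let $g_n^{(j)}$ be the number of pairs (bracketing, valuation $\{p_1,\dots,p_n\}\to V_m$) for which the bracketed formula evaluates to $v_j$, and $g_n=\sum_{j=0}^{m-1}g_n^{(j)}=m^nC_{n-1}$. Put $G_j(x)=\sum_{n\ge1}g_n^{(j)}x^n$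 and $G(x)=\sum_{n\ge1}g_nx^n$; these power series converge for $|x|\le r=\frac1{4m}$, and $H_k(r)$ denotes the sum at $x=r$. $[x^n]$ denotes coefficient extraction. -}

module Defs where

open import Algebra.Definitions.RawSemiring using (_^_)
open import Data.Bool.Base using (if_then_else_)
open import Data.Empty using (⊥-elim)
open import Data.Fin.Base using (Fin; toℕ; fromℕ)
import Data.Fin.Properties as Fin
open import Data.Integer.Base using (+_)
open import Data.List.Base
  using (List; []; _∷_; [_]; length; map; filter; upTo; allFin; concatMap; cartesianProductWith)
open import Data.List.Membership.Propositional using (_∈_)
open import Data.List.Membership.Propositional.Properties
  using (∈-map⁺; ∈-map⁻; ∈-concat⁺′; ∈-concat⁻′; ∈-upTo⁺; ∈-upTo⁻; ∈-cartesianProductWith⁺; ∈-cartesianProductWith⁻)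
open import Data.List.Relation.Unary.All using (All; []; _∷_; universal)
import Data.List.Relation.Unary.All.Properties as All
open import Data.List.Relation.Unary.AllPairs using (AllPairs; []; _∷_)
import Data.List.Relation.Unary.AllPairs as AllPairs
import Data.List.Relation.Unary.AllPairs.Properties as AllPairs
open import Data.List.Relation.Unary.Any using (here; there)
open import Data.List.Relation.Unary.Unique.Propositional using (Unique)
import Data.List.Relation.Unary.Unique.Propositional.Properties as Unique
open import Data.Nat.Base as ℕ using (ℕ; zero; suc; s≤s; z≤n; NonTrivial)
open import Data.Nat.ListAction using (sum)
import Data.Nat.Properties as ℕ
open import Data.Product.Base using (_×_; _,_; ∃-syntax; Σ-syntax)
open import Data.Rational.Base as ℚ using (ℚ; 0ℚ; 1ℚ; _/_)
import Data.Rational.Properties as ℚ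
open import Data.Rational.Solver using (module +-*-Solver)
open import Data.Sum.Base using (inj₁; inj₂)
open import Data.Vec.Base using (Vec; []; _∷_; take; drop)
open import Relation.Nullary using (yes; no; does)
open import Relation.Binary.PropositionalEquality
  using (_≡_; _≢_; refl; sym; trans; cong; cong₂; subst; subst₂; module ≡-Reasoning)

------------------------------------------------------------------------
-- Gödel implication on the m-element chain
------------------------------------------------------------------------

-- The chain v₀ < ⋯ < v_{m-1} is Fin m; its top element is fromℕ (m - 1).
infixr 5 _⇒G_
_⇒G_ : ∀ {m} → Fin m → Fin m → Fin m
_⇒G_ {suc l} p q = if does (p Fin.≤? q) then fromℕ l else q

------------------------------------------------------------------------
-- Bracketings
------------------------------------------------------------------------

-- A bracketing of p₁ ⇒ ⋯ ⇒ pₙ; the variables are the leaves, read from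
-- left to right.
infixr 5 _⇒_
data Bracketing : Set where
  leaf : Bracketing
  _⇒_  : Bracketing → Bracketing → Bracketing

leaves : Bracketing → ℕ
leaves leaf    = 1
leaves (s ⇒ t) = leaves s ℕ.+ leaves t

Valuation : ℕ → ℕ → Set
Valuation m n = Vec (Fin m) n

eval : ∀ {m} (t : Bracketing) → Valuation m (leaves t) → Fin m
eval leaf    (v ∷ []) = v
eval (s ⇒ t) ρ        = eval s (take (leaves s) ρ) ⇒G eval t (drop (leaves s) ρ)

-- The first argument bounds the recursion depth; any bound ≥ n gives the
-- same list.
bracketings′ : ℕ → ℕ → List Bracketing
bracketingsWithLeft : (f n i : ℕ) → List Bracketing

bracketings′ zero    _             = []
bracketings′ (suc f) zero          = []
bracketings′ (suc f) (suc zero)    = [ leaf ]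
bracketings′ (suc f) (suc (suc n)) =
  concatMap (bracketingsWithLeft f n) (upTo (suc n))

-- Those of s ⇒ t with i + 1 leaves in s and n + 1 - i leaves in t.
bracketingsWithLeft f n i =
  cartesianProductWith _⇒_ (bracketings′ f (suc i)) (bracketings′ f (suc n ℕ.∸ i))

-- All bracketings with n leaves, each listed exactly once; see
-- bracketings-sound, bracketings-complete and bracketings-unique.
bracketings : ℕ → List Bracketing
bracketings n = bracketings′ n n

-- All valuations Vec (Fin m) n, each listed exactly once.
valuations : ∀ m n → List (Valuation m n)
valuations m zero    = [ [] ]
valuations m (suc n) = cartesianProductWith _∷_ (allFin m) (valuations m n)

1≤leaves : ∀ t → 1 ℕ.≤ leaves t
1≤leaves leaf    = s≤s z≤n
1≤leaves (s ⇒ t) = ℕ.≤-trans (1≤leaves s) (ℕ.m≤m+n _ _)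

private
  sound′ : ∀ f n {t} → t ∈ bracketings′ f n → leaves t ≡ n
  sound′ (suc f) (suc zero)    (here refl) = refl
  sound′ (suc f) (suc (suc n)) t∈
    with _ , t∈xs , xs∈ ← ∈-concat⁻′ (map (bracketingsWithLeft f n) (upTo (suc n))) t∈
    with i , i∈ , refl ← ∈-map⁻ (bracketingsWithLeft f n) xs∈
    with a , b , a∈ , b∈ , refl ← ∈-cartesianProductWith⁻ _⇒_ (bracketings′ f (suc i)) (bracketings′ f (suc n ℕ.∸ i)) t∈xs
    = trans (cong₂ ℕ._+_ (sound′ f (suc i) a∈) (sound′ f (suc n ℕ.∸ i) b∈))
            (cong suc (ℕ.m+[n∸m]≡n {i} {suc n} (ℕ.<⇒≤ (∈-upTo⁻ i∈))))

  complete′ : ∀ f t → leaves t ℕ.≤ f → t ∈ bracketings′ f (leaves t)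
  complete′ zero    t       p = ⊥-elim (ℕ.<⇒≱ (1≤leaves t) p)
  complete′ (suc f) leaf    p = here refl
  complete′ (suc f) (s ⇒ t) p = go (leaves s) (leaves t) refl refl (1≤leaves s) (1≤leaves t)
    where
    go : ∀ a b → leaves s ≡ a → leaves t ≡ b → 1 ℕ.≤ a → 1 ℕ.≤ b →
         (s ⇒ t) ∈ bracketings′ (suc f) (a ℕ.+ b)
    go (suc a) (suc b) ea eb _ _ rewrite ℕ.+-suc a b =
      ∈-concat⁺′ {xss = map (bracketingsWithLeft f (a ℕ.+ b)) (upTo (suc (a ℕ.+ b)))}
        (∈-cartesianProductWith⁺ _⇒_
          (subst (λ k → s ∈ bracketings′ f k) ea (complete′ f s s≤f))
          (subst (λ k → t ∈ bracketings′ f k) eb′ (complete′ f t t≤f)))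
        (∈-map⁺ (bracketingsWithLeft f (a ℕ.+ b)) (∈-upTo⁺ (s≤s (ℕ.m≤m+n a b))))
      where
      s≤f : leaves s ℕ.≤ f
      s≤f = ℕ.≤-pred (ℕ.<-≤-trans (ℕ.m<m+n (leaves s) (1≤leaves t)) p)
      t≤f : leaves t ℕ.≤ f
      t≤f = ℕ.≤-pred (ℕ.<-≤-trans (ℕ.m<n+m (leaves t) (1≤leaves s)) p)
      eb′ : leaves t ≡ suc (a ℕ.+ b) ℕ.∸ a
      eb′ = trans eb (sym (trans (cong (ℕ._∸ a) (sym (ℕ.+-suc a b))) (ℕ.m+n∸m≡n a (suc b))))

  ⇒-injective : ∀ {s s′ t t′} → (s ⇒ t) ≡ (s′ ⇒ t′) → s ≡ s′ × t ≡ t′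
  ⇒-injective refl = refl , refl

  unique′ : ∀ f n → Unique (bracketings′ f n)
  unique′ zero    n             = []
  unique′ (suc f) zero          = []
  unique′ (suc f) (suc zero)    = [] ∷ []
  unique′ (suc f) (suc (suc n)) = Unique.concat⁺
    (All.map⁺ (universal (λ i →
      Unique.cartesianProductWith⁺ _⇒_ ⇒-injective (unique′ f _) (unique′ f _)) (upTo (suc n))))
    (AllPairs.map⁺ (AllPairs.map (λ {i} {j} i≢j {t} p → i≢j (disjoint i j p)) (Unique.upTo⁺ (suc n))))
    where
    disjoint : ∀ i j {t} →
      t ∈ bracketingsWithLeft f n i × t ∈ bracketingsWithLeft f n j → i ≡ j
    disjoint i j (p , q)
      with a , b , a∈ , b∈ , refl ← ∈-cartesianProductWith⁻ _⇒_ (bracketings′ f (suc i)) (bracketings′ f (suc n ℕ.∸ i)) p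
      with _ , _ , c∈ , _ , refl ← ∈-cartesianProductWith⁻ _⇒_ (bracketings′ f (suc j)) (bracketings′ f (suc n ℕ.∸ j)) q
      = ℕ.suc-injective (trans (sym (sound′ f (suc i) a∈)) (sound′ f (suc j) c∈))

bracketings-sound : ∀ n {t} → t ∈ bracketings n → leaves t ≡ n
bracketings-sound n = sound′ n n

bracketings-complete : ∀ t → t ∈ bracketings (leaves t)
bracketings-complete t = complete′ (leaves t) t ℕ.≤-refl

bracketings-unique : ∀ n → Unique (bracketings n)
bracketings-unique n = unique′ n n

------------------------------------------------------------------------
-- The counting sequences and their generating functions
------------------------------------------------------------------------

-- g m n j is g_n^{(j)}: the number of pairs (bracketing, valuation)
-- evaluating to v_j.
g : (m n j : ℕ) → ℕ
g m n j = sum (map count (bracketings n))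
  where
  count : Bracketing → ℕ
  count t = length (filter (λ ρ → toℕ (eval t ρ) ℕ.≟ j) (valuations m (leaves t)))

-- Σ_{j=a}^{b-1} f j
sumFromTo : ℕ → ℕ → (ℕ → ℕ) → ℕ
sumFromTo a b f = sum (map (λ i → f (a ℕ.+ i)) (upTo (b ℕ.∸ a)))

-- A power series is its coefficient sequence: A n = [xⁿ] A.
PowerSeries : Set
PowerSeries = ℕ → ℕ

-- The series below start at n = 1 in the text; here the coefficient at
-- n = 0 vanishes because bracketings 0 = [].
G⟨_⟩ : (m j : ℕ) → PowerSeries
G⟨ m ⟩ j n = g m n j

Gtot : (m : ℕ) → PowerSeries
Gtot m n = sumFromTo 0 m (g m n)

H⟨_⟩ : (m k : ℕ) → PowerSeries
H⟨ m ⟩ k n = sumFromTo k m (λ j → G⟨ m ⟩ j n)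

------------------------------------------------------------------------
-- Rational auxiliaries
------------------------------------------------------------------------

fromℕ→ℚ : ℕ → ℚ
fromℕ→ℚ n = + n / 1

-- Total division, with p ÷₀ 0 = 0.  In ratios of coefficients the zero
-- case only occurs at n = 0, which does not affect limits.
infixl 7 _÷₀_
_÷₀_ : ℚ → ℚ → ℚ
p ÷₀ q with q ℚ.≟ 0ℚ
... | yes _  = 0ℚ
... | no q≢0 = ℚ._÷_ p q {{ℚ.≢-nonZero q≢0}}

ratio : ℕ → ℕ → ℚ
ratio a b = fromℕ→ℚ a ÷₀ fromℕ→ℚ b

radius : (m : ℕ) → .{{_ : NonTrivial m}} → ℚ
radius m = (+ 1 / (4 ℕ.* m)) {{ℕ.m*n≢0 4 m {{_}} {{ℕ.nonTrivial⇒nonZero m}}}}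

-- Σ_{n<N} ([xⁿ] A) xⁿ
partialSum : PowerSeries → ℚ → ℕ → ℚ
partialSum A x zero    = 0ℚ
partialSum A x (suc N) =
  partialSum A x N ℚ.+ fromℕ→ℚ (A N) ℚ.* (ℚ.+-*-rawSemiring ^ x) N

private
  0≤∣_∣ : ∀ p → 0ℚ ℚ.≤ ℚ.∣ p ∣
  0≤∣ p ∣ = ℚ.nonNegative⁻¹ ℚ.∣ p ∣ {{ℚ.∣-∣-nonNeg p}}

  ∣p∣≤ : ∀ {p q} → p ℚ.≤ q → ℚ.- p ℚ.≤ q → ℚ.∣ p ∣ ℚ.≤ q
  ∣p∣≤ {p} a b with ℚ.∣p∣≡p∨∣p∣≡-p p
  ... | inj₁ e rewrite e = a
  ... | inj₂ e rewrite e = b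

  p-q≤ : ∀ {p q r} → p ℚ.≤ r ℚ.+ q → p ℚ.- q ℚ.≤ r
  p-q≤ {p} {q} {r} h = subst (p ℚ.- q ℚ.≤_)
    (solve 2 (λ r q → r :+ q :- q := r) refl r q) (ℚ.+-monoˡ-≤ (ℚ.- q) h)
    where open +-*-Solver

  ∣p-q∣-sym : ∀ p q → ℚ.∣ p ℚ.- q ∣ ≡ ℚ.∣ q ℚ.- p ∣
  ∣p-q∣-sym p q = trans (sym (ℚ.∣-p∣≡∣p∣ (p ℚ.- q)))
    (cong ℚ.∣_∣ (solve 2 (λ p q → :- (p :- q) := q :- p) refl p q))
    where open +-*-Solver

  ∣p∣-∣q∣≤∣p-q∣ : ∀ p q → ℚ.∣ p ∣ ℚ.- ℚ.∣ q ∣ ℚ.≤ ℚ.∣ p ℚ.- q ∣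
  ∣p∣-∣q∣≤∣p-q∣ p q = p-q≤ {ℚ.∣ p ∣} {ℚ.∣ q ∣} (subst (λ z → ℚ.∣ z ∣ ℚ.≤ ℚ.∣ p ℚ.- q ∣ ℚ.+ ℚ.∣ q ∣)
    (solve 2 (λ p q → p :- q :+ q := p) refl p q) (ℚ.∣p+q∣≤∣p∣+∣q∣ (p ℚ.- q) q))
    where open +-*-Solver

  ∣∣p∣-∣q∣∣≤∣p-q∣ : ∀ p q → ℚ.∣ ℚ.∣ p ∣ ℚ.- ℚ.∣ q ∣ ∣ ℚ.≤ ℚ.∣ p ℚ.- q ∣
  ∣∣p∣-∣q∣∣≤∣p-q∣ p q = ∣p∣≤ (∣p∣-∣q∣≤∣p-q∣ p q)
    (subst₂ ℚ._≤_ (solve 2 (λ a b → b :- a := :- (a :- b)) refl ℚ.∣ p ∣ ℚ.∣ q ∣)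
            (∣p-q∣-sym q p) (∣p∣-∣q∣≤∣p-q∣ q p))
    where open +-*-Solver

  half : ℚ
  half = + 1 / 2

  0<½* : ∀ {ε} → 0ℚ ℚ.< ε → 0ℚ ℚ.< half ℚ.* ε
  0<½* {ε} p = subst (ℚ._< half ℚ.* ε) (ℚ.*-zeroʳ half) (ℚ.*-monoʳ-<-pos half p)

  ½+½ : ∀ ε → half ℚ.* ε ℚ.+ half ℚ.* ε ≡ ε
  ½+½ ε = trans (sym (ℚ.*-distribʳ-+ ε half half)) (ℚ.*-identityˡ ε)

  *-mono-≤ : ∀ {p q r s} → 0ℚ ℚ.≤ q → 0ℚ ℚ.≤ r → p ℚ.≤ q → r ℚ.≤ s → p ℚ.* r ℚ.≤ q ℚ.* s
  *-mono-≤ {p} {q} {r} {s} 0≤q 0≤r p≤q r≤s = ℚ.≤-trans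
    (ℚ.*-monoʳ-≤-nonNeg r {{ℚ.nonNegative 0≤r}} p≤q)
    (ℚ.*-monoˡ-≤-nonNeg q {{ℚ.nonNegative 0≤q}} r≤s)

  0<* : ∀ {p q} → 0ℚ ℚ.< p → 0ℚ ℚ.< q → 0ℚ ℚ.< p ℚ.* q
  0<* {p} {q} 0<p 0<q = ℚ.positive⁻¹ _ {{ℚ.pos*pos⇒pos p {{ℚ.positive 0<p}} q {{ℚ.positive 0<q}}}}

  invert : ∀ B → 0ℚ ℚ.< B → Σ[ C ∈ ℚ ] 0ℚ ℚ.< C × B ℚ.* C ≡ 1ℚ
  invert B 0<B = ℚ.1/ B , ℚ.positive⁻¹ _ {{ℚ.1/pos⇒pos B}} , ℚ.*-inverseʳ B
    where
    instance
      B-pos = ℚ.positive 0<B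
      B-nz  = ℚ.pos⇒nonZero B

------------------------------------------------------------------------
-- Real numbers, as Cauchy sequences of rationals
------------------------------------------------------------------------

IsCauchy : (ℕ → ℚ) → Set
IsCauchy a = ∀ ε → 0ℚ ℚ.< ε → ∃[ N ] ∀ i j → N ℕ.≤ i → N ℕ.≤ j → ℚ.∣ a i ℚ.- a j ∣ ℚ.≤ ε

record ℝ : Set where
  constructor mkℝ
  field
    seq    : ℕ → ℚ
    cauchy : IsCauchy seq
open ℝ public

infix 4 _≈_ _<ʳ_ _≤ʳ_

_≈_ : ℝ → ℝ → Set
x ≈ y = ∀ ε → 0ℚ ℚ.< ε → ∃[ N ] ∀ n → N ℕ.≤ n → ℚ.∣ seq x n ℚ.- seq y n ∣ ℚ.≤ ε

_<ʳ_ : ℝ → ℝ → Set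
x <ʳ y = ∃[ δ ] 0ℚ ℚ.< δ × ∃[ N ] ∀ n → N ℕ.≤ n → seq x n ℚ.+ δ ℚ.≤ seq y n

_≤ʳ_ : ℝ → ℝ → Set
x ≤ʳ y = ∀ ε → 0ℚ ℚ.< ε → ∃[ N ] ∀ n → N ℕ.≤ n → seq x n ℚ.≤ seq y n ℚ.+ ε

-- Apartness from zero, the constructive form of x ≠ 0.
_#0 : ℝ → Set
x #0 = ∃[ δ ] 0ℚ ℚ.< δ × ∃[ N ] ∀ n → N ℕ.≤ n → δ ℚ.≤ ℚ.∣ seq x n ∣

fromℚ : ℚ → ℝ
fromℚ p = mkℝ (λ _ → p) λ ε 0<ε → 0 , λ _ _ _ _ →
  subst (λ z → ℚ.∣ z ∣ ℚ.≤ ε) (sym (ℚ.+-inverseʳ p)) (ℚ.<⇒≤ 0<ε)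

infixl 6 _+ʳ_ _-ʳ_
infixl 7 _*ʳ_
infix  8 -ʳ_

_+ʳ_ : ℝ → ℝ → ℝ
seq    (x +ʳ y) n = seq x n ℚ.+ seq y n
cauchy (x +ʳ y) ε 0<ε
  with N , p ← cauchy x (half ℚ.* ε) (0<½* 0<ε)
  with M , q ← cauchy y (half ℚ.* ε) (0<½* 0<ε)
  = N ℕ.⊔ M , λ i j hi hj →
    subst₂ ℚ._≤_
      (cong ℚ.∣_∣ (solve 4 (λ a b c d → (a :- c) :+ (b :- d) := (a :+ b) :- (c :+ d)) refl
                    (seq x i) (seq y i) (seq x j) (seq y j)))
      (½+½ ε)
      (ℚ.≤-trans (ℚ.∣p+q∣≤∣p∣+∣q∣ (seq x i ℚ.- seq x j) (seq y i ℚ.- seq y j))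
        (ℚ.+-mono-≤ (p i j (ℕ.m⊔n≤o⇒m≤o N M hi) (ℕ.m⊔n≤o⇒m≤o N M hj))
                    (q i j (ℕ.m⊔n≤o⇒n≤o N M hi) (ℕ.m⊔n≤o⇒n≤o N M hj))))
    where open +-*-Solver

-ʳ_ : ℝ → ℝ
seq    (-ʳ x) n = ℚ.- seq x n
cauchy (-ʳ x) ε 0<ε with N , p ← cauchy x ε 0<ε = N , λ i j hi hj →
  subst (λ z → ℚ.∣ z ∣ ℚ.≤ ε)
    (solve 2 (λ a b → b :- a := (:- a) :- (:- b)) refl (seq x i) (seq x j)) (p j i hj hi)
  where open +-*-Solver

_-ʳ_ : ℝ → ℝ → ℝ
x -ʳ y = x +ʳ (-ʳ y)

∣_∣ʳ : ℝ → ℝ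
seq    ∣ x ∣ʳ n = ℚ.∣ seq x n ∣
cauchy ∣ x ∣ʳ ε 0<ε with N , p ← cauchy x ε 0<ε = N , λ i j hi hj →
  ℚ.≤-trans (∣∣p∣-∣q∣∣≤∣p-q∣ (seq x i) (seq x j)) (p i j hi hj)

private
  bounded : ∀ x → ∃[ B ] 0ℚ ℚ.< B × ∃[ N ] ∀ n → N ℕ.≤ n → ℚ.∣ seq x n ∣ ℚ.≤ B
  bounded x with N , p ← cauchy x 1ℚ (ℚ.positive⁻¹ 1ℚ) =
    1ℚ ℚ.+ ℚ.∣ seq x N ∣ ,
    ℚ.+-mono-<-≤ (ℚ.positive⁻¹ 1ℚ) 0≤∣ seq x N ∣ ,
    N , λ n h → subst (λ z → ℚ.∣ z ∣ ℚ.≤ 1ℚ ℚ.+ ℚ.∣ seq x N ∣)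
      (solve 2 (λ a b → a :- b :+ b := a) refl (seq x n) (seq x N))
      (ℚ.≤-trans (ℚ.∣p+q∣≤∣p∣+∣q∣ (seq x n ℚ.- seq x N) (seq x N))
                 (ℚ.+-monoˡ-≤ ℚ.∣ seq x N ∣ (p n N h ℕ.≤-refl)))
    where open +-*-Solver

private
  cancel : ∀ b c → b ℚ.* c ≡ 1ℚ → ∀ d → b ℚ.* (c ℚ.* d) ≡ d
  cancel b c e d = trans (sym (ℚ.*-assoc b c d)) (trans (cong (ℚ._* d) e) (ℚ.*-identityˡ d))

  *-close : ∀ a b c d {B D e₁ e₂} → 0ℚ ℚ.≤ B → 0ℚ ℚ.≤ D →
            ℚ.∣ a ∣ ℚ.≤ B → ℚ.∣ d ∣ ℚ.≤ D → ℚ.∣ a ℚ.- c ∣ ℚ.≤ e₁ → ℚ.∣ b ℚ.- d ∣ ℚ.≤ e₂ →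
            ℚ.∣ a ℚ.* b ℚ.- c ℚ.* d ∣ ℚ.≤ B ℚ.* e₂ ℚ.+ D ℚ.* e₁
  *-close a b c d {B} {D} {e₁} {e₂} 0≤B 0≤D a≤ d≤ ac bd = begin
    ℚ.∣ a ℚ.* b ℚ.- c ℚ.* d ∣
      ≡⟨ cong ℚ.∣_∣ (solve 4 (λ a b c d → a :* b :- c :* d := a :* (b :- d) :+ d :* (a :- c))
                      refl a b c d) ⟩
    ℚ.∣ a ℚ.* (b ℚ.- d) ℚ.+ d ℚ.* (a ℚ.- c) ∣
      ≤⟨ ℚ.∣p+q∣≤∣p∣+∣q∣ (a ℚ.* (b ℚ.- d)) (d ℚ.* (a ℚ.- c)) ⟩
    ℚ.∣ a ℚ.* (b ℚ.- d) ∣ ℚ.+ ℚ.∣ d ℚ.* (a ℚ.- c) ∣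
      ≡⟨ cong₂ ℚ._+_ (ℚ.∣p*q∣≡∣p∣*∣q∣ a (b ℚ.- d)) (ℚ.∣p*q∣≡∣p∣*∣q∣ d (a ℚ.- c)) ⟩
    ℚ.∣ a ∣ ℚ.* ℚ.∣ b ℚ.- d ∣ ℚ.+ ℚ.∣ d ∣ ℚ.* ℚ.∣ a ℚ.- c ∣
      ≤⟨ ℚ.+-mono-≤ (*-mono-≤ {ℚ.∣ a ∣} {B} {ℚ.∣ b ℚ.- d ∣} {e₂} 0≤B 0≤∣ b ℚ.- d ∣ a≤ bd)
                    (*-mono-≤ {ℚ.∣ d ∣} {D} {ℚ.∣ a ℚ.- c ∣} {e₁} 0≤D 0≤∣ a ℚ.- c ∣ d≤ ac) ⟩
    B ℚ.* e₂ ℚ.+ D ℚ.* e₁ ∎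
    where
    open ℚ.≤-Reasoning
    open +-*-Solver

  *-close′ : ∀ a b c d B B′ D D′ ε → 0ℚ ℚ.< B → 0ℚ ℚ.< D → B ℚ.* B′ ≡ 1ℚ → D ℚ.* D′ ≡ 1ℚ →
             ℚ.∣ a ∣ ℚ.≤ B → ℚ.∣ d ∣ ℚ.≤ D →
             ℚ.∣ a ℚ.- c ∣ ℚ.≤ D′ ℚ.* (half ℚ.* ε) → ℚ.∣ b ℚ.- d ∣ ℚ.≤ B′ ℚ.* (half ℚ.* ε) →
             ℚ.∣ a ℚ.* b ℚ.- c ℚ.* d ∣ ℚ.≤ ε
  *-close′ a b c d B B′ D D′ ε 0<B 0<D BB′ DD′ a≤ d≤ ac bd = ℚ.≤-trans
    (*-close a b c d {B} {D} {D′ ℚ.* (half ℚ.* ε)} {B′ ℚ.* (half ℚ.* ε)}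
      (ℚ.<⇒≤ 0<B) (ℚ.<⇒≤ 0<D) a≤ d≤ ac bd)
    (ℚ.≤-reflexive (trans
      (cong₂ ℚ._+_ (cancel B B′ BB′ (half ℚ.* ε)) (cancel D D′ DD′ (half ℚ.* ε))) (½+½ ε)))

  *-cauchy : ∀ x y → IsCauchy (λ n → seq x n ℚ.* seq y n)
  *-cauchy x y ε 0<ε =
    let B , 0<B , N₁ , bx = bounded x
        D , 0<D , N₂ , by = bounded y
        B′ , 0<B′ , BB′ = invert B 0<B
        D′ , 0<D′ , DD′ = invert D 0<D
        N₃ , cx = cauchy x (D′ ℚ.* (half ℚ.* ε)) (0<* {D′} {half ℚ.* ε} 0<D′ (0<½* {ε} 0<ε))
        N₄ , cy = cauchy y (B′ ℚ.* (half ℚ.* ε)) (0<* {B′} {half ℚ.* ε} 0<B′ (0<½* {ε} 0<ε))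
    in (N₁ ℕ.⊔ N₂) ℕ.⊔ (N₃ ℕ.⊔ N₄) , λ i j hi hj →
      let hi₁ = ℕ.m⊔n≤o⇒m≤o N₁ N₂ (ℕ.m⊔n≤o⇒m≤o (N₁ ℕ.⊔ N₂) (N₃ ℕ.⊔ N₄) hi)
          hj₂ = ℕ.m⊔n≤o⇒n≤o N₁ N₂ (ℕ.m⊔n≤o⇒m≤o (N₁ ℕ.⊔ N₂) (N₃ ℕ.⊔ N₄) hj)
          hi′ = ℕ.m⊔n≤o⇒n≤o (N₁ ℕ.⊔ N₂) (N₃ ℕ.⊔ N₄) hi
          hj′ = ℕ.m⊔n≤o⇒n≤o (N₁ ℕ.⊔ N₂) (N₃ ℕ.⊔ N₄) hj
      in *-close′ (seq x i) (seq y i) (seq x j) (seq y j) B B′ D D′ ε 0<B 0<D BB′ DD′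
           (bx i hi₁) (by j hj₂)
           (cx i j (ℕ.m⊔n≤o⇒m≤o N₃ N₄ hi′) (ℕ.m⊔n≤o⇒m≤o N₃ N₄ hj′))
           (cy i j (ℕ.m⊔n≤o⇒n≤o N₃ N₄ hi′) (ℕ.m⊔n≤o⇒n≤o N₃ N₄ hj′))

_*ʳ_ : ℝ → ℝ → ℝ
seq    (x *ʳ y) n = seq x n ℚ.* seq y n
cauchy (x *ʳ y)   = *-cauchy x y

private
  *-÷₀-cancel : ∀ a → a ≢ 0ℚ → a ℚ.* (1ℚ ÷₀ a) ≡ 1ℚ
  *-÷₀-cancel a a≢0 with a ℚ.≟ 0ℚ
  ... | yes e  = ⊥-elim (a≢0 e)
  ... | no a≢0 = trans (cong (a ℚ.*_) (ℚ.*-identityˡ _)) (ℚ.*-inverseʳ a {{ℚ.≢-nonZero a≢0}})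

  apart⇒≢0 : ∀ {a δ} → 0ℚ ℚ.< δ → δ ℚ.≤ ℚ.∣ a ∣ → a ≢ 0ℚ
  apart⇒≢0 0<δ δ≤∣a∣ refl = ℚ.<-irrefl refl (ℚ.<-≤-trans 0<δ δ≤∣a∣)

  ∣1/a∣≤ : ∀ a δ δ′ → 0ℚ ℚ.< δ → 0ℚ ℚ.< δ′ → δ ℚ.* δ′ ≡ 1ℚ → δ ℚ.≤ ℚ.∣ a ∣ →
           ℚ.∣ 1ℚ ÷₀ a ∣ ℚ.≤ δ′
  ∣1/a∣≤ a δ δ′ 0<δ 0<δ′ δδ′ δ≤∣a∣ = begin
    ∣1/a∣                           ≡⟨ ℚ.*-identityʳ ∣1/a∣ ⟨
    ∣1/a∣ ℚ.* 1ℚ                    ≡⟨ cong (∣1/a∣ ℚ.*_) δδ′ ⟨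
    ∣1/a∣ ℚ.* (δ ℚ.* δ′)            ≤⟨ ℚ.*-monoˡ-≤-nonNeg ∣1/a∣ {{ℚ.∣-∣-nonNeg (1ℚ ÷₀ a)}}
                                         (ℚ.*-monoʳ-≤-nonNeg δ′ {{ℚ.nonNegative (ℚ.<⇒≤ 0<δ′)}} δ≤∣a∣) ⟩
    ∣1/a∣ ℚ.* (ℚ.∣ a ∣ ℚ.* δ′)      ≡⟨ solve 3 (λ p q r → p :* (q :* r) := (q :* p) :* r) refl ∣1/a∣ ℚ.∣ a ∣ δ′ ⟩
    ℚ.∣ a ∣ ℚ.* ∣1/a∣ ℚ.* δ′        ≡⟨ cong (ℚ._* δ′) (ℚ.∣p*q∣≡∣p∣*∣q∣ a (1ℚ ÷₀ a)) ⟨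
    ℚ.∣ a ℚ.* (1ℚ ÷₀ a) ∣ ℚ.* δ′    ≡⟨ cong (λ z → ℚ.∣ z ∣ ℚ.* δ′) (*-÷₀-cancel a (apart⇒≢0 0<δ δ≤∣a∣)) ⟩
    1ℚ ℚ.* δ′                       ≡⟨ ℚ.*-identityˡ δ′ ⟩
    δ′                              ∎
    where
    open ℚ.≤-Reasoning
    open +-*-Solver
    ∣1/a∣ = ℚ.∣ 1ℚ ÷₀ a ∣

  1/a-1/b : ∀ a b → a ≢ 0ℚ → b ≢ 0ℚ →
            1ℚ ÷₀ a ℚ.- 1ℚ ÷₀ b ≡ (1ℚ ÷₀ a) ℚ.* (1ℚ ÷₀ b) ℚ.* (b ℚ.- a)
  1/a-1/b a b a≢0 b≢0 = sym (begin
    a′ ℚ.* b′ ℚ.* (b ℚ.- a)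
      ≡⟨ solve 4 (λ a b a′ b′ → a′ :* b′ :* (b :- a) := (b :* b′) :* a′ :- (a :* a′) :* b′) refl a b a′ b′ ⟩
    (b ℚ.* b′) ℚ.* a′ ℚ.- (a ℚ.* a′) ℚ.* b′
      ≡⟨ cong₂ (λ p q → p ℚ.* a′ ℚ.- q ℚ.* b′) (*-÷₀-cancel b b≢0) (*-÷₀-cancel a a≢0) ⟩
    1ℚ ℚ.* a′ ℚ.- 1ℚ ℚ.* b′
      ≡⟨ cong₂ ℚ._-_ (ℚ.*-identityˡ a′) (ℚ.*-identityˡ b′) ⟩
    a′ ℚ.- b′ ∎)
    where
    open ≡-Reasoning
    open +-*-Solver
    a′ = 1ℚ ÷₀ a
    b′ = 1ℚ ÷₀ b

  1/-close : ∀ a b δ δ′ ε → 0ℚ ℚ.< δ → 0ℚ ℚ.< δ′ → δ ℚ.* δ′ ≡ 1ℚ → δ ℚ.≤ ℚ.∣ a ∣ → δ ℚ.≤ ℚ.∣ b ∣ →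
             ℚ.∣ b ℚ.- a ∣ ℚ.≤ δ ℚ.* δ ℚ.* ε → ℚ.∣ 1ℚ ÷₀ a ℚ.- 1ℚ ÷₀ b ∣ ℚ.≤ ε
  1/-close a b δ δ′ ε 0<δ 0<δ′ δδ′ fa fb close = begin
    ℚ.∣ a′ ℚ.- b′ ∣
      ≡⟨ cong ℚ.∣_∣ (1/a-1/b a b (apart⇒≢0 0<δ fa) (apart⇒≢0 0<δ fb)) ⟩
    ℚ.∣ a′ ℚ.* b′ ℚ.* (b ℚ.- a) ∣
      ≡⟨ trans (ℚ.∣p*q∣≡∣p∣*∣q∣ (a′ ℚ.* b′) (b ℚ.- a))
               (cong (ℚ._* ℚ.∣ b ℚ.- a ∣) (ℚ.∣p*q∣≡∣p∣*∣q∣ a′ b′)) ⟩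
    ℚ.∣ a′ ∣ ℚ.* ℚ.∣ b′ ∣ ℚ.* ℚ.∣ b ℚ.- a ∣
      ≤⟨ *-mono-≤ {ℚ.∣ a′ ∣ ℚ.* ℚ.∣ b′ ∣} {δ′ ℚ.* δ′} (ℚ.<⇒≤ (0<* {δ′} {δ′} 0<δ′ 0<δ′)) 0≤∣ b ℚ.- a ∣
           (*-mono-≤ {ℚ.∣ a′ ∣} {δ′} {ℚ.∣ b′ ∣} {δ′} (ℚ.<⇒≤ 0<δ′) 0≤∣ b′ ∣
             (∣1/a∣≤ a δ δ′ 0<δ 0<δ′ δδ′ fa) (∣1/a∣≤ b δ δ′ 0<δ 0<δ′ δδ′ fb)) close ⟩
    δ′ ℚ.* δ′ ℚ.* (δ ℚ.* δ ℚ.* ε)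
      ≡⟨ solve 3 (λ d e x → d :* d :* (e :* e :* x) := e :* d :* (e :* d :* x)) refl δ′ δ ε ⟩
    δ ℚ.* δ′ ℚ.* (δ ℚ.* δ′ ℚ.* ε)
      ≡⟨ cong (λ z → z ℚ.* (z ℚ.* ε)) δδ′ ⟩
    1ℚ ℚ.* (1ℚ ℚ.* ε)
      ≡⟨ trans (ℚ.*-identityˡ (1ℚ ℚ.* ε)) (ℚ.*-identityˡ ε) ⟩
    ε ∎
    where
    open ℚ.≤-Reasoning
    open +-*-Solver
    a′ = 1ℚ ÷₀ a
    b′ = 1ℚ ÷₀ b

  inv-cauchy : ∀ x → x #0 → IsCauchy (λ n → 1ℚ ÷₀ seq x n)
  inv-cauchy x (δ , 0<δ , N , far) ε 0<ε =
    let δ′ , 0<δ′ , δδ′ = invert δ 0<δ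
        M , c = cauchy x (δ ℚ.* δ ℚ.* ε) (0<* {δ ℚ.* δ} {ε} (0<* {δ} {δ} 0<δ 0<δ) 0<ε)
    in N ℕ.⊔ M , λ i j hi hj →
      1/-close (seq x i) (seq x j) δ δ′ ε 0<δ 0<δ′ δδ′
        (far i (ℕ.m⊔n≤o⇒m≤o N M hi)) (far j (ℕ.m⊔n≤o⇒m≤o N M hj))
        (c j i (ℕ.m⊔n≤o⇒n≤o N M hj) (ℕ.m⊔n≤o⇒n≤o N M hi))

-- The terms of x are eventually nonzero, so the zero case of ÷₀ is
-- irrelevant.
inv : (x : ℝ) → x #0 → ℝ
seq    (inv x _)   n = 1ℚ ÷₀ seq x n
cauchy (inv x x#0)   = inv-cauchy x x#0

1ʳ : ℝ
1ʳ = fromℚ 1ℚ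

------------------------------------------------------------------------
-- Limits, sums of series, derivatives
------------------------------------------------------------------------

infix 4 _⟶_
_⟶_ : (ℕ → ℚ) → ℝ → Set
a ⟶ L = ∀ ε → 0ℚ ℚ.< ε → ∃[ N ] ∀ n → N ℕ.≤ n → ∣ fromℚ (a n) -ʳ L ∣ʳ <ʳ fromℚ ε

-- The series A converges at x with sum s.
HasSum : PowerSeries → ℚ → ℝ → Set
HasSum A x s = partialSum A x ⟶ s

-- f is a real function with domain D.
HasDerivative : {D : ℝ → Set} (f : ∀ u → D u → ℝ) (u : ℝ) → D u → ℝ → Set
HasDerivative {D} f u du f′ =
  ∀ ε → 0ℚ ℚ.< ε → ∃[ δ ] 0ℚ ℚ.< δ × (∀ w (dw : D w) → ∣ w -ʳ u ∣ʳ <ʳ fromℚ δ →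
    ∣ (f w dw -ʳ f u du) -ʳ f′ *ʳ (w -ʳ u) ∣ʳ ≤ʳ fromℚ ε *ʳ ∣ w -ʳ u ∣ʳ)

------------------------------------------------------------------------
-- Φᵣ and its derivative
------------------------------------------------------------------------

≠1 : ℝ → Set
≠1 u = (1ʳ -ʳ u) #0

Φ : ℚ → (u : ℝ) → ≠1 u → ℝ
Φ r u u≠1 = u +ʳ fromℚ r *ʳ inv (1ʳ -ʳ u) u≠1

∂Φ : ℚ → (u : ℝ) → ≠1 u → ℝ
∂Φ r u u≠1 = 1ʳ +ʳ fromℚ r *ʳ (inv (1ʳ -ʳ u) u≠1 *ʳ inv (1ʳ -ʳ u) u≠1)

{-# OPTIONS --safe #-}
-- Scale the coefficients by rⁿ and let aₙ, hₙ, uₙ, vₙ be those of G, H_k,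
-- H_{k+1}, G_k, so that aₙ = C_{n-1}/4ⁿ, h = u + v, and vₙ = (u ⋆ v)ₙ,
-- aₙ = (a ⋆ a)ₙ for n ≥ 2, where ⋆ is the Cauchy product.  All of them are
-- dominated by a, and a sums to ½ with tail τ/2 tending to 0.  For i < K replace
-- a_{n-i} by aₙ in the terms i and n - i of (u ⋆ v)ₙ and drop the middle terms:
-- the error is largest for a ⋆ a, where it is aₙ τ_K.  Hence, with ρ = u/a and
-- θ = v/a,
--   θₙ = Σ_{i<K} (uᵢ θ_{n-i} + vᵢ ρ_{n-i}) + O(τ_K).
-- As ρ + θ = h/a and Σ |uᵢ - vᵢ| ≤ ½, this contracts the oscillation of θ when
-- that of h/a is small, so convergence of the ratios passes from k to k + 1.  In
-- the limit θ (1 - H_{k+1}(r)) = ρ G_k(r), while the equation for v summed at r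
-- gives G_k(r) (1 - H_{k+1}(r)) = r; these are the two recursions.
module Submission where

open import Defs
open import Data.Nat.Base using (ℕ; suc; _∸_; _<_; NonTrivial)
open import Data.Product.Base using (_×_; Σ-syntax)

open import Algebra.Definitions.RawSemiring using (_^_)
open import Data.Bool.Base using (Bool; true; false; if_then_else_)
open import Data.Empty using (⊥-elim)
open import Data.Fin.Base using (Fin; toℕ; fromℕ)
import Data.Fin.Properties as Fin
import Data.Integer.Base as ℤ
import Data.Integer.Properties as ℤ
open import Data.List.Base
  using (List; []; _∷_; _++_; length; map; filter; upTo; applyUpTo; allFin; tabulate; concat; concatMap; cartesianProductWith)
open import Data.List.Properties using (map-cong; map-cong-local; map-++; map-∘; map-tabulate; map-upTo; map-applyUpTo)
import Data.List.Relation.Unary.All.Properties as All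
open import Data.Nat.Base as ℕ using (zero; z≤n; s≤s)
open import Data.Nat.ListAction using (sum)
open import Data.Nat.ListAction.Properties using (sum-++)
import Data.Nat.Properties as ℕ
open import Data.Nat.Solver using () renaming (module +-*-Solver to ℕ-Solver)
open import Data.Product.Base using (_,_; ∃-syntax; proj₁; proj₂)
open import Data.Rational.Base as ℚ using (ℚ; 0ℚ; 1ℚ; ½; _+_; _*_; _-_; -_; ∣_∣; _≤_)
import Data.Rational.Properties as ℚ
open import Data.Rational.Solver using (module +-*-Solver)
import Data.Rational.Unnormalised.Base as ℚᵘ
import Data.Rational.Unnormalised.Properties as ℚᵘ
open import Data.Sum.Base using (inj₁; inj₂)
open import Data.Vec.Base using ([]; _∷_; take; drop)
open import Function.Base using (id; _∘_)
open import Relation.Binary.Definitions using (tri<; tri≈; tri>)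
open import Relation.Binary.PropositionalEquality
  using (_≡_; _≢_; refl; sym; trans; cong; cong₂; subst; subst₂; module ≡-Reasoning)
open import Relation.Nullary using (¬_; Dec; yes; no; does)
open import Relation.Nullary.Decidable using (dec-true; dec-false)
open +-*-Solver using (solve; _:+_; _:*_; _:-_; :-_; _:=_; con)
open ℕ-Solver using () renaming (solve to ℕ-solve; _:+_ to _:+ℕ_; _:=_ to _:=ℕ_)

-- Ordered field arithmetic

-- The radius r is critical: the discriminant 1 - 4mx of G = mx + G² vanishes there, so G(r) = ½ is
-- a double root and aₙ decays only like n^(-3/2). No geometric tail bound is available; what
-- remains is that `a ⋆ a` agrees with `a` from index 2 on, which makes the linearisation error of
-- `a ⋆ a` exactly computable. That the tails tend to 0 is drawn from the linear recurrence n aₙ =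
-- (n - 3/2) aₙ₋₁: it evaluates the tail in closed form as a central binomial coefficient over a
-- power of 4, and bounding its square gives a rate without square roots.
--
-- Reals are Cauchy sequences, so comparing upper and lower limits does not yield a limit; a modulus
-- has to be produced. Hence the explicit oscillation bounds, shrunk by a fixed factor. The bare
-- factor is ½; ¾ leaves room for the error terms. The equations between limits are likewise kept as
-- error estimates at finite n, since `≈` compares the n-th terms of the sequences that represent
-- the two reals.

≤-by : ∀ {p q d} → 0ℚ ≤ d → q ≡ p + d → p ≤ q
≤-by {p} {q} {d} 0≤d e = begin
  p       ≡⟨ ℚ.+-identityʳ p ⟨
  p + 0ℚ  ≤⟨ ℚ.+-monoʳ-≤ p 0≤d ⟩
  p + d   ≡⟨ e ⟨
  q       ∎
  where open ℚ.≤-Reasoning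

p≤q⇒0≤q-p : ∀ {p q} → p ≤ q → 0ℚ ≤ q - p
p≤q⇒0≤q-p {p} {q} p≤q =
  subst (_≤ q - p) (ℚ.+-inverseʳ p) (ℚ.+-monoˡ-≤ (- p) p≤q)

0≤+ : ∀ {p q} → 0ℚ ≤ p → 0ℚ ≤ q → 0ℚ ≤ p + q
0≤+ = ℚ.+-mono-≤

0≤* : ∀ {p q} → 0ℚ ≤ p → 0ℚ ≤ q → 0ℚ ≤ p * q
0≤* {p} {q} 0≤p 0≤q =
  ℚ.nonNegative⁻¹ (p * q)
    {{ℚ.nonNeg*nonNeg⇒nonNeg p {{ℚ.nonNegative 0≤p}} q {{ℚ.nonNegative 0≤q}}}}

0<* : ∀ {p q} → 0ℚ ℚ.< p → 0ℚ ℚ.< q → 0ℚ ℚ.< p * q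
0<* {p} {q} 0<p 0<q =
  ℚ.positive⁻¹ (p * q) {{ℚ.pos*pos⇒pos p {{ℚ.positive 0<p}} q {{ℚ.positive 0<q}}}}

*-mono-≤ : ∀ {p q r s} → 0ℚ ≤ r → 0ℚ ≤ q → p ≤ q → r ≤ s → p * r ≤ q * s
*-mono-≤ {p} {q} {r} {s} 0≤r 0≤q p≤q r≤s = ≤-by
  (0≤+ (0≤* (p≤q⇒0≤q-p p≤q) 0≤r) (0≤* 0≤q (p≤q⇒0≤q-p r≤s)))
  (solve 4 (λ p q r s → q :* s := p :* r :+ ((q :- p) :* r :+ q :* (s :- r))) refl p q r s)

p≤∣p∣ : ∀ p → p ≤ ∣ p ∣
p≤∣p∣ p with ℚ.≤-total 0ℚ p
... | inj₁ 0≤p = ℚ.≤-reflexive (sym (ℚ.0≤p⇒∣p∣≡p 0≤p))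
... | inj₂ p≤0 = ℚ.≤-trans p≤0 (ℚ.0≤∣p∣ p)

∣p∣≤ : ∀ {p q} → p ≤ q → - p ≤ q → ∣ p ∣ ≤ q
∣p∣≤ {p} a b with ℚ.∣p∣≡p∨∣p∣≡-p p
... | inj₁ e rewrite e = a
... | inj₂ e rewrite e = b

∣p-q∣≡∣q-p∣ : ∀ p q → ∣ p - q ∣ ≡ ∣ q - p ∣
∣p-q∣≡∣q-p∣ p q = trans (sym (ℚ.∣-p∣≡∣p∣ (p - q)))
  (cong ∣_∣ (solve 2 (λ p q → :- (p :- q) := q :- p) refl p q))

∣p+q∣≤ : ∀ {p q a b} → ∣ p ∣ ≤ a → ∣ q ∣ ≤ b → ∣ p + q ∣ ≤ a + b
∣p+q∣≤ {p} {q} p≤a q≤b = ℚ.≤-trans (ℚ.∣p+q∣≤∣p∣+∣q∣ p q) (ℚ.+-mono-≤ p≤a q≤b)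

∣p*q∣≤ : ∀ {p q a b} → ∣ p ∣ ≤ a → ∣ q ∣ ≤ b → ∣ p * q ∣ ≤ a * b
∣p*q∣≤ {p} {q} p≤a q≤b = ℚ.≤-trans (ℚ.≤-reflexive (ℚ.∣p*q∣≡∣p∣*∣q∣ p q))
  (*-mono-≤ (ℚ.0≤∣p∣ q) (ℚ.≤-trans (ℚ.0≤∣p∣ p) p≤a) p≤a q≤b)

0≤p⇒∣p∣≤ : ∀ {p a} → 0ℚ ≤ p → p ≤ a → ∣ p ∣ ≤ a
0≤p⇒∣p∣≤ 0≤p p≤a = subst (_≤ _) (sym (ℚ.0≤p⇒∣p∣≡p 0≤p)) p≤a

*-cancelˡ-≤ : ∀ {p q} r → 0ℚ ℚ.< r → r * p ≤ r * q → p ≤ q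
*-cancelˡ-≤ r 0<r = ℚ.*-cancelˡ-≤-pos r {{ℚ.positive 0<r}}

0<½* : ∀ {ε} → 0ℚ ℚ.< ε → 0ℚ ℚ.< ½ * ε
0<½* = 0<* (ℚ.positive⁻¹ ½)

-- Finite sums and Cauchy products

∑ : ℕ → (ℕ → ℚ) → ℚ
∑ zero    f = 0ℚ
∑ (suc n) f = ∑ n f + f n

infixl 7 _⋆_
_⋆_ : (ℕ → ℚ) → (ℕ → ℚ) → ℕ → ℚ
(f ⋆ g) n = ∑ (suc n) (λ i → f i * g (n ∸ i))

∑-cong : ∀ n {f g : ℕ → ℚ} → (∀ i → i < n → f i ≡ g i) → ∑ n f ≡ ∑ n g
∑-cong zero    e = refl
∑-cong (suc n) e = cong₂ _+_ (∑-cong n (λ i i<n → e i (ℕ.m<n⇒m<1+n i<n))) (e n ℕ.≤-refl)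

∑-mono-≤ : ∀ n {f g : ℕ → ℚ} → (∀ i → i < n → f i ≤ g i) → ∑ n f ≤ ∑ n g
∑-mono-≤ zero    e = ℚ.≤-refl
∑-mono-≤ (suc n) e = ℚ.+-mono-≤ (∑-mono-≤ n (λ i i<n → e i (ℕ.m<n⇒m<1+n i<n))) (e n ℕ.≤-refl)

0≤∑ : ∀ n {f} → (∀ i → i < n → 0ℚ ≤ f i) → 0ℚ ≤ ∑ n f
0≤∑ zero    e = ℚ.≤-refl
0≤∑ (suc n) e = 0≤+ (0≤∑ n (λ i i<n → e i (ℕ.m<n⇒m<1+n i<n))) (e n ℕ.≤-refl)

∣∑∣≤ : ∀ n {f g} → (∀ i → i < n → ∣ f i ∣ ≤ g i) → ∣ ∑ n f ∣ ≤ ∑ n g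
∣∑∣≤ zero    e = ℚ.≤-refl
∣∑∣≤ (suc n) e = ∣p+q∣≤ (∣∑∣≤ n (λ i i<n → e i (ℕ.m<n⇒m<1+n i<n))) (e n ℕ.≤-refl)

∑-distrib-+ : ∀ n f g → ∑ n (λ i → f i + g i) ≡ ∑ n f + ∑ n g
∑-distrib-+ zero    f g = refl
∑-distrib-+ (suc n) f g = trans (cong (_+ (f n + g n)) (∑-distrib-+ n f g))
  (solve 4 (λ a b c d → a :+ b :+ (c :+ d) := a :+ c :+ (b :+ d)) refl (∑ n f) (∑ n g) (f n) (g n))

*-distribˡ-∑ : ∀ c n f → ∑ n (λ i → c * f i) ≡ c * ∑ n f
*-distribˡ-∑ c zero    f = sym (ℚ.*-zeroʳ c)
*-distribˡ-∑ c (suc n) f = trans (cong (_+ c * f n) (*-distribˡ-∑ c n f))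
  (sym (ℚ.*-distribˡ-+ c (∑ n f) (f n)))

∑-split : ∀ m n f → ∑ (m ℕ.+ n) f ≡ ∑ m f + ∑ n (λ i → f (m ℕ.+ i))
∑-split m zero    f rewrite ℕ.+-identityʳ m = sym (ℚ.+-identityʳ (∑ m f))
∑-split m (suc n) f rewrite ℕ.+-suc m n =
  trans (cong (_+ f (m ℕ.+ n)) (∑-split m n f)) (ℚ.+-assoc (∑ m f) _ _)

∑-head : ∀ n f → ∑ (suc n) f ≡ f 0 + ∑ n (f ∘ suc)
∑-head n f = trans (∑-split 1 n f) (cong (_+ ∑ n (f ∘ suc)) (ℚ.+-identityˡ (f 0)))

∑-reverse : ∀ n f → ∑ n f ≡ ∑ n (λ i → f (n ∸ suc i))
∑-reverse zero    f = refl
∑-reverse (suc n) f = begin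
  ∑ n f + f n                          ≡⟨ cong (_+ f n) (∑-reverse n f) ⟩
  ∑ n (λ i → f (n ∸ suc i)) + f n      ≡⟨ ℚ.+-comm _ (f n) ⟩
  f n + ∑ n (λ i → f (n ∸ suc i))      ≡⟨ ∑-head n (λ i → f (n ∸ i)) ⟨
  ∑ (suc n) (λ i → f (n ∸ i))          ∎
  where open ≡-Reasoning

-- The last K terms are reversed by i ↦ n - i, so that both ends of the product pair a factor of
-- index i < K with one of index n - i.
⋆-split : ∀ f g n K l → suc n ≡ K ℕ.+ (l ℕ.+ K) →
  (f ⋆ g) n ≡ ∑ K (λ i → f i * g (n ∸ i) + g i * f (n ∸ i)) + ∑ l (λ i → f (K ℕ.+ i) * g (n ∸ (K ℕ.+ i)))
⋆-split f g n K l e = begin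
  ∑ (suc n) F
    ≡⟨ cong (λ s → ∑ s F) e ⟩
  ∑ (K ℕ.+ (l ℕ.+ K)) F
    ≡⟨ trans (∑-split K (l ℕ.+ K) F) (cong (∑ K F +_) (∑-split l K (λ i → F (K ℕ.+ i)))) ⟩
  ∑ K F + (mid + ∑ K (λ i → F (K ℕ.+ (l ℕ.+ i))))
    ≡⟨ cong (λ s → ∑ K F + (mid + s)) (trans (∑-reverse K _) (∑-cong K last)) ⟩
  ∑ K F + (mid + ∑ K (λ i → g i * f (n ∸ i)))
    ≡⟨ solve 3 (λ a b c → a :+ (b :+ c) := a :+ c :+ b) refl (∑ K F) mid _ ⟩
  ∑ K F + ∑ K (λ i → g i * f (n ∸ i)) + mid
    ≡⟨ cong (_+ mid) (∑-distrib-+ K F _) ⟨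
  ∑ K (λ i → F i + g i * f (n ∸ i)) + mid ∎
  where
  open ≡-Reasoning
  F : ℕ → ℚ
  F i = f i * g (n ∸ i)
  mid = ∑ l (λ i → F (K ℕ.+ i))
  last : ∀ i → i < K → F (K ℕ.+ (l ℕ.+ (K ∸ suc i))) ≡ g i * f (n ∸ i)
  last i i<K = trans (cong F index) (trans (cong (λ s → f (n ∸ i) * g s) (ℕ.m∸[m∸n]≡n i≤n))
                                           (ℚ.*-comm (f (n ∸ i)) (g i)))
    where
    i≤n : i ℕ.≤ n
    i≤n = ℕ.≤-pred (subst (suc i ℕ.≤_) (sym e) (ℕ.≤-trans i<K (ℕ.m≤m+n K (l ℕ.+ K))))
    index : K ℕ.+ (l ℕ.+ (K ∸ suc i)) ≡ n ∸ i
    index = begin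
      K ℕ.+ (l ℕ.+ (K ∸ suc i))  ≡⟨ cong (K ℕ.+_) (ℕ.+-∸-assoc l i<K) ⟨
      K ℕ.+ ((l ℕ.+ K) ∸ suc i)  ≡⟨ ℕ.+-∸-assoc K (ℕ.≤-trans i<K (ℕ.m≤n+m K l)) ⟨
      K ℕ.+ (l ℕ.+ K) ∸ suc i    ≡⟨ cong (_∸ suc i) e ⟨
      n ∸ i                      ∎

-- The last sum consists of the terms f i * g j with i, j < n ≤ i + j.
∑*∑≡∑⋆+rest : ∀ f g n → ∑ n f * ∑ n g ≡ ∑ n (f ⋆ g) + ∑ n (λ i → f i * ∑ i (λ j → g ((n ∸ i) ℕ.+ j)))
∑*∑≡∑⋆+rest f g n = begin
  ∑ n f * ∑ n g
    ≡⟨ trans (ℚ.*-comm (∑ n f) (∑ n g)) (sym (*-distribˡ-∑ (∑ n g) n f)) ⟩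
  ∑ n (λ i → ∑ n g * f i)
    ≡⟨ ∑-cong n (λ i i<n → trans (ℚ.*-comm (∑ n g) (f i)) (trans
         (cong (λ s → f i * s) (trans (cong (λ s → ∑ s g) (sym (ℕ.m∸n+n≡m (ℕ.<⇒≤ i<n)))) (∑-split (n ∸ i) i g)))
         (ℚ.*-distribˡ-+ (f i) _ _))) ⟩
  ∑ n (λ i → f i * ∑ (n ∸ i) g + f i * ∑ i (λ j → g ((n ∸ i) ℕ.+ j)))
    ≡⟨ ∑-distrib-+ n _ _ ⟩
  ∑ n (λ i → f i * ∑ (n ∸ i) g) + rest
    ≡⟨ cong (_+ rest) (triangle n) ⟩
  ∑ n (f ⋆ g) + rest ∎
  where
  open ≡-Reasoning
  rest = ∑ n (λ i → f i * ∑ i (λ j → g ((n ∸ i) ℕ.+ j)))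
  triangle : ∀ n → ∑ n (λ i → f i * ∑ (n ∸ i) g) ≡ ∑ n (f ⋆ g)
  triangle zero    = refl
  triangle (suc n) = begin
    ∑ n (λ i → f i * ∑ (suc n ∸ i) g) + f n * ∑ (suc n ∸ n) g
      ≡⟨ cong₂ _+_ (∑-cong n (λ i i<n → step i (ℕ.<⇒≤ i<n))) (step n ℕ.≤-refl) ⟩
    ∑ (suc n) (λ i → f i * ∑ (n ∸ i) g + f i * g (n ∸ i))
      ≡⟨ ∑-distrib-+ (suc n) (λ i → f i * ∑ (n ∸ i) g) (λ i → f i * g (n ∸ i)) ⟩
    ∑ n (λ i → f i * ∑ (n ∸ i) g) + f n * ∑ (n ∸ n) g + (f ⋆ g) n
      ≡⟨ cong (_+ (f ⋆ g) n) (trans (cong (λ s → ∑ n (λ i → f i * ∑ (n ∸ i) g) + f n * ∑ s g) (ℕ.n∸n≡0 n))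
           (trans (cong (∑ n (λ i → f i * ∑ (n ∸ i) g) +_) (ℚ.*-zeroʳ (f n)))
                  (ℚ.+-identityʳ (∑ n (λ i → f i * ∑ (n ∸ i) g))))) ⟩
    ∑ n (λ i → f i * ∑ (n ∸ i) g) + (f ⋆ g) n
      ≡⟨ cong (_+ (f ⋆ g) n) (triangle n) ⟩
    ∑ n (f ⋆ g) + (f ⋆ g) n ∎
    where
    step : ∀ i → i ℕ.≤ n → f i * ∑ (suc n ∸ i) g ≡ f i * ∑ (n ∸ i) g + f i * g (n ∸ i)
    step i i≤n rewrite ℕ.+-∸-assoc 1 i≤n = ℚ.*-distribˡ-+ (f i) _ _

-- Natural numbers in ℚ

fromℕ→ℚ-toℚᵘ : ∀ n → ℚ.toℚᵘ (fromℕ→ℚ n) ℚᵘ.≃ ℚᵘ.mkℚᵘ (ℤ.+ n) 0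
fromℕ→ℚ-toℚᵘ n = ℚ.toℚᵘ-fromℚᵘ (ℚᵘ.mkℚᵘ (ℤ.+ n) 0)

fromℕ→ℚ-+ : ∀ m n → fromℕ→ℚ (m ℕ.+ n) ≡ fromℕ→ℚ m + fromℕ→ℚ n
fromℕ→ℚ-+ m n = ℚ.toℚᵘ-injective (begin
  ℚ.toℚᵘ (fromℕ→ℚ (m ℕ.+ n))
    ≈⟨ fromℕ→ℚ-toℚᵘ (m ℕ.+ n) ⟩
  ℚᵘ.mkℚᵘ (ℤ.+ (m ℕ.+ n)) 0
    ≈⟨ ℚᵘ.*≡* (cong (ℤ._* ℤ.1ℤ) (cong₂ ℤ._+_ (sym (ℤ.*-identityʳ (ℤ.+ m))) (sym (ℤ.*-identityʳ (ℤ.+ n))))) ⟩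
  ℚᵘ.mkℚᵘ (ℤ.+ m) 0 ℚᵘ.+ ℚᵘ.mkℚᵘ (ℤ.+ n) 0
    ≈⟨ ℚᵘ.+-cong (fromℕ→ℚ-toℚᵘ m) (fromℕ→ℚ-toℚᵘ n) ⟨
  ℚ.toℚᵘ (fromℕ→ℚ m) ℚᵘ.+ ℚ.toℚᵘ (fromℕ→ℚ n)
    ≈⟨ ℚ.toℚᵘ-homo-+ (fromℕ→ℚ m) (fromℕ→ℚ n) ⟨
  ℚ.toℚᵘ (fromℕ→ℚ m + fromℕ→ℚ n) ∎)
  where open ℚᵘ.≃-Reasoning

fromℕ→ℚ-* : ∀ m n → fromℕ→ℚ (m ℕ.* n) ≡ fromℕ→ℚ m * fromℕ→ℚ n
fromℕ→ℚ-* zero    n = sym (ℚ.*-zeroˡ (fromℕ→ℚ n))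
fromℕ→ℚ-* (suc m) n = begin
  fromℕ→ℚ (n ℕ.+ m ℕ.* n)                 ≡⟨ fromℕ→ℚ-+ n (m ℕ.* n) ⟩
  fromℕ→ℚ n + fromℕ→ℚ (m ℕ.* n)           ≡⟨ cong (fromℕ→ℚ n +_) (fromℕ→ℚ-* m n) ⟩
  fromℕ→ℚ n + fromℕ→ℚ m * fromℕ→ℚ n       ≡⟨ solve 2 (λ m n → n :+ m :* n := (con 1ℚ :+ m) :* n) refl (fromℕ→ℚ m) (fromℕ→ℚ n) ⟩
  (1ℚ + fromℕ→ℚ m) * fromℕ→ℚ n            ≡⟨ cong (_* fromℕ→ℚ n) (fromℕ→ℚ-+ 1 m) ⟨
  fromℕ→ℚ (suc m) * fromℕ→ℚ n             ∎
  where open ≡-Reasoning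

0≤fromℕ→ℚ : ∀ n → 0ℚ ≤ fromℕ→ℚ n
0≤fromℕ→ℚ n = ℚ.nonNegative⁻¹ (fromℕ→ℚ n) {{ℚ.normalize-nonNeg n 1}}

1≤fromℕ→ℚ-suc : ∀ n → 1ℚ ≤ fromℕ→ℚ (suc n)
1≤fromℕ→ℚ-suc n = ≤-by (0≤fromℕ→ℚ n) (fromℕ→ℚ-+ 1 n)

0<fromℕ→ℚ-suc : ∀ n → 0ℚ ℚ.< fromℕ→ℚ (suc n)
0<fromℕ→ℚ-suc n = ℚ.<-≤-trans (ℚ.positive⁻¹ 1ℚ) (1≤fromℕ→ℚ-suc n)

fromℕ→ℚ-mono-≤ : ∀ {m n} → m ℕ.≤ n → fromℕ→ℚ m ≤ fromℕ→ℚ n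
fromℕ→ℚ-mono-≤ {m} {n} m≤n = ≤-by (0≤fromℕ→ℚ (n ∸ m))
  (trans (cong fromℕ→ℚ (sym (ℕ.m+[n∸m]≡n m≤n))) (fromℕ→ℚ-+ m (n ∸ m)))

archimedean : ∀ p → ∃[ n ] p ≤ fromℕ→ℚ n
archimedean p = ℤ.∣ ℚᵘ.↥ (ℚ.toℚᵘ p) ∣ , ℚ.toℚᵘ-cancel-≤ (ℚᵘ.≤-trans (bound (ℚ.toℚᵘ p))
  (ℚᵘ.≤-reflexive (ℚᵘ.≃-sym (fromℕ→ℚ-toℚᵘ ℤ.∣ ℚᵘ.↥ (ℚ.toℚᵘ p) ∣))))
  where
  bound : ∀ p → p ℚᵘ.≤ ℚᵘ.mkℚᵘ (ℤ.+ ℤ.∣ ℚᵘ.↥ p ∣) 0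
  bound (ℚᵘ.mkℚᵘ (ℤ.+ n) d)     = ℚᵘ.*≤* (ℤ.*-monoˡ-≤-nonNeg (ℤ.+ n) (ℤ.+≤+ (s≤s z≤n)))
  bound (ℚᵘ.mkℚᵘ (ℤ.-[1+ n ]) d) = ℚᵘ.*≤* ℤ.-≤+

0<-invert : ∀ B → 0ℚ ℚ.< B → ∃[ C ] 0ℚ ℚ.< C × B * C ≡ 1ℚ
0<-invert B 0<B = ℚ.1/ B , ℚ.positive⁻¹ _ {{ℚ.1/pos⇒pos B}} , ℚ.*-inverseʳ B
  where
  instance
    B-pos = ℚ.positive 0<B
    B-nz  = ℚ.pos⇒nonZero B

-- The sequence C_{n-1}/4ⁿ

module CatalanWeights
  (a : ℕ → ℚ) (a₀ : a 0 ≡ 0ℚ) (a₁ : a 1 ≡ ½ * ½) (a-⋆ : ∀ n → a (2 ℕ.+ n) ≡ (a ⋆ a) (2 ℕ.+ n))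
  where

  private
    ι = fromℕ→ℚ

    -- With A the generating function of `a`, these are the coefficients of x A′ A.
    T : ℕ → ℚ
    T n = ∑ (suc n) (λ i → ι i * a i * a (n ∸ i))

    -- The product rule θ(a²) = 2 a θa for θ = x d/dx.
    n*a⋆a : ∀ n → ι n * (a ⋆ a) n ≡ T n + T n
    n*a⋆a n = sym (begin
      T n + T n
        ≡⟨ cong (T n +_) (trans (∑-reverse (suc n) _) (∑-cong (suc n) (λ i i<1+n → swap i (ℕ.≤-pred i<1+n)))) ⟩
      T n + ∑ (suc n) (λ i → ι (n ∸ i) * a (n ∸ i) * a i)
        ≡⟨ ∑-distrib-+ (suc n) (λ i → ι i * a i * a (n ∸ i)) (λ i → ι (n ∸ i) * a (n ∸ i) * a i) ⟨
      ∑ (suc n) (λ i → ι i * a i * a (n ∸ i) + ι (n ∸ i) * a (n ∸ i) * a i)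
        ≡⟨ ∑-cong (suc n) (λ i i<1+n → collect i (ℕ.≤-pred i<1+n)) ⟩
      ∑ (suc n) (λ i → ι n * (a i * a (n ∸ i)))
        ≡⟨ *-distribˡ-∑ (ι n) (suc n) (λ i → a i * a (n ∸ i)) ⟩
      ι n * (a ⋆ a) n ∎)
      where
      open ≡-Reasoning
      swap : ∀ i → i ℕ.≤ n → ι (n ∸ i) * a (n ∸ i) * a (n ∸ (n ∸ i)) ≡ ι (n ∸ i) * a (n ∸ i) * a i
      swap i i≤n = cong (λ s → ι (n ∸ i) * a (n ∸ i) * a s) (ℕ.m∸[m∸n]≡n i≤n)
      collect : ∀ i → i ℕ.≤ n → ι i * a i * a (n ∸ i) + ι (n ∸ i) * a (n ∸ i) * a i ≡ ι n * (a i * a (n ∸ i))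
      collect i i≤n = trans
        (solve 4 (λ p q x y → p :* x :* y :+ q :* y :* x := (p :+ q) :* (x :* y)) refl (ι i) (ι (n ∸ i)) (a i) (a (n ∸ i)))
        (cong (_* (a i * a (n ∸ i))) (trans (sym (fromℕ→ℚ-+ i (n ∸ i))) (cong ι (ℕ.m+[n∸m]≡n i≤n))))

    -- The Catalan recurrence n C_{n-1} = (4n - 6) C_{n-2} after scaling, or the differential
    -- equation (1 - x) A′ = ¼ - ½A of A = (1 - √(1 - x))/2.
    Recurrence : ℕ → Set
    Recurrence n = ι (2 ℕ.+ n) * a (2 ℕ.+ n) ≡ (ι (suc n) - ½) * a (suc n)

    -- This is A′ A = (¼ + x A′ - ½A) A at index n, so the recurrence enters only through earlier
    -- instances; together with the product rule it drives a strong induction.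
    T-suc : ∀ n → (∀ j → suc j < n → Recurrence j) → T (suc n) ≡ ½ * ½ * a n + (T n - ½ * (a ⋆ a) n)
    T-suc n rec = begin
      T (suc n)
        ≡⟨ trans (∑-head (suc n) _) (cong₂ _+_ (cong (_* a (suc n)) (ℚ.*-zeroˡ (a 0)))
             (∑-head n (λ j → ι (suc j) * a (suc j) * a (n ∸ j)))) ⟩
      0ℚ * a (suc n) + (1ℚ * a 1 * a n + ∑ n (λ j → ι (2 ℕ.+ j) * a (2 ℕ.+ j) * a (n ∸ suc j)))
        ≡⟨ cong₂ (λ p q → 0ℚ * a (suc n) + (1ℚ * p * a n + q)) a₁ (∑-cong n term) ⟩
      0ℚ * a (suc n) + (1ℚ * (½ * ½) * a n + ∑ n (F ∘ suc))
        ≡⟨ solve 3 (λ x y z → con 0ℚ :* x :+ (con 1ℚ :* con (½ * ½) :* y :+ z)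
                      := con (½ * ½) :* y :+ ((con 0ℚ :- con ½) :* con 0ℚ :* y :+ z)) refl (a (suc n)) (a n) (∑ n (F ∘ suc)) ⟩
      ½ * ½ * a n + ((0ℚ - ½) * 0ℚ * a n + ∑ n (F ∘ suc))
        -- A term at j = 0, which vanishes with `a 0`, is supplied so that the sum of `F` starts at
        -- 0.
        ≡⟨ cong (½ * ½ * a n +_) (trans (cong (λ p → (0ℚ - ½) * p * a n + ∑ n (F ∘ suc)) (sym a₀)) (sym (∑-head n F))) ⟩
      ½ * ½ * a n + ∑ (suc n) F
        ≡⟨ cong (½ * ½ * a n +_) expand ⟩
      ½ * ½ * a n + (T n - ½ * (a ⋆ a) n) ∎
      where
      open ≡-Reasoning
      F : ℕ → ℚ
      F j = (ι j - ½) * a j * a (n ∸ j)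
      term : ∀ j → j < n → ι (2 ℕ.+ j) * a (2 ℕ.+ j) * a (n ∸ suc j) ≡ F (suc j)
      term j j<n with ℕ.m≤n⇒m<n∨m≡n j<n
      ... | inj₁ 1+j<n = cong (_* a (n ∸ suc j)) (rec j 1+j<n)
      -- The top term would call for the very instance that `recurrence-step` is proving; its factor
      -- `a 0` is zero, which avoids the circle.
      ... | inj₂ refl rewrite ℕ.n∸n≡0 j | a₀ = trans (ℚ.*-zeroʳ (ι (2 ℕ.+ j) * a (2 ℕ.+ j)))
                                                    (sym (ℚ.*-zeroʳ ((ι (suc j) - ½) * a (suc j))))
      expand : ∑ (suc n) F ≡ T n - ½ * (a ⋆ a) n
      expand = begin
        ∑ (suc n) F
          ≡⟨ ∑-cong (suc n) (λ j _ → solve 3 (λ p x y → (p :- con ½) :* x :* y := p :* x :* y :+ (:- con ½) :* (x :* y))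
               refl (ι j) (a j) (a (n ∸ j))) ⟩
        ∑ (suc n) (λ j → ι j * a j * a (n ∸ j) + (- ½) * (a j * a (n ∸ j)))
          ≡⟨ trans (∑-distrib-+ (suc n) (λ j → ι j * a j * a (n ∸ j)) (λ j → (- ½) * (a j * a (n ∸ j))))
                   (cong (T n +_) (*-distribˡ-∑ (- ½) (suc n) (λ j → a j * a (n ∸ j)))) ⟩
        T n + (- ½) * (a ⋆ a) n
          ≡⟨ solve 2 (λ t s → t :+ (:- con ½) :* s := t :- con ½ :* s) refl (T n) ((a ⋆ a) n) ⟩
        T n - ½ * (a ⋆ a) n ∎

    recurrence-step : ∀ n → (∀ j → j < n → Recurrence j) → Recurrence n
    recurrence-step n rec = begin
      ι (2 ℕ.+ n) * a (2 ℕ.+ n)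
        ≡⟨ trans (cong (ι (2 ℕ.+ n) *_) (a-⋆ n)) (n*a⋆a (2 ℕ.+ n)) ⟩
      T (2 ℕ.+ n) + T (2 ℕ.+ n)
        ≡⟨ cong (λ t → t + t) (T-suc (suc n) (λ j j<n → rec j (ℕ.≤-pred j<n))) ⟩
      t′ + t′
        ≡⟨ solve 3 (λ x t s → let t′ = con (½ * ½) :* x :+ (t :- con ½ :* s) in t′ :+ t′ := con ½ :* x :+ (t :+ t) :- s)
             refl (a (suc n)) (T (suc n)) ((a ⋆ a) (suc n)) ⟩
      ½ * a (suc n) + (T (suc n) + T (suc n)) - (a ⋆ a) (suc n)
        ≡⟨ cong (λ t → ½ * a (suc n) + t - (a ⋆ a) (suc n)) (n*a⋆a (suc n)) ⟨
      ½ * a (suc n) + ι (suc n) * (a ⋆ a) (suc n) - (a ⋆ a) (suc n)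
        ≡⟨ last n ⟩
      (ι (suc n) - ½) * a (suc n) ∎
      where
      open ≡-Reasoning
      t′ = ½ * ½ * a (suc n) + (T (suc n) - ½ * (a ⋆ a) (suc n))
      last : ∀ n → ½ * a (suc n) + ι (suc n) * (a ⋆ a) (suc n) - (a ⋆ a) (suc n) ≡ (ι (suc n) - ½) * a (suc n)
      -- `a` and `a ⋆ a` differ at index 1, but there the coefficient `ι 1` - 1 of `(a ⋆ a) 1` is
      -- zero.
      last zero    = solve 2 (λ x s → con ½ :* x :+ con 1ℚ :* s :- s := (con 1ℚ :- con ½) :* x) refl (a 1) ((a ⋆ a) 1)
      last (suc n) rewrite sym (a-⋆ n) =
        solve 2 (λ x p → con ½ :* x :+ p :* x :- x := (p :- con ½) :* x) refl (a (2 ℕ.+ n)) (ι (2 ℕ.+ n))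

    recurrence-below : ∀ n j → j < n → Recurrence j
    recurrence-below (suc n) j j<1+n with ℕ.m≤n⇒m<n∨m≡n (ℕ.≤-pred j<1+n)
    ... | inj₁ j<n  = recurrence-below n j j<n
    ... | inj₂ refl = recurrence-step n (recurrence-below n)

  recurrence : ∀ n → ι (2 ℕ.+ n) * a (2 ℕ.+ n) ≡ (ι (suc n) - ½) * a (suc n)
  recurrence n = recurrence-below (suc n) n ℕ.≤-refl

  private
    ½≤ι-½ : ∀ n → ½ ≤ ι (suc n) - ½
    ½≤ι-½ n = ≤-by (p≤q⇒0≤q-p (1≤fromℕ→ℚ-suc n))
      (solve 1 (λ p → p :- con ½ := con ½ :+ (p :- con 1ℚ)) refl (ι (suc n)))

  0<a : ∀ n → 0ℚ ℚ.< a (suc n)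
  0<a zero    = subst (0ℚ ℚ.<_) (sym a₁) (ℚ.positive⁻¹ (½ * ½))
  0<a (suc n) = ℚ.*-cancelˡ-<-nonNeg (ι (2 ℕ.+ n)) {{ℚ.nonNegative (0≤fromℕ→ℚ (2 ℕ.+ n))}}
    (subst₂ ℚ._<_ (sym (ℚ.*-zeroʳ (ι (2 ℕ.+ n)))) (sym (recurrence n))
      (0<* (ℚ.<-≤-trans (ℚ.positive⁻¹ ½) (½≤ι-½ n)) (0<a n)))

  0≤a : ∀ n → 0ℚ ≤ a n
  0≤a zero    = ℚ.≤-reflexive (sym a₀)
  0≤a (suc n) = ℚ.<⇒≤ (0<a n)

  a-antitone : ∀ {m n} → 0 < m → m ℕ.≤ n → a n ≤ a m
  a-antitone {suc m} {suc n} _ m≤n with ℕ.m≤n⇒m<n∨m≡n m≤n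
  ... | inj₂ refl = ℚ.≤-refl
  ... | inj₁ m<n  = go n (ℕ.≤-pred m<n)
    where
    step : ∀ n → a (2 ℕ.+ n) ≤ a (suc n)
    step n = *-cancelˡ-≤ (ι (2 ℕ.+ n)) (0<fromℕ→ℚ-suc (suc n))
      (≤-by (0≤* (ℚ.nonNegative⁻¹ (1ℚ + ½)) (0≤a (suc n)))
        (trans (cong (_* a (suc n)) (fromℕ→ℚ-+ 1 (suc n)))
          (trans (solve 2 (λ p x → (con 1ℚ :+ p) :* x := (p :- con ½) :* x :+ con (1ℚ + ½) :* x) refl (ι (suc n)) (a (suc n)))
                 (cong (_+ (1ℚ + ½) * a (suc n)) (sym (recurrence n))))))
    go : ∀ n → suc m ℕ.≤ n → a (suc n) ≤ a (suc m)
    go (suc n) m≤n with ℕ.m≤n⇒m<n∨m≡n m≤n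
    ... | inj₂ refl = step n
    ... | inj₁ m<n  = ℚ.≤-trans (step n) (go n (ℕ.≤-pred m<n))

  -- Partial sums and tails of the weights

  S : ℕ → ℚ
  S n = ∑ n a

  -- Twice the tail of ∑ a, as the full sum is ½.
  τ : ℕ → ℚ
  τ n = 1ℚ - (S n + S n)

  -- The value is binom(2n, n)/4ⁿ. The induction step is the recurrence, read as 4n aₙ - 2aₙ = 4(n +
  -- 1) aₙ₊₁. Nonnegativity of `τ`, hence the bound ½ on all partial sums, can be read off from it.
  τ-closed : ∀ n → τ (suc n) ≡ (1ℚ + 1ℚ + 1ℚ + 1ℚ) * (ι (suc n) * a (suc n))
  τ-closed zero    rewrite a₀ | a₁ = refl
  τ-closed (suc n) = begin
    1ℚ - (S (suc n) + x + (S (suc n) + x))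
      ≡⟨ solve 2 (λ s x → con 1ℚ :- (s :+ x :+ (s :+ x)) := con 1ℚ :- (s :+ s) :- (x :+ x)) refl (S (suc n)) x ⟩
    τ (suc n) - (x + x)
      ≡⟨ cong (_- (x + x)) (τ-closed n) ⟩
    four * (ι (suc n) * x) - (x + x)
      ≡⟨ solve 2 (λ p x → con four :* (p :* x) :- (x :+ x) := con four :* ((p :- con ½) :* x)) refl (ι (suc n)) x ⟩
    four * ((ι (suc n) - ½) * x)
      ≡⟨ cong (four *_) (recurrence n) ⟨
    four * (ι (2 ℕ.+ n) * a (2 ℕ.+ n)) ∎
    where
    open ≡-Reasoning
    x = a (suc n)
    four = 1ℚ + 1ℚ + 1ℚ + 1ℚ

  0≤τ : ∀ n → 0ℚ ≤ τ n
  0≤τ zero    = ℚ.nonNegative⁻¹ 1ℚ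
  0≤τ (suc n) = subst (0ℚ ≤_) (sym (τ-closed n))
    (0≤* (ℚ.nonNegative⁻¹ (1ℚ + 1ℚ + 1ℚ + 1ℚ)) (0≤* (0≤fromℕ→ℚ (suc n)) (0≤a (suc n))))

  S-mono-≤ : ∀ {m n} → m ℕ.≤ n → S m ≤ S n
  S-mono-≤ {m} {n} m≤n = ≤-by (0≤∑ (n ∸ m) (λ i _ → 0≤a (m ℕ.+ i)))
    (trans (cong S (sym (ℕ.m+[n∸m]≡n m≤n))) (∑-split m (n ∸ m) a))

  0≤S : ∀ n → 0ℚ ≤ S n
  0≤S n = 0≤∑ n (λ i _ → 0≤a i)

  S≤½ : ∀ n → S n ≤ ½
  S≤½ n = ≤-by (0≤* (ℚ.nonNegative⁻¹ ½) (0≤τ n))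
    (solve 1 (λ s → con ½ := s :+ con ½ :* (con 1ℚ :- (s :+ s))) refl (S n))

  private
    -- A Wallis-type estimate: (2n + 1)(binom(2n, n)/4ⁿ)² equals 1 at n = 0 and decreases, because
    -- (2n + 3)(2n + 1) ≤ (2n + 2)².
    τ²-bound : ∀ n → (ι (suc n) + ι n) * (τ (suc n) * τ (suc n)) ≤ 1ℚ
    τ²-bound zero rewrite a₀ = ℚ.≤-refl
    τ²-bound (suc n) = ℚ.≤-trans (≤-by slack≥0 identity) (τ²-bound n)
      where
      four = 1ℚ + 1ℚ + 1ℚ + 1ℚ
      k = ι n
      x = a (suc n)
      slack≥0 : 0ℚ ≤ four * (x * x) * (1ℚ + k + k)
      slack≥0 = 0≤* (0≤* (ℚ.nonNegative⁻¹ four) (0≤* (0≤a (suc n)) (0≤a (suc n))))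
                    (0≤+ (0≤+ (ℚ.nonNegative⁻¹ 1ℚ) (0≤fromℕ→ℚ n)) (0≤fromℕ→ℚ n))
      τ₁ : τ (suc n) ≡ four * ((1ℚ + k) * x)
      τ₁ = trans (τ-closed n) (cong (λ p → four * (p * x)) (fromℕ→ℚ-+ 1 n))
      τ₂ : τ (2 ℕ.+ n) ≡ four * ((1ℚ + k - ½) * x)
      τ₂ = trans (τ-closed (suc n)) (cong (four *_) (trans (recurrence n) (cong (λ p → (p - ½) * x) (fromℕ→ℚ-+ 1 n))))
      open ≡-Reasoning
      identity : (ι (suc n) + ι n) * (τ (suc n) * τ (suc n))
               ≡ (ι (2 ℕ.+ n) + ι (suc n)) * (τ (2 ℕ.+ n) * τ (2 ℕ.+ n)) + four * (x * x) * (1ℚ + k + k)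
      identity = begin
        (ι (suc n) + ι n) * (τ (suc n) * τ (suc n))
          ≡⟨ cong₂ (λ p q → (p + k) * (q * q)) (fromℕ→ℚ-+ 1 n) τ₁ ⟩
        (1ℚ + k + k) * (four * ((1ℚ + k) * x) * (four * ((1ℚ + k) * x)))
          ≡⟨ solve 2 (λ k x → let c = con four; o = con 1ℚ in
               (o :+ k :+ k) :* (c :* ((o :+ k) :* x) :* (c :* ((o :+ k) :* x)))
               := (con (1ℚ + 1ℚ) :+ k :+ (o :+ k)) :* (c :* ((o :+ k :- con ½) :* x) :* (c :* ((o :+ k :- con ½) :* x)))
                  :+ c :* (x :* x) :* (o :+ k :+ k)) refl k x ⟩
        (1ℚ + 1ℚ + k + (1ℚ + k)) * (four * ((1ℚ + k - ½) * x) * (four * ((1ℚ + k - ½) * x))) + four * (x * x) * (1ℚ + k + k)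
          ≡⟨ cong (_+ four * (x * x) * (1ℚ + k + k))
               (trans (cong₂ (λ p q → (p + q) * (four * ((1ℚ + k - ½) * x) * (four * ((1ℚ + k - ½) * x))))
                             (sym (fromℕ→ℚ-+ 2 n)) (sym (fromℕ→ℚ-+ 1 n)))
                      (cong (λ q → (ι (2 ℕ.+ n) + ι (suc n)) * (q * q)) (sym τ₂))) ⟩
        (ι (2 ℕ.+ n) + ι (suc n)) * (τ (2 ℕ.+ n) * τ (2 ℕ.+ n)) + four * (x * x) * (1ℚ + k + k) ∎

  τ-antitone : ∀ {m n} → m ℕ.≤ n → τ n ≤ τ m
  τ-antitone {m} {n} m≤n = ≤-by (0≤+ d d)
    (solve 2 (λ s t → con 1ℚ :- (s :+ s) := con 1ℚ :- (t :+ t) :+ (t :- s :+ (t :- s))) refl (S m) (S n))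
    where d = p≤q⇒0≤q-p (S-mono-≤ m≤n)

  τ-small : ∀ ε → 0ℚ ℚ.< ε → ∃[ N ] ∀ n → N ℕ.≤ n → τ n ≤ ε
  τ-small ε 0<ε =
    let C , 0<C , εC = 0<-invert ε 0<ε
        -- With C = 1/ε, the alternative ε ≤ τ would give 2 = 2C²ε² ≤ (2N + 1)τ² ≤ 1. The factor 2
        -- makes the contradiction strict although only ≤ is assumed.
        N , large = archimedean ((1ℚ + 1ℚ) * (C * C))
    in suc N , λ n N<n → ℚ.≤-trans (τ-antitone N<n) (small C N εC large)
    where
    small : ∀ C N → ε * C ≡ 1ℚ → (1ℚ + 1ℚ) * (C * C) ≤ ι N → τ (suc N) ≤ ε
    small C N εC large with ℚ.≤-total (τ (suc N)) ε
    ... | inj₁ τ≤ε = τ≤ε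
    ... | inj₂ ε≤τ = ⊥-elim (ℚ.<-irrefl refl (ℚ.<-≤-trans 1<2 (begin
      1ℚ + 1ℚ
        ≡⟨ cong (λ z → (1ℚ + 1ℚ) * (z * z)) εC ⟨
      (1ℚ + 1ℚ) * (ε * C * (ε * C))
        ≡⟨ solve 2 (λ e c → con (1ℚ + 1ℚ) :* (e :* c :* (e :* c)) := con (1ℚ + 1ℚ) :* (c :* c) :* (e :* e)) refl ε C ⟩
      (1ℚ + 1ℚ) * (C * C) * (ε * ε)
        ≤⟨ *-mono-≤ (0≤* (ℚ.<⇒≤ 0<ε) (ℚ.<⇒≤ 0<ε)) (0≤+ (0≤fromℕ→ℚ (suc N)) (0≤fromℕ→ℚ N))
             (ℚ.≤-trans large (≤-by (0≤fromℕ→ℚ (suc N)) (ℚ.+-comm (ι (suc N)) (ι N))))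
             (*-mono-≤ (ℚ.<⇒≤ 0<ε) (0≤τ (suc N)) ε≤τ ε≤τ) ⟩
      (ι (suc N) + ι N) * (τ (suc N) * τ (suc N))
        ≤⟨ τ²-bound N ⟩
      1ℚ ∎)))
      where
      open ℚ.≤-Reasoning
      1<2 : 1ℚ ℚ.< 1ℚ + 1ℚ
      1<2 = ℚ.*<* (ℤ.+<+ (s≤s (s≤s z≤n)))

  -- A partial sum of the identity F = f₁x + G F at x = 1. The product vanishes at indices 0 and 1
  -- because both constant terms do, so `f 1` is left over as the inhomogeneous term.
  ∑⋆-fixpoint : ∀ {f g} → f 0 ≡ 0ℚ → g 0 ≡ 0ℚ → (∀ n → f (2 ℕ.+ n) ≡ (g ⋆ f) (2 ℕ.+ n)) →
    ∀ n → ∑ (2 ℕ.+ n) f ≡ f 1 + ∑ (2 ℕ.+ n) (g ⋆ f)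
  ∑⋆-fixpoint {f} {g} f₀ g₀ fix zero rewrite f₀ | g₀ =
    solve 2 (λ x y → con 0ℚ :+ con 0ℚ :+ x
                  := x :+ (con 0ℚ :+ (con 0ℚ :+ con 0ℚ :* con 0ℚ) :+ (con 0ℚ :+ con 0ℚ :* x :+ y :* con 0ℚ)))
      refl (f 1) (g 1)
  ∑⋆-fixpoint {f} {g} f₀ g₀ fix (suc n) = trans (cong₂ _+_ (∑⋆-fixpoint {f} {g} f₀ g₀ fix n) (fix n))
    (ℚ.+-assoc (f 1) (∑ (2 ℕ.+ n) (g ⋆ f)) ((g ⋆ f) (2 ℕ.+ n)))

  -- Sequences dominated by a, given by their ratios to a.

  InUnit : (ℕ → ℚ) → Set
  InUnit β = ∀ i → 0ℚ ≤ β i × β i ≤ 1ℚ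

  weigh : (ℕ → ℚ) → ℕ → ℚ
  weigh β i = β i * a i

  module _ {β : ℕ → ℚ} (β-unit : InUnit β) where

    0≤weigh : ∀ i → 0ℚ ≤ weigh β i
    0≤weigh i = 0≤* (β-unit i .proj₁) (0≤a i)

    weigh≤a : ∀ i → weigh β i ≤ a i
    weigh≤a i = subst (weigh β i ≤_) (ℚ.*-identityˡ (a i))
      (*-mono-≤ (0≤a i) (ℚ.nonNegative⁻¹ 1ℚ) (β-unit i .proj₂) ℚ.≤-refl)

    ∣β∣≤1 : ∀ i → ∣ β i ∣ ≤ 1ℚ
    ∣β∣≤1 i = 0≤p⇒∣p∣≤ (β-unit i .proj₁) (β-unit i .proj₂)

    ∑weigh≤½ : ∀ n → ∑ n (weigh β) ≤ ½
    ∑weigh≤½ n = ℚ.≤-trans (∑-mono-≤ n (λ i _ → weigh≤a i)) (S≤½ n)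

    ∑weigh-tail : ∀ {m n} → m ℕ.≤ n → ∣ ∑ n (weigh β) - ∑ m (weigh β) ∣ ≤ ½ * τ m
    ∑weigh-tail {m} {n} m≤n rewrite sym (ℕ.m+[n∸m]≡n m≤n) | ∑-split m (n ∸ m) (weigh β) =
      subst (λ z → ∣ z ∣ ≤ ½ * τ m) (solve 2 (λ x y → y := x :+ y :- x) refl (∑ m (weigh β)) tail)
        (0≤p⇒∣p∣≤ (0≤∑ (n ∸ m) (λ i _ → 0≤weigh (m ℕ.+ i)))
          (ℚ.≤-trans (∑-mono-≤ (n ∸ m) (λ i _ → weigh≤a (m ℕ.+ i)))
            (≤-by (p≤q⇒0≤q-p (subst (_≤ ½) (∑-split m (n ∸ m) a) (S≤½ (m ℕ.+ (n ∸ m)))))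
              (solve 2 (λ s t → con ½ :* (con 1ℚ :- (s :+ s)) := t :+ (con ½ :- (s :+ t))) refl (S m) (∑ (n ∸ m) (λ i → a (m ℕ.+ i)))))))
      where tail = ∑ (n ∸ m) (λ i → weigh β (m ℕ.+ i))

  module _ {β γ : ℕ → ℚ} (β-unit : InUnit β) (γ-unit : InUnit γ) where

    private
      b = weigh β
      c = weigh γ

    linearise : ℕ → ℕ → ℚ
    linearise K n = ∑ K (λ i → b i * γ (n ∸ i) + c i * β (n ∸ i))

    -- Replacing a (n ∸ i) by a n and dropping the middle terms of b ⋆ c
    -- costs at most what it costs for a ⋆ a, where it costs exactly a n * τ K.
    ⋆-linearise : ∀ K n → 2 ℕ.≤ n → K ℕ.+ K ℕ.≤ n →
      a n * linearise K n ≤ (b ⋆ c) n × (b ⋆ c) n ≤ a n * (linearise K n + τ K)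
    ⋆-linearise K (suc zero) (s≤s ()) _
    ⋆-linearise K n@(suc (suc n₂)) _ 2K≤n = lower , upper
      where
      l = suc n ∸ (K ℕ.+ K)
      size : suc n ≡ K ℕ.+ (l ℕ.+ K)
      size = begin
        suc n                ≡⟨ ℕ.m∸n+n≡m (ℕ.m≤n⇒m≤1+n 2K≤n) ⟨
        l ℕ.+ (K ℕ.+ K)      ≡⟨ ℕ.+-assoc l K K ⟨
        l ℕ.+ K ℕ.+ K        ≡⟨ ℕ.+-comm (l ℕ.+ K) K ⟩
        K ℕ.+ (l ℕ.+ K)      ∎
        where open ≡-Reasoning
      X P Q : ℕ → ℚ
      X i = b i * γ (n ∸ i) + c i * β (n ∸ i)
      P i = b i * c (n ∸ i) + c i * b (n ∸ i)
      Q i = a i * a (n ∸ i) + a i * a (n ∸ i)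
      mid-bc = ∑ l (λ i → b (K ℕ.+ i) * c (n ∸ (K ℕ.+ i)))
      mid-aa = ∑ l (λ i → a (K ℕ.+ i) * a (n ∸ (K ℕ.+ i)))

      slack : ∀ i → i < K → 0ℚ ≤ a (n ∸ i) - a n
      slack i i<K = p≤q⇒0≤q-p (a-antitone (ℕ.m<n⇒0<n∸m (ℕ.<-≤-trans i<K (ℕ.≤-trans (ℕ.m≤m+n K K) 2K≤n))) (ℕ.m∸n≤m n i))

      term≤ : ∀ i j → b i * γ j ≤ a i
      term≤ i j = subst (b i * γ j ≤_) (ℚ.*-identityʳ (a i))
        (*-mono-≤ (γ-unit j .proj₁) (0≤a i) (weigh≤a β-unit i) (γ-unit j .proj₂))
      term≤′ : ∀ i j → c i * β j ≤ a i
      term≤′ i j = subst (c i * β j ≤_) (ℚ.*-identityʳ (a i))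
        (*-mono-≤ (β-unit j .proj₁) (0≤a i) (weigh≤a γ-unit i) (β-unit j .proj₂))

      lower : a n * linearise K n ≤ (b ⋆ c) n
      lower = begin
        a n * ∑ K X       ≡⟨ *-distribˡ-∑ (a n) K X ⟨
        ∑ K (λ i → a n * X i)
          ≤⟨ ∑-mono-≤ K (λ i i<K → ≤-by
               (0≤* (slack i i<K) (0≤+ (0≤* (0≤weigh β-unit i) (γ-unit (n ∸ i) .proj₁))
                                       (0≤* (0≤weigh γ-unit i) (β-unit (n ∸ i) .proj₁))))
               (solve 6 (λ an ar x g y h → x :* (g :* ar) :+ y :* (h :* ar)
                    := an :* (x :* g :+ y :* h) :+ (ar :- an) :* (x :* g :+ y :* h)) refl
                  (a n) (a (n ∸ i)) (b i) (γ (n ∸ i)) (c i) (β (n ∸ i)))) ⟩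
        ∑ K P
          ≤⟨ ≤-by (0≤∑ l (λ i _ → 0≤* (0≤weigh β-unit (K ℕ.+ i)) (0≤weigh γ-unit (n ∸ (K ℕ.+ i))))) (⋆-split b c n K l size) ⟩
        (b ⋆ c) n ∎
        where open ℚ.≤-Reasoning

      -- The product (a_{n-i} - aₙ)(2aᵢ - `X i`) is nonnegative: `a` is antitone on positive
      -- indices, and each summand of `X i` is at most aᵢ. Expanded, it compares the replacement
      -- error for b ⋆ c with that for a ⋆ a.
      termwise : ∀ i → i < K → P i + a n * (a i + a i) ≤ a n * X i + Q i
      termwise i i<K = ≤-by
        (0≤* (slack i i<K) (0≤+ (p≤q⇒0≤q-p (term≤ i (n ∸ i))) (p≤q⇒0≤q-p (term≤′ i (n ∸ i)))))
        (solve 7 (λ an ar x g y h ai → an :* (x :* g :+ y :* h) :+ (ai :* ar :+ ai :* ar)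
             := (x :* (g :* ar) :+ y :* (h :* ar) :+ an :* (ai :+ ai))
                :+ (ar :- an) :* (ai :- x :* g :+ (ai :- y :* h))) refl
           (a n) (a (n ∸ i)) (b i) (γ (n ∸ i)) (c i) (β (n ∸ i)) (a i))

      summed : ∑ K P + a n * (S K + S K) ≤ a n * ∑ K X + ∑ K Q
      summed = begin
        ∑ K P + a n * (S K + S K)
          ≡⟨ cong (λ z → ∑ K P + a n * z) (∑-distrib-+ K a a) ⟨
        ∑ K P + a n * ∑ K (λ i → a i + a i)
          ≡⟨ cong (∑ K P +_) (*-distribˡ-∑ (a n) K (λ i → a i + a i)) ⟨
        ∑ K P + ∑ K (λ i → a n * (a i + a i))
          ≡⟨ ∑-distrib-+ K P (λ i → a n * (a i + a i)) ⟨
        ∑ K (λ i → P i + a n * (a i + a i))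
          ≤⟨ ∑-mono-≤ K termwise ⟩
        ∑ K (λ i → a n * X i + Q i)
          ≡⟨ trans (∑-distrib-+ K (λ i → a n * X i) Q) (cong (_+ ∑ K Q) (*-distribˡ-∑ (a n) K X)) ⟩
        a n * ∑ K X + ∑ K Q ∎
        where open ℚ.≤-Reasoning

      mid≤ : mid-bc ≤ mid-aa
      mid≤ = ∑-mono-≤ l (λ i _ → *-mono-≤ (0≤weigh γ-unit (n ∸ (K ℕ.+ i))) (0≤a (K ℕ.+ i))
                                         (weigh≤a β-unit (K ℕ.+ i)) (weigh≤a γ-unit (n ∸ (K ℕ.+ i))))

      upper : (b ⋆ c) n ≤ a n * (linearise K n + τ K)
      upper = ≤-by (0≤+ (p≤q⇒0≤q-p summed) (p≤q⇒0≤q-p mid≤)) (begin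
        a n * (∑ K X + τ K)
          ≡⟨ solve 3 (λ x y s → x :* (y :+ (con 1ℚ :- (s :+ s))) := x :* y :+ x :- x :* (s :+ s)) refl (a n) (∑ K X) (S K) ⟩
        a n * ∑ K X + a n - a n * (S K + S K)
          -- The 1 inside `τ K` contributes a bare `a n`, which is (a ⋆ a)ₙ and splits into ends and
          -- middle exactly as b ⋆ c does.
          ≡⟨ cong (λ z → a n * ∑ K X + z - a n * (S K + S K)) (trans (a-⋆ n₂) (⋆-split a a n K l size)) ⟩
        a n * ∑ K X + (∑ K Q + mid-aa) - a n * (S K + S K)
          ≡⟨ solve 6 (λ x q m y p m′ → x :+ (q :+ m) :- y := p :+ m′ :+ (x :+ q :- (p :+ y) :+ (m :- m′))) refl
               (a n * ∑ K X) (∑ K Q) mid-aa (a n * (S K + S K)) (∑ K P) mid-bc ⟩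
        ∑ K P + mid-bc + (a n * ∑ K X + ∑ K Q - (∑ K P + a n * (S K + S K)) + (mid-aa - mid-bc))
          ≡⟨ cong (_+ (a n * ∑ K X + ∑ K Q - (∑ K P + a n * (S K + S K)) + (mid-aa - mid-bc))) (⋆-split b c n K l size) ⟨
        (b ⋆ c) n + (a n * ∑ K X + ∑ K Q - (∑ K P + a n * (S K + S K)) + (mid-aa - mid-bc)) ∎)
        where open ≡-Reasoning

    -- The corner of the square missed by the Cauchy product is termwise largest for a ⋆ a. There it
    -- equals S² - (S - ¼) = (½ - S)², a quarter of `τ` squared, which is below `τ`.
    ∑*∑≈∑⋆ : ∀ n → ∣ ∑ (2 ℕ.+ n) b * ∑ (2 ℕ.+ n) c - ∑ (2 ℕ.+ n) (b ⋆ c) ∣ ≤ τ (2 ℕ.+ n)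
    ∑*∑≈∑⋆ n = begin
      ∣ ∑ N b * ∑ N c - ∑ N (b ⋆ c) ∣
        ≡⟨ cong (λ z → ∣ z - ∑ N (b ⋆ c) ∣) (∑*∑≡∑⋆+rest b c N) ⟩
      ∣ ∑ N (b ⋆ c) + D b c - ∑ N (b ⋆ c) ∣
        ≡⟨ cong ∣_∣ (solve 2 (λ x d → x :+ d :- x := d) refl (∑ N (b ⋆ c)) (D b c)) ⟩
      ∣ D b c ∣
        ≤⟨ 0≤p⇒∣p∣≤ (0≤∑ N (λ i _ → 0≤* (0≤weigh β-unit i) (0≤∑ i (λ j _ → 0≤weigh γ-unit (N ∸ i ℕ.+ j)))))
             (∑-mono-≤ N (λ i _ → *-mono-≤ (0≤∑ i (λ j _ → 0≤weigh γ-unit (N ∸ i ℕ.+ j))) (0≤a i)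
               (weigh≤a β-unit i) (∑-mono-≤ i (λ j _ → weigh≤a γ-unit (N ∸ i ℕ.+ j))))) ⟩
      D a a
        ≡⟨ solve 2 (λ x d → d := x :+ d :- x) refl (∑ N (a ⋆ a)) (D a a) ⟩
      ∑ N (a ⋆ a) + D a a - ∑ N (a ⋆ a)
        ≡⟨ cong (_- ∑ N (a ⋆ a)) (∑*∑≡∑⋆+rest a a N) ⟨
      S N * S N - ∑ N (a ⋆ a)
        ≡⟨ cong (λ z → S N * S N - z) (solve 2 (λ x y → y := x :+ y :- x) refl (a 1) (∑ N (a ⋆ a))) ⟩
      S N * S N - (a 1 + ∑ N (a ⋆ a) - a 1)
        ≡⟨ cong₂ (λ y z → S N * S N - (y - z)) (sym (∑⋆-fixpoint {a} {a} a₀ a₀ a-⋆ n)) a₁ ⟩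
      S N * S N - (S N - ½ * ½)
        ≤⟨ ≤-by (0≤+ (0≤* (ℚ.nonNegative⁻¹ (½ + ½ * ½)) (0≤τ N)) (0≤* (0≤* (ℚ.nonNegative⁻¹ ½) (0≤τ N)) (0≤S N)))
             (solve 1 (λ s → con 1ℚ :- (s :+ s) := s :* s :- (s :- con (½ * ½)) :+
                (con (½ + ½ * ½) :* (con 1ℚ :- (s :+ s)) :+ con ½ :* (con 1ℚ :- (s :+ s)) :* s)) refl (S N)) ⟩
      τ N ∎
      where
      open ℚ.≤-Reasoning
      N = 2 ℕ.+ n
      D : (ℕ → ℚ) → (ℕ → ℚ) → ℚ
      D f g = ∑ N (λ i → f i * ∑ i (λ j → g ((N ∸ i) ℕ.+ j)))

  -- Contraction of oscillations and the limit equations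

  Oscillation : (ℕ → ℚ) → ℕ → ℚ → Set
  Oscillation f N B = ∀ i j → N ℕ.≤ i → N ℕ.≤ j → ∣ f i - f j ∣ ≤ B

  Oscillation⇒0≤ : ∀ {f N B} → Oscillation f N B → 0ℚ ≤ B
  Oscillation⇒0≤ {f} {N} osc = ℚ.≤-trans (ℚ.0≤∣p∣ (f N - f N)) (osc N N ℕ.≤-refl ℕ.≤-refl)

  m+n≤o⇒m≤o∸k : ∀ {m n o k} → m ℕ.+ n ℕ.≤ o → k ℕ.≤ n → m ℕ.≤ o ∸ k
  m+n≤o⇒m≤o∸k {m} {n} {o} {k} m+n≤o k≤n =
    ℕ.m+n≤o⇒m≤o∸n m (ℕ.≤-trans (ℕ.+-monoʳ-≤ m k≤n) m+n≤o)

  module FixedPoint {ρ θ : ℕ → ℚ} (ρ-unit : InUnit ρ) (θ-unit : InUnit θ)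
    (fixpoint : ∀ n → weigh θ (2 ℕ.+ n) ≡ (weigh ρ ⋆ weigh θ) (2 ℕ.+ n))
    where

    private
      u = weigh ρ
      v = weigh θ
      L = linearise ρ-unit θ-unit

      η : ℕ → ℚ
      η n = ρ n + θ n

    θ≈linearise : ∀ K n → 2 ℕ.≤ n → K ℕ.+ K ℕ.≤ n → ∣ θ n - L K n ∣ ≤ τ K
    θ≈linearise K (suc zero) (s≤s ()) _
    θ≈linearise K n@(suc (suc n₂)) 2≤n 2K≤n = 0≤p⇒∣p∣≤
      (p≤q⇒0≤q-p (*-cancelˡ-≤ (a n) (0<a (suc n₂)) (subst (a n * L K n ≤_) conv≡ (⋆-linearise ρ-unit θ-unit K n 2≤n 2K≤n .proj₁))))
      (≤-by (p≤q⇒0≤q-p (*-cancelˡ-≤ (a n) (0<a (suc n₂))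
              (subst (_≤ a n * (L K n + τ K)) conv≡ (⋆-linearise ρ-unit θ-unit K n 2≤n 2K≤n .proj₂))))
        (solve 3 (λ t l x → t := x :- l :+ (l :+ t :- x)) refl (τ K) (L K n) (θ n)))
      where
      conv≡ : (u ⋆ v) n ≡ a n * θ n
      conv≡ = trans (sym (fixpoint n₂)) (ℚ.*-comm (θ n) (a n))

    ∣u-v∣≤a : ∀ i → ∣ u i - v i ∣ ≤ a i
    ∣u-v∣≤a i = ∣p∣≤
      (≤-by (0≤+ (p≤q⇒0≤q-p (weigh≤a ρ-unit i)) (0≤weigh θ-unit i))
        (solve 3 (λ x y z → z := x :- y :+ (z :- x :+ y)) refl (u i) (v i) (a i)))
      (≤-by (0≤+ (p≤q⇒0≤q-p (weigh≤a θ-unit i)) (0≤weigh ρ-unit i))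
        (solve 3 (λ x y z → z := :- (x :- y) :+ (z :- y :+ x)) refl (u i) (v i) (a i)))

    -- Eliminating ρ = η - θ turns the difference of two linearisations into a sum of (u - v)Δθ +
    -- vΔη. Both coefficients are at most `a` in absolute value, and the partial sums of `a` stay
    -- below ½. The shift by K keeps every index i - k above N.
    linearise-oscillation : ∀ {N B ε} K → Oscillation η N ε → Oscillation θ N B →
      Oscillation (L K) (N ℕ.+ K) (½ * (B + ε))
    linearise-oscillation {N} {B} {ε} K η-osc θ-osc i j i≥ j≥ = begin
      ∣ L K i - L K j ∣
        ≡⟨ cong (λ z → ∣ z - L K j ∣) expand ⟩
      ∣ L K j + ∑ K Δ - L K j ∣
        ≡⟨ cong ∣_∣ (solve 2 (λ x y → x :+ y :- x := y) refl (L K j) (∑ K Δ)) ⟩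
      ∣ ∑ K Δ ∣
        ≤⟨ ∣∑∣≤ K (λ k k<K → ∣p+q∣≤
             (∣p*q∣≤ (∣u-v∣≤a k) (θ-osc (i ∸ k) (j ∸ k) (m+n≤o⇒m≤o∸k i≥ (ℕ.<⇒≤ k<K)) (m+n≤o⇒m≤o∸k j≥ (ℕ.<⇒≤ k<K))))
             (∣p*q∣≤ (0≤p⇒∣p∣≤ (0≤weigh θ-unit k) (weigh≤a θ-unit k))
                     (η-osc (i ∸ k) (j ∸ k) (m+n≤o⇒m≤o∸k i≥ (ℕ.<⇒≤ k<K)) (m+n≤o⇒m≤o∸k j≥ (ℕ.<⇒≤ k<K))))) ⟩
      ∑ K (λ k → a k * B + a k * ε)
        ≡⟨ ∑-cong K (λ k _ → solve 3 (λ x b e → x :* b :+ x :* e := (b :+ e) :* x) refl (a k) B ε) ⟩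
      ∑ K (λ k → (B + ε) * a k)
        ≡⟨ *-distribˡ-∑ (B + ε) K a ⟩
      (B + ε) * S K
        ≤⟨ *-mono-≤ (0≤S K) (0≤+ (Oscillation⇒0≤ {θ} θ-osc) (Oscillation⇒0≤ {η} η-osc)) ℚ.≤-refl (S≤½ K) ⟩
      (B + ε) * ½
        ≡⟨ ℚ.*-comm (B + ε) ½ ⟩
      ½ * (B + ε) ∎
      where
      open ℚ.≤-Reasoning
      Δ : ℕ → ℚ
      Δ k = (u k - v k) * (θ (i ∸ k) - θ (j ∸ k)) + v k * (η (i ∸ k) - η (j ∸ k))
      expand : L K i ≡ L K j + ∑ K Δ
      expand = trans
        (∑-cong K (λ k _ → solve 6 (λ x y r t r′ t′ →
            x :* t :+ y :* r := x :* t′ :+ y :* r′ :+ ((x :- y) :* (t :- t′) :+ y :* (r :+ t :- (r′ :+ t′)))) refl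
          (u k) (v k) (ρ (i ∸ k)) (θ (i ∸ k)) (ρ (j ∸ k)) (θ (j ∸ k))))
        (∑-distrib-+ K (λ k → u k * θ (j ∸ k) + v k * ρ (j ∸ k)) Δ)

    -- Two linearisation errors, one at each index, surround the oscillation of the linearised
    -- sequence. The threshold collects the three requirements 2 ≤ i, 2K ≤ i and N + K ≤ i.
    θ-oscillation : ∀ {N B ε} K → Oscillation η N ε → Oscillation θ N B →
      Oscillation θ (2 ℕ.+ ((K ℕ.+ K) ℕ.+ (N ℕ.+ K))) (τ K + (½ * (B + ε) + τ K))
    θ-oscillation {N} {B} {ε} K η-osc θ-osc i j i≥ j≥ =
      subst (λ z → ∣ z ∣ ≤ τ K + (½ * (B + ε) + τ K))
        (solve 4 (λ x l m y → x :- l :+ (l :- m :+ (m :- y)) := x :- y) refl (θ i) (L K i) (L K j) (θ j))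
        (∣p+q∣≤ (θ≈linearise K i (2≤ i≥) (2K≤ i≥))
          (∣p+q∣≤ (linearise-oscillation {N} {B} {ε} K η-osc θ-osc i j (N+K≤ i≥) (N+K≤ j≥))
            (subst (_≤ τ K) (∣p-q∣≡∣q-p∣ (θ j) (L K j)) (θ≈linearise K j (2≤ j≥) (2K≤ j≥)))))
      where
      2≤ : ∀ {i} → 2 ℕ.+ ((K ℕ.+ K) ℕ.+ (N ℕ.+ K)) ℕ.≤ i → 2 ℕ.≤ i
      2≤ = ℕ.m+n≤o⇒m≤o 2
      2K≤ : ∀ {i} → 2 ℕ.+ ((K ℕ.+ K) ℕ.+ (N ℕ.+ K)) ℕ.≤ i → K ℕ.+ K ℕ.≤ i
      2K≤ h = ℕ.m+n≤o⇒m≤o (K ℕ.+ K) (ℕ.m+n≤o⇒n≤o 2 h)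
      N+K≤ : ∀ {i} → 2 ℕ.+ ((K ℕ.+ K) ℕ.+ (N ℕ.+ K)) ℕ.≤ i → N ℕ.+ K ℕ.≤ i
      N+K≤ h = ℕ.m+n≤o⇒n≤o (K ℕ.+ K) (ℕ.m+n≤o⇒n≤o 2 h)

    private
      ¾ = ½ + ½ * ½

      ¾^ : ℕ → ℚ
      ¾^ zero    = 1ℚ
      ¾^ (suc k) = ¾ * ¾^ k

      0<¾^ : ∀ k → 0ℚ ℚ.< ¾^ k
      0<¾^ zero    = ℚ.positive⁻¹ 1ℚ
      0<¾^ (suc k) = 0<* (ℚ.positive⁻¹ ¾) (0<¾^ k)

      four = 1ℚ + 1ℚ + 1ℚ + 1ℚ

      -- A Bernoulli inequality, (4/3)^k ≥ 1 + k/4, cleared of denominators.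
      ¾^-bound : ∀ k → ¾^ k * (four + fromℕ→ℚ k) ≤ four
      ¾^-bound zero    = ℚ.≤-refl
      ¾^-bound (suc k) = ℚ.≤-trans
        (≤-by (0≤* (ℚ.<⇒≤ (0<¾^ k)) (0≤* (ℚ.nonNegative⁻¹ (½ * ½)) (0≤+ (0≤fromℕ→ℚ k) (ℚ.nonNegative⁻¹ 1ℚ))))
          (trans
            (solve 2 (λ x p → x :* (con four :+ p) := con ¾ :* x :* (con four :+ (con 1ℚ :+ p)) :+ x :* (con (½ * ½) :* (p :+ con 1ℚ)))
              refl (¾^ k) (fromℕ→ℚ k))
            (cong (λ z → ¾ * ¾^ k * (four + z) + ¾^ k * (½ * ½ * (fromℕ→ℚ k + 1ℚ))) (sym (fromℕ→ℚ-+ 1 k)))))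
        (¾^-bound k)

      ¾^-small : ∀ ε → 0ℚ ℚ.< ε → ∃[ k ] ¾^ k ≤ ε
      ¾^-small ε 0<ε =
        let C , 0<C , εC = 0<-invert ε 0<ε
            k , large = archimedean (four * C)
        in k , *-cancelˡ-≤ (four * C) (0<* (ℚ.positive⁻¹ four) 0<C) (begin
          four * C * ¾^ k
            ≤⟨ *-mono-≤ (ℚ.<⇒≤ (0<¾^ k)) (0≤fromℕ→ℚ k) large ℚ.≤-refl ⟩
          fromℕ→ℚ k * ¾^ k
            ≤⟨ ≤-by (0≤* (ℚ.nonNegative⁻¹ four) (ℚ.<⇒≤ (0<¾^ k)))
                 (solve 2 (λ p x → x :* (con four :+ p) := p :* x :+ con four :* x) refl (fromℕ→ℚ k) (¾^ k)) ⟩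
          ¾^ k * (four + fromℕ→ℚ k)
            ≤⟨ ¾^-bound k ⟩
          four
            ≡⟨ trans (sym (ℚ.*-identityʳ four)) (cong (four *_) (sym εC)) ⟩
          four * (ε * C)
            ≡⟨ solve 2 (λ e c → con four :* (e :* c) := con four :* c :* e) refl ε C ⟩
          four * C * ε ∎)
        where open ℚ.≤-Reasoning

      θ-osc-¾^ : IsCauchy η → ∀ k → ∃[ N ] Oscillation θ N (¾^ k)
      θ-osc-¾^ η-cauchy zero = 0 , λ i j _ _ → ∣p∣≤
        (≤-by (0≤+ (p≤q⇒0≤q-p (θ-unit i .proj₂)) (θ-unit j .proj₁))
          (solve 2 (λ x y → con 1ℚ := x :- y :+ (con 1ℚ :- x :+ y)) refl (θ i) (θ j)))
        (≤-by (0≤+ (p≤q⇒0≤q-p (θ-unit j .proj₂)) (θ-unit i .proj₁))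
          (solve 2 (λ x y → con 1ℚ := :- (x :- y) :+ (con 1ℚ :- y :+ x)) refl (θ i) (θ j)))
      θ-osc-¾^ η-cauchy (suc k) =
        let B = ¾^ k
            N₁ , θ-osc = θ-osc-¾^ η-cauchy k
            -- With ε = B/4 and `τ K` ≤ B/16 the new bound is 5B/8 + 2B/16 = ¾B.
            N₂ , η-osc = η-cauchy (½ * (½ * B)) (0<½* (0<½* (0<¾^ k)))
            K , τ≤ = τ-small (½ * (½ * (½ * (½ * B)))) (0<½* (0<½* (0<½* (0<½* (0<¾^ k)))))
            osc = θ-oscillation {N₁ ℕ.⊔ N₂} {B} {½ * (½ * B)} K
              (λ i j hi hj → η-osc i j (ℕ.m⊔n≤o⇒n≤o N₁ N₂ hi) (ℕ.m⊔n≤o⇒n≤o N₁ N₂ hj))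
              (λ i j hi hj → θ-osc i j (ℕ.m⊔n≤o⇒m≤o N₁ N₂ hi) (ℕ.m⊔n≤o⇒m≤o N₁ N₂ hj))
            slack = p≤q⇒0≤q-p (τ≤ K ℕ.≤-refl)
        in _ , λ i j hi hj → ℚ.≤-trans (osc i j hi hj) (≤-by (0≤+ slack slack)
          (solve 2 (λ b t → let h = λ x → con ½ :* x in
             con ¾ :* b := t :+ (h (b :+ h (h b)) :+ t) :+ (h (h (h (h b))) :- t :+ (h (h (h (h b))) :- t))) refl B (τ K)))

    θ-cauchy : IsCauchy η → IsCauchy θ
    θ-cauchy η-cauchy ε 0<ε =
      let k , small = ¾^-small ε 0<ε
          N , osc = θ-osc-¾^ η-cauchy k
      in N , λ i j hi hj → ℚ.≤-trans (osc i j hi hj) small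

    -- Once the ratios have settled, the lagged values in the linearisation can be frozen at n,
    -- leaving θₙ ≈ (Σ_{i<K} uᵢ)θₙ + (Σ_{i<K} vᵢ)ρₙ; extending the sums from K to n costs ½`τ K`
    -- each.
    θ-limit-equation : IsCauchy ρ → IsCauchy θ → ∀ ε → 0ℚ ℚ.< ε →
      ∃[ N ] ∀ n → N ℕ.≤ n → ∣ θ n * (1ℚ - ∑ n u) - ∑ n v * ρ n ∣ ≤ ε
    θ-limit-equation ρ-cauchy θ-cauchy ε 0<ε =
      let N₁ , ρ-osc = ρ-cauchy (½ * ε) (0<½* 0<ε)
          N₂ , θ-osc = θ-cauchy (½ * ε) (0<½* 0<ε)
          -- Freezing costs ε/2, because the weights sum to at most ½. Linearising and the two
          -- extensions cost 2`τ K` together, which is at most ε/2.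
          K , τ≤ = τ-small (½ * (½ * ε)) (0<½* (0<½* 0<ε))
      in 2 ℕ.+ ((K ℕ.+ K) ℕ.+ ((N₁ ℕ.⊔ N₂) ℕ.+ K)) , λ n hn →
        let 2K≤n = ℕ.m+n≤o⇒m≤o (K ℕ.+ K) (ℕ.m+n≤o⇒n≤o 2 hn)
            N≤n = ℕ.m+n≤o⇒n≤o (K ℕ.+ K) (ℕ.m+n≤o⇒n≤o 2 hn)
        in ℚ.≤-trans (estimate K n (ℕ.m+n≤o⇒m≤o 2 hn) 2K≤n
             (λ k k<K → let h = m+n≤o⇒m≤o∸k N≤n (ℕ.<⇒≤ k<K); h′ = ℕ.m+n≤o⇒m≤o (N₁ ℕ.⊔ N₂) N≤n in
               ρ-osc (n ∸ k) n (ℕ.m⊔n≤o⇒m≤o N₁ N₂ h) (ℕ.m⊔n≤o⇒m≤o N₁ N₂ h′) ,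
               θ-osc (n ∸ k) n (ℕ.m⊔n≤o⇒n≤o N₁ N₂ h) (ℕ.m⊔n≤o⇒n≤o N₁ N₂ h′)))
           (≤-by (let slack = p≤q⇒0≤q-p (τ≤ K ℕ.≤-refl) in 0≤+ slack slack)
             (solve 2 (λ e t → let h = λ x → con ½ :* x in
                e := t :+ (h e :+ (h t :* con 1ℚ :+ h t :* con 1ℚ)) :+ (h (h e) :- t :+ (h (h e) :- t))) refl ε (τ K)))
      where
      estimate : ∀ K n → 2 ℕ.≤ n → K ℕ.+ K ℕ.≤ n →
        (∀ k → k < K → ∣ ρ (n ∸ k) - ρ n ∣ ≤ ½ * ε × ∣ θ (n ∸ k) - θ n ∣ ≤ ½ * ε) →
        ∣ θ n * (1ℚ - ∑ n u) - ∑ n v * ρ n ∣ ≤ τ K + (½ * ε + (½ * τ K * 1ℚ + ½ * τ K * 1ℚ))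
      estimate K n 2≤n 2K≤n close = subst (λ z → ∣ z ∣ ≤ τ K + (½ * ε + (½ * τ K * 1ℚ + ½ * τ K * 1ℚ)))
        (solve 7 (λ t l uK vK un vn r → t :- l :+ (l :- (uK :* t :+ vK :* r) :+ ((uK :- un) :* t :+ (vK :- vn) :* r))
             := t :* (con 1ℚ :- un) :- vn :* r) refl
          (θ n) (L K n) (∑ K u) (∑ K v) (∑ n u) (∑ n v) (ρ n))
        (∣p+q∣≤ (θ≈linearise K n 2≤n 2K≤n) (∣p+q∣≤ frozen (∣p+q∣≤
          (∣p*q∣≤ (subst (_≤ ½ * τ K) (∣p-q∣≡∣q-p∣ (∑ n u) (∑ K u)) (∑weigh-tail ρ-unit K≤n)) (∣β∣≤1 θ-unit n))
          (∣p*q∣≤ (subst (_≤ ½ * τ K) (∣p-q∣≡∣q-p∣ (∑ n v) (∑ K v)) (∑weigh-tail θ-unit K≤n)) (∣β∣≤1 ρ-unit n)))))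
        where
        K≤n = ℕ.≤-trans (ℕ.m≤m+n K K) 2K≤n
        Δ : ℕ → ℚ
        Δ k = u k * (θ (n ∸ k) - θ n) + v k * (ρ (n ∸ k) - ρ n)
        expand : L K n ≡ ∑ K Δ + (∑ K u * θ n + ∑ K v * ρ n)
        expand = begin
          L K n
            ≡⟨ ∑-cong K (λ k _ → solve 6 (λ x y r t r′ t′ →
                 x :* t :+ y :* r := x :* (t :- t′) :+ y :* (r :- r′) :+ (t′ :* x :+ r′ :* y)) refl
                 (u k) (v k) (ρ (n ∸ k)) (θ (n ∸ k)) (ρ n) (θ n)) ⟩
          ∑ K (λ k → Δ k + (θ n * u k + ρ n * v k))
            ≡⟨ trans (∑-distrib-+ K Δ (λ k → θ n * u k + ρ n * v k))
                 (cong (∑ K Δ +_) (∑-distrib-+ K (λ k → θ n * u k) (λ k → ρ n * v k))) ⟩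
          ∑ K Δ + (∑ K (λ k → θ n * u k) + ∑ K (λ k → ρ n * v k))
            ≡⟨ cong₂ (λ x y → ∑ K Δ + (x + y)) (trans (*-distribˡ-∑ (θ n) K u) (ℚ.*-comm (θ n) (∑ K u)))
                                              (trans (*-distribˡ-∑ (ρ n) K v) (ℚ.*-comm (ρ n) (∑ K v))) ⟩
          ∑ K Δ + (∑ K u * θ n + ∑ K v * ρ n) ∎
          where open ≡-Reasoning
        frozen : ∣ L K n - (∑ K u * θ n + ∑ K v * ρ n) ∣ ≤ ½ * ε
        frozen = begin
          ∣ L K n - (∑ K u * θ n + ∑ K v * ρ n) ∣
            ≡⟨ cong ∣_∣ (trans (cong (_- (∑ K u * θ n + ∑ K v * ρ n)) expand)
                 (solve 2 (λ x y → x :+ y :- y := x) refl (∑ K Δ) (∑ K u * θ n + ∑ K v * ρ n))) ⟩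
          ∣ ∑ K Δ ∣
            ≤⟨ ∣∑∣≤ K (λ k k<K → ∣p+q∣≤
                 (∣p*q∣≤ (0≤p⇒∣p∣≤ (0≤weigh ρ-unit k) (weigh≤a ρ-unit k)) (close k k<K .proj₂))
                 (∣p*q∣≤ (0≤p⇒∣p∣≤ (0≤weigh θ-unit k) (weigh≤a θ-unit k)) (close k k<K .proj₁))) ⟩
          ∑ K (λ k → a k * (½ * ε) + a k * (½ * ε))
            ≡⟨ ∑-cong K (λ k _ → solve 2 (λ x e → x :* (con ½ :* e) :+ x :* (con ½ :* e) := e :* x) refl (a k) ε) ⟩
          ∑ K (λ k → ε * a k)
            ≡⟨ *-distribˡ-∑ ε K a ⟩
          ε * S K
            ≤⟨ *-mono-≤ (0≤S K) (ℚ.<⇒≤ 0<ε) ℚ.≤-refl (S≤½ K) ⟩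
          ε * ½
            ≡⟨ ℚ.*-comm ε ½ ⟩
          ½ * ε ∎
          where open ℚ.≤-Reasoning

    -- Partial sums of V = v₁ + U V; the error is the corner that the Cauchy product misses.
    ∑-limit-equation : ∀ ε → 0ℚ ℚ.< ε → ∃[ N ] ∀ n → N ℕ.≤ n → ∣ ∑ n v * (1ℚ - ∑ n u) - v 1 ∣ ≤ ε
    ∑-limit-equation ε 0<ε =
      let N , τ≤ = τ-small ε 0<ε in 2 ℕ.+ N , λ where
        (suc zero)    (s≤s ())
        (suc (suc n)) (s≤s (s≤s N≤n)) →
          ℚ.≤-trans (bound n) (τ≤ (2 ℕ.+ n) (ℕ.m≤n⇒m≤1+n (ℕ.m≤n⇒m≤1+n N≤n)))
      where
      weigh₀ : ∀ β → weigh β 0 ≡ 0ℚ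
      weigh₀ β = trans (cong (β 0 *_) a₀) (ℚ.*-zeroʳ (β 0))
      bound : ∀ n → ∣ ∑ (2 ℕ.+ n) v * (1ℚ - ∑ (2 ℕ.+ n) u) - v 1 ∣ ≤ τ (2 ℕ.+ n)
      bound n = begin
        ∣ V * (1ℚ - U) - v 1 ∣
          ≡⟨ cong ∣_∣ (solve 3 (λ v u r → v :* (con 1ℚ :- u) :- r := v :- r :- u :* v) refl V U (v 1)) ⟩
        ∣ V - v 1 - U * V ∣
          ≡⟨ cong (λ z → ∣ z - v 1 - U * V ∣) (∑⋆-fixpoint {v} {u} (weigh₀ θ) (weigh₀ ρ) fixpoint n) ⟩
        ∣ v 1 + W - v 1 - U * V ∣
          ≡⟨ cong ∣_∣ (solve 3 (λ r w x → r :+ w :- r :- x := w :- x) refl (v 1) W (U * V)) ⟩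
        ∣ W - U * V ∣
          ≡⟨ ∣p-q∣≡∣q-p∣ W (U * V) ⟩
        ∣ U * V - W ∣
          ≤⟨ ∑*∑≈∑⋆ ρ-unit θ-unit n ⟩
        τ (2 ℕ.+ n) ∎
        where
        open ℚ.≤-Reasoning
        U = ∑ (2 ℕ.+ n) u
        V = ∑ (2 ℕ.+ n) v
        W = ∑ (2 ℕ.+ n) (u ⋆ v)

-- Weighted counts of bracketings with valuations

sum-map-+ : ∀ {A : Set} (f g : A → ℕ) xs →
  sum (map (λ x → f x ℕ.+ g x) xs) ≡ sum (map f xs) ℕ.+ sum (map g xs)
sum-map-+ f g []       = refl
sum-map-+ f g (x ∷ xs) = begin
  f x ℕ.+ g x ℕ.+ sum (map (λ x → f x ℕ.+ g x) xs)
    ≡⟨ cong (f x ℕ.+ g x ℕ.+_) (sum-map-+ f g xs) ⟩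
  f x ℕ.+ g x ℕ.+ (sum (map f xs) ℕ.+ sum (map g xs))
    ≡⟨ ℕ-solve 4 (λ a b c d → a :+ℕ b :+ℕ (c :+ℕ d) :=ℕ a :+ℕ c :+ℕ (b :+ℕ d)) refl (f x) (g x) _ _ ⟩
  f x ℕ.+ sum (map f xs) ℕ.+ (g x ℕ.+ sum (map g xs)) ∎
  where open ≡-Reasoning

sum-map-cong : ∀ {A : Set} {f g : A → ℕ} → (∀ x → f x ≡ g x) → ∀ xs → sum (map f xs) ≡ sum (map g xs)
sum-map-cong f≗g xs = cong sum (map-cong f≗g xs)

sum-map-* : ∀ {A B : Set} (f : A → ℕ) (g : B → ℕ) xs ys →
  sum (map (λ x → sum (map (λ y → f x ℕ.* g y) ys)) xs) ≡ sum (map f xs) ℕ.* sum (map g ys)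
sum-map-* f g []       ys = refl
sum-map-* f g (x ∷ xs) ys = begin
  sum (map (λ y → f x ℕ.* g y) ys) ℕ.+ sum (map (λ x → sum (map (λ y → f x ℕ.* g y) ys)) xs)
    ≡⟨ cong₂ ℕ._+_ (row ys) (sum-map-* f g xs ys) ⟩
  f x ℕ.* sum (map g ys) ℕ.+ sum (map f xs) ℕ.* sum (map g ys)
    ≡⟨ ℕ.*-distribʳ-+ (sum (map g ys)) (f x) (sum (map f xs)) ⟨
  (f x ℕ.+ sum (map f xs)) ℕ.* sum (map g ys) ∎
  where
  open ≡-Reasoning
  row : ∀ ys → sum (map (λ y → f x ℕ.* g y) ys) ≡ f x ℕ.* sum (map g ys)
  row []       = sym (ℕ.*-zeroʳ (f x))
  row (y ∷ ys) = trans (cong (f x ℕ.* g y ℕ.+_) (row ys)) (sym (ℕ.*-distribˡ-+ (f x) (g y) _))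

sum-map-++ : ∀ {A : Set} (f : A → ℕ) xs ys → sum (map f (xs ++ ys)) ≡ sum (map f xs) ℕ.+ sum (map f ys)
sum-map-++ f xs ys = trans (cong sum (map-++ f xs ys)) (sum-++ (map f xs) (map f ys))

sum-map-concatMap : ∀ {A B : Set} (f : B → ℕ) (h : A → List B) xs →
  sum (map f (concatMap h xs)) ≡ sum (map (λ x → sum (map f (h x))) xs)
sum-map-concatMap f h []       = refl
sum-map-concatMap f h (x ∷ xs) = trans (sum-map-++ f (h x) (concatMap h xs))
  (cong (sum (map f (h x)) ℕ.+_) (sum-map-concatMap f h xs))

sum-map-cartesianProductWith : ∀ {A B C : Set} (f : C → ℕ) (c : A → B → C) xs ys →
  sum (map f (cartesianProductWith c xs ys)) ≡ sum (map (λ x → sum (map (λ y → f (c x y)) ys)) xs)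
sum-map-cartesianProductWith f c []       ys = refl
sum-map-cartesianProductWith f c (x ∷ xs) ys = trans
  (sum-map-++ f (map (c x) ys) (cartesianProductWith c xs ys))
  (cong₂ ℕ._+_ (cong sum (sym (map-∘ ys))) (sum-map-cartesianProductWith f c xs ys))

-- The variables of s ⇒ t are distinct, so a valuation is an independent pair of valuations of s and
-- t, separated by `take` and `drop` as in `eval`.
sum-valuations-split : ∀ m a {b} (φ : Valuation m a → Valuation m b → ℕ) →
  sum (map (λ ρ → φ (take a ρ) (drop a ρ)) (valuations m (a ℕ.+ b))) ≡
  sum (map (λ ρ → sum (map (φ ρ) (valuations m b))) (valuations m a))
sum-valuations-split m zero        φ = sym (ℕ.+-identityʳ _)
sum-valuations-split m (suc a) {b} φ = begin
  sum (map (λ ρ → φ (take (suc a) ρ) (drop (suc a) ρ)) (valuations m (suc a ℕ.+ b)))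
    ≡⟨ sum-map-cartesianProductWith (λ ρ → φ (take (suc a) ρ) (drop (suc a) ρ)) _∷_ (allFin m) (valuations m (a ℕ.+ b)) ⟩
  sum (map (λ x → sum (map (λ ρ → φ (x ∷ take a ρ) (drop a ρ)) (valuations m (a ℕ.+ b)))) (allFin m))
    ≡⟨ sum-map-cong (λ x → sum-valuations-split m a (λ ρ → φ (x ∷ ρ))) (allFin m) ⟩
  sum (map (λ x → sum (map (λ ρ → sum (map (φ (x ∷ ρ)) (valuations m b))) (valuations m a))) (allFin m))
    ≡⟨ sum-map-cartesianProductWith (λ ρ → sum (map (φ ρ) (valuations m b))) _∷_ (allFin m) (valuations m a) ⟨
  sum (map (λ ρ → sum (map (φ ρ) (valuations m b))) (valuations m (suc a))) ∎
  where open ≡-Reasoning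

-- Unfolding `bracketings` at n + 2 calls both factors with the common depth bound n + 1; this
-- replaces that bound by their own sizes.
bracketings′-cong : ∀ {f f′ n} → n ℕ.≤ f → n ℕ.≤ f′ → bracketings′ f n ≡ bracketings′ f′ n
bracketings′-cong {zero}  {zero}   {zero}        _ _ = refl
bracketings′-cong {zero}  {suc f′} {zero}        _ _ = refl
bracketings′-cong {suc f} {zero}   {zero}        _ _ = refl
bracketings′-cong {suc f} {suc f′} {zero}        _ _ = refl
bracketings′-cong {suc f} {suc f′} {suc zero}    _ _ = refl
bracketings′-cong {suc f} {suc f′} {suc (suc n)} (s≤s n<f) (s≤s n<f′) =
  cong concat (map-cong-local (All.applyUpTo⁺₁ id (suc n) (λ {i} i<1+n →
    cong₂ (cartesianProductWith _⇒_)
      (bracketings′-cong (ℕ.≤-trans i<1+n n<f) (ℕ.≤-trans i<1+n n<f′))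
      (bracketings′-cong (ℕ.≤-trans (ℕ.m∸n≤m (suc n) i) n<f) (ℕ.≤-trans (ℕ.m∸n≤m (suc n) i) n<f′)))))

module _ {m : ℕ} where

  -- General weights on the chain treat single values and up-sets alike: any weight that factorises
  -- over `⇒G` yields a convolution recurrence.
  countᵗ : (Fin m → ℕ) → Bracketing → ℕ
  countᵗ w t = sum (map (λ ρ → w (eval t ρ)) (valuations m (leaves t)))

  count : (Fin m → ℕ) → ℕ → ℕ
  count w n = sum (map (countᵗ w) (bracketings n))

  countᵗ-⇒ : ∀ w w₁ w₂ → (∀ p q → w (p ⇒G q) ≡ w₁ p ℕ.* w₂ q) →
    ∀ s t → countᵗ w (s ⇒ t) ≡ countᵗ w₁ s ℕ.* countᵗ w₂ t
  countᵗ-⇒ w w₁ w₂ w-⇒ s t = begin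
    countᵗ w (s ⇒ t)
      ≡⟨ sum-valuations-split m (leaves s) (λ ρ σ → w (eval s ρ ⇒G eval t σ)) ⟩
    sum (map (λ ρ → sum (map (λ σ → w (eval s ρ ⇒G eval t σ)) (valuations m (leaves t)))) (valuations m (leaves s)))
      ≡⟨ sum-map-cong (λ ρ → sum-map-cong (λ σ → w-⇒ (eval s ρ) (eval t σ)) (valuations m (leaves t))) (valuations m (leaves s)) ⟩
    sum (map (λ ρ → sum (map (λ σ → w₁ (eval s ρ) ℕ.* w₂ (eval t σ)) (valuations m (leaves t)))) (valuations m (leaves s)))
      ≡⟨ sum-map-* (λ ρ → w₁ (eval s ρ)) (λ σ → w₂ (eval t σ)) (valuations m (leaves s)) (valuations m (leaves t)) ⟩
    countᵗ w₁ s ℕ.* countᵗ w₂ t ∎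
    where open ≡-Reasoning

  count-⇒ : ∀ w w₁ w₂ → (∀ p q → w (p ⇒G q) ≡ w₁ p ℕ.* w₂ q) →
    ∀ n → count w (2 ℕ.+ n) ≡ sum (map (λ i → count w₁ (suc i) ℕ.* count w₂ (suc n ∸ i)) (upTo (suc n)))
  count-⇒ w w₁ w₂ w-⇒ n = trans
    (sum-map-concatMap (countᵗ w) (bracketingsWithLeft (suc n) n) (upTo (suc n)))
    (cong sum (map-cong-local (All.applyUpTo⁺₁ id (suc n) (λ {i} i<1+n → block i i<1+n))))
    where
    block : ∀ i → i < suc n →
      sum (map (countᵗ w) (bracketingsWithLeft (suc n) n i)) ≡ count w₁ (suc i) ℕ.* count w₂ (suc n ∸ i)
    block i i<1+n = begin
      sum (map (countᵗ w) (bracketingsWithLeft (suc n) n i))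
        ≡⟨ cong₂ (λ xs ys → sum (map (countᵗ w) (cartesianProductWith _⇒_ xs ys)))
             (bracketings′-cong i<1+n ℕ.≤-refl) (bracketings′-cong (ℕ.m∸n≤m (suc n) i) ℕ.≤-refl) ⟩
      sum (map (countᵗ w) (cartesianProductWith _⇒_ (bracketings (suc i)) (bracketings (suc n ∸ i))))
        ≡⟨ sum-map-cartesianProductWith (countᵗ w) _⇒_ (bracketings (suc i)) (bracketings (suc n ∸ i)) ⟩
      sum (map (λ s → sum (map (λ t → countᵗ w (s ⇒ t)) (bracketings (suc n ∸ i)))) (bracketings (suc i)))
        ≡⟨ sum-map-cong (λ s → sum-map-cong (λ t → countᵗ-⇒ w w₁ w₂ w-⇒ s t) (bracketings (suc n ∸ i))) (bracketings (suc i)) ⟩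
      sum (map (λ s → sum (map (λ t → countᵗ w₁ s ℕ.* countᵗ w₂ t) (bracketings (suc n ∸ i)))) (bracketings (suc i)))
        ≡⟨ sum-map-* (countᵗ w₁) (countᵗ w₂) (bracketings (suc i)) (bracketings (suc n ∸ i)) ⟩
      count w₁ (suc i) ℕ.* count w₂ (suc n ∸ i) ∎
      where open ≡-Reasoning

  count-+ : ∀ w₁ w₂ n → count (λ p → w₁ p ℕ.+ w₂ p) n ≡ count w₁ n ℕ.+ count w₂ n
  count-+ w₁ w₂ n = trans
    (sum-map-cong (λ t → sum-map-+ (λ ρ → w₁ (eval t ρ)) (λ ρ → w₂ (eval t ρ)) (valuations m (leaves t))) (bracketings n))
    (sum-map-+ (countᵗ w₁) (countᵗ w₂) (bracketings n))

  count-cong : ∀ {w₁ w₂} → (∀ p → w₁ p ≡ w₂ p) → ∀ n → count w₁ n ≡ count w₂ n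
  count-cong w₁≗w₂ n = sum-map-cong (λ t → sum-map-cong (λ ρ → w₁≗w₂ (eval t ρ)) (valuations m (leaves t))) (bracketings n)

  count-1 : ∀ w → count w 1 ≡ sum (tabulate w)
  count-1 w = begin
    sum (map (λ ρ → w (eval leaf ρ)) (cartesianProductWith _∷_ (allFin m) ([] ∷ []))) ℕ.+ 0
      ≡⟨ trans (ℕ.+-identityʳ _) (sum-map-cartesianProductWith (λ ρ → w (eval leaf ρ)) _∷_ (allFin m) ([] ∷ [])) ⟩
    sum (map (λ p → w p ℕ.+ 0) (allFin m))
      ≡⟨ sum-map-cong (λ p → ℕ.+-identityʳ (w p)) (allFin m) ⟩
    sum (map w (allFin m))
      ≡⟨ cong sum (map-tabulate id w) ⟩
    sum (tabulate w) ∎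
    where open ≡-Reasoning

-- Indicator weights and the recurrences of the counting sequences

𝟙 : Bool → ℕ
𝟙 b = if b then 1 else 0

𝟙= 𝟙≥ : ∀ {m} → ℕ → Fin m → ℕ
𝟙= j p = 𝟙 (does (toℕ p ℕ.≟ j))
𝟙≥ k p = 𝟙 (does (k ℕ.≤? toℕ p))

𝟙≡1 : ∀ {P : Set} (d : Dec P) → P → 𝟙 (does d) ≡ 1
𝟙≡1 d p = cong 𝟙 (dec-true d p)

𝟙≡0 : ∀ {P : Set} (d : Dec P) → ¬ P → 𝟙 (does d) ≡ 0
𝟙≡0 d ¬p = cong 𝟙 (dec-false d ¬p)

𝟙≥-suc : ∀ {m} k (p : Fin m) → 𝟙≥ k p ≡ 𝟙= k p ℕ.+ 𝟙≥ (suc k) p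
𝟙≥-suc k p with ℕ.<-cmp k (toℕ p)
... | tri< k<p k≢p _
  rewrite 𝟙≡1 (k ℕ.≤? toℕ p) (ℕ.<⇒≤ k<p) | 𝟙≡0 (toℕ p ℕ.≟ k) (k≢p ∘ sym) | 𝟙≡1 (suc k ℕ.≤? toℕ p) k<p = refl
... | tri≈ k≮p k≡p _
  rewrite 𝟙≡1 (k ℕ.≤? toℕ p) (ℕ.≤-reflexive k≡p) | 𝟙≡1 (toℕ p ℕ.≟ k) (sym k≡p) | 𝟙≡0 (suc k ℕ.≤? toℕ p) k≮p = refl
... | tri> k≮p k≢p p<k
  rewrite 𝟙≡0 (k ℕ.≤? toℕ p) (ℕ.<⇒≱ p<k) | 𝟙≡0 (toℕ p ℕ.≟ k) (k≢p ∘ sym) | 𝟙≡0 (suc k ℕ.≤? toℕ p) k≮p = refl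

⇒G-≤ : ∀ {l} {p q : Fin (suc l)} → toℕ p ℕ.≤ toℕ q → p ⇒G q ≡ fromℕ l
⇒G-≤ {l} {p} {q} p≤q = cong (λ b → if b then fromℕ l else q) (dec-true (p Fin.≤? q) p≤q)

⇒G-≰ : ∀ {l} {p q : Fin (suc l)} → ¬ toℕ p ℕ.≤ toℕ q → p ⇒G q ≡ q
⇒G-≰ {l} {p} {q} p≰q = cong (λ b → if b then fromℕ l else q) (dec-false (p Fin.≤? q) p≰q)

-- Below the top, p ⇒G q takes the value j iff j = q < p.
𝟙=-⇒G : ∀ {m j} → suc j < m → (p q : Fin m) → 𝟙= j (p ⇒G q) ≡ 𝟙≥ (suc j) p ℕ.* 𝟙= j q
𝟙=-⇒G {suc l} {j} (s≤s j<l) p q = cases (p Fin.≤? q) (toℕ q ℕ.≟ j)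
  where
  top≢j : toℕ (fromℕ l) ≢ j
  top≢j e = ℕ.<⇒≢ j<l (sym (trans (sym (Fin.toℕ-fromℕ l)) e))
  cases : Dec (toℕ p ℕ.≤ toℕ q) → Dec (toℕ q ≡ j) → 𝟙= j (p ⇒G q) ≡ 𝟙≥ (suc j) p ℕ.* 𝟙= j q
  cases (yes p≤q) (yes q≡j) = trans
    (trans (cong (𝟙= j) (⇒G-≤ p≤q)) (𝟙≡0 (toℕ (fromℕ l) ℕ.≟ j) top≢j))
    (cong (ℕ._* 𝟙= j q) (sym (𝟙≡0 (suc j ℕ.≤? toℕ p) (ℕ.≤⇒≯ (ℕ.≤-trans p≤q (ℕ.≤-reflexive q≡j))))))
  cases (yes p≤q) (no q≢j) = trans
    (trans (cong (𝟙= j) (⇒G-≤ p≤q)) (𝟙≡0 (toℕ (fromℕ l) ℕ.≟ j) top≢j))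
    (sym (trans (cong (𝟙≥ (suc j) p ℕ.*_) (𝟙≡0 (toℕ q ℕ.≟ j) q≢j)) (ℕ.*-zeroʳ (𝟙≥ (suc j) p))))
  cases (no p≰q) (yes q≡j) = trans (cong (𝟙= j) (⇒G-≰ p≰q)) (sym (trans
    (cong (ℕ._* 𝟙= j q) (𝟙≡1 (suc j ℕ.≤? toℕ p) (subst (λ z → suc z ℕ.≤ toℕ p) q≡j (ℕ.≰⇒> p≰q))))
    (ℕ.*-identityˡ (𝟙= j q))))
  cases (no p≰q) (no q≢j) = trans
    (trans (cong (𝟙= j) (⇒G-≰ p≰q)) (𝟙≡0 (toℕ q ℕ.≟ j) q≢j))
    (sym (trans (cong (𝟙≥ (suc j) p ℕ.*_) (𝟙≡0 (toℕ q ℕ.≟ j) q≢j)) (ℕ.*-zeroʳ (𝟙≥ (suc j) p))))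

sum-𝟙= : ∀ {m j} → j < m → sum (tabulate {n = m} (𝟙= j)) ≡ 1
sum-𝟙= {suc m} {zero}  _         = cong suc (zeros m)
  where
  zeros : ∀ m → sum (tabulate {n = m} (λ _ → 0)) ≡ 0
  zeros zero    = refl
  zeros (suc m) = zeros m
sum-𝟙= {suc m} {suc j} (s≤s j<m) = sum-𝟙= j<m

sum-𝟙≥0 : ∀ m → sum (tabulate {n = m} (𝟙≥ 0)) ≡ m
sum-𝟙≥0 zero    = refl
sum-𝟙≥0 (suc m) = cong suc (sum-𝟙≥0 m)

g≡count : ∀ m n j → g m n j ≡ count {m} (𝟙= j) n
g≡count m n j = sum-map-cong (λ t → length-filter t (valuations m (leaves t))) (bracketings n)
  where
  length-filter : ∀ t (ρs : List (Valuation m (leaves t))) →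
    length (filter (λ ρ → toℕ (eval t ρ) ℕ.≟ j) ρs) ≡ sum (map (λ ρ → 𝟙= j (eval t ρ)) ρs)
  length-filter t []       = refl
  length-filter t (ρ ∷ ρs) with does (toℕ (eval t ρ) ℕ.≟ j)
  ... | true  = cong suc (length-filter t ρs)
  ... | false = length-filter t ρs

sumFromTo-head : ∀ {a b} f → a < b → sumFromTo a b f ≡ f a ℕ.+ sumFromTo (suc a) b f
sumFromTo-head {a} {suc b} f (s≤s a≤b) rewrite ℕ.+-∸-assoc 1 a≤b = cong₂ ℕ._+_ (cong f (ℕ.+-identityʳ a))
  (cong sum (trans (map-applyUpTo suc (λ i → f (a ℕ.+ i)) (b ∸ a))
    (trans (applyUpTo-cong (b ∸ a) (λ i → cong f (ℕ.+-suc a i)))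
           (sym (map-upTo (λ i → f (suc a ℕ.+ i)) (b ∸ a))))))
  where
  applyUpTo-cong : ∀ {h h′ : ℕ → ℕ} n → (∀ i → h i ≡ h′ i) → applyUpTo h n ≡ applyUpTo h′ n
  applyUpTo-cong zero    e = refl
  applyUpTo-cong (suc n) e = cong₂ _∷_ (e 0) (applyUpTo-cong n (λ i → e (suc i)))

H-suc : ∀ {m k} → k < m → ∀ n → H⟨ m ⟩ k n ≡ g m n k ℕ.+ H⟨ m ⟩ (suc k) n
H-suc {m} k<m n = sumFromTo-head (g m n) k<m

H≥m : ∀ {m k} → m ℕ.≤ k → ∀ n → H⟨ m ⟩ k n ≡ 0
H≥m m≤k n rewrite ℕ.m≤n⇒m∸n≡0 m≤k = refl

-- The indicator of an up-set loses one point as k grows by 1, just as the sum loses its first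
-- summand; downward from k = m, where no value is left.
H≡count : ∀ m k n → k ℕ.≤ m → H⟨ m ⟩ k n ≡ count {m} (𝟙≥ k) n
H≡count m k n k≤m = go (m ∸ k) k (ℕ.m+[n∸m]≡n k≤m)
  where
  count-0 : ∀ n → count {m} (λ _ → 0) n ≡ 0
  -- Additivity applied to 0 = 0 + 0 gives c = c + c.
  count-0 n = ℕ.+-cancelˡ-≡ (count {m} (λ _ → 0) n) _ _
    (trans (sym (count-+ {m} (λ _ → 0) (λ _ → 0) n)) (sym (ℕ.+-identityʳ _)))
  go : ∀ d k → k ℕ.+ d ≡ m → H⟨ m ⟩ k n ≡ count {m} (𝟙≥ k) n
  go zero k e = trans (H≥m (ℕ.≤-reflexive m≡k) n)
    (sym (trans (count-cong (λ p → 𝟙≡0 (k ℕ.≤? toℕ p) (ℕ.<⇒≱ (subst (toℕ p <_) m≡k (Fin.toℕ<n p)))) n) (count-0 n)))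
    where m≡k = trans (sym e) (ℕ.+-identityʳ k)
  go (suc d) k e = begin
    H⟨ m ⟩ k n
      ≡⟨ H-suc (subst (k <_) e (ℕ.m<m+n k (s≤s z≤n))) n ⟩
    g m n k ℕ.+ H⟨ m ⟩ (suc k) n
      ≡⟨ cong₂ ℕ._+_ (g≡count m n k) (go d (suc k) (trans (sym (ℕ.+-suc k d)) e)) ⟩
    count {m} (𝟙= k) n ℕ.+ count {m} (𝟙≥ (suc k)) n
      ≡⟨ count-+ {m} (𝟙= k) (𝟙≥ (suc k)) n ⟨
    count {m} (λ p → 𝟙= k p ℕ.+ 𝟙≥ (suc k) p) n
      ≡⟨ count-cong (λ p → sym (𝟙≥-suc k p)) n ⟩
    count {m} (𝟙≥ k) n ∎
    where open ≡-Reasoning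

-- The top value is excluded because it also arises from every p ≤ q; below it, `𝟙=-⇒G` factorises
-- the indicator.
g-recurrence : ∀ {m k} → suc k < m → ∀ n →
  g m (2 ℕ.+ n) k ≡ sum (map (λ i → H⟨ m ⟩ (suc k) (suc i) ℕ.* g m (suc n ∸ i) k) (upTo (suc n)))
g-recurrence {m} {k} k<m n = begin
  g m (2 ℕ.+ n) k
    ≡⟨ g≡count m (2 ℕ.+ n) k ⟩
  count {m} (𝟙= k) (2 ℕ.+ n)
    ≡⟨ count-⇒ (𝟙= k) (𝟙≥ (suc k)) (𝟙= k) (𝟙=-⇒G k<m) n ⟩
  sum (map (λ i → count {m} (𝟙≥ (suc k)) (suc i) ℕ.* count {m} (𝟙= k) (suc n ∸ i)) (upTo (suc n)))
    ≡⟨ sum-map-cong (λ i → sym (cong₂ ℕ._*_ (H≡count m (suc k) (suc i) (ℕ.<⇒≤ k<m)) (g≡count m (suc n ∸ i) k))) (upTo (suc n)) ⟩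
  sum (map (λ i → H⟨ m ⟩ (suc k) (suc i) ℕ.* g m (suc n ∸ i) k) (upTo (suc n))) ∎
  where open ≡-Reasoning

Gtot-recurrence : ∀ m n →
  Gtot m (2 ℕ.+ n) ≡ sum (map (λ i → Gtot m (suc i) ℕ.* Gtot m (suc n ∸ i)) (upTo (suc n)))
Gtot-recurrence m n = begin
  Gtot m (2 ℕ.+ n)
    ≡⟨ H≡count m 0 (2 ℕ.+ n) z≤n ⟩
  count {m} (𝟙≥ 0) (2 ℕ.+ n)
    -- `𝟙≥ 0` is constantly 1, so it factorises over `⇒G` by computation.
    ≡⟨ count-⇒ {m} (𝟙≥ 0) (𝟙≥ 0) (𝟙≥ 0) (λ _ _ → refl) n ⟩
  sum (map (λ i → count {m} (𝟙≥ 0) (suc i) ℕ.* count {m} (𝟙≥ 0) (suc n ∸ i)) (upTo (suc n)))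
    ≡⟨ sum-map-cong (λ i → sym (cong₂ ℕ._*_ (H≡count m 0 (suc i) z≤n) (H≡count m 0 (suc n ∸ i) z≤n))) (upTo (suc n)) ⟩
  sum (map (λ i → Gtot m (suc i) ℕ.* Gtot m (suc n ∸ i)) (upTo (suc n))) ∎
  where open ≡-Reasoning

g-1 : ∀ {m k} → k < m → g m 1 k ≡ 1
g-1 {m} {k} k<m = trans (g≡count m 1 k) (trans (count-1 {m} (𝟙= k)) (sum-𝟙= k<m))

Gtot-1 : ∀ m → Gtot m 1 ≡ m
Gtot-1 m = trans (H≡count m 0 1 z≤n) (trans (count-1 {m} (𝟙≥ 0)) (sum-𝟙≥0 m))

H-0 : ∀ {m} k → k ℕ.≤ m → H⟨ m ⟩ k 0 ≡ 0
H-0 {m} k k≤m = H≡count m k 0 k≤m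

-- Reciprocals and the derivative of Φ

÷₀-cancel : ∀ p {q} → q ≢ 0ℚ → (p ÷₀ q) * q ≡ p
÷₀-cancel p {q} q≢0 with q ℚ.≟ 0ℚ
... | yes q≡0 = ⊥-elim (q≢0 q≡0)
... | no  q≢0 = trans (ℚ.*-assoc p _ q) (trans (cong (p *_) (ℚ.*-inverseˡ q {{ℚ.≢-nonZero q≢0}})) (ℚ.*-identityʳ p))

÷₀-distrib-+ : ∀ p q r → (p + q) ÷₀ r ≡ p ÷₀ r + q ÷₀ r
÷₀-distrib-+ p q r with r ℚ.≟ 0ℚ
... | yes _ = refl
... | no  _ = ℚ.*-distribʳ-+ _ p q

÷₀-self : ∀ {p} → p ≢ 0ℚ → p ÷₀ p ≡ 1ℚ
÷₀-self {p} p≢0 with p ℚ.≟ 0ℚ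
... | yes p≡0 = ⊥-elim (p≢0 p≡0)
... | no  p≢0 = ℚ.*-inverseʳ p {{ℚ.≢-nonZero p≢0}}

÷₀-zeroˡ : ∀ q → 0ℚ ÷₀ q ≡ 0ℚ
÷₀-zeroˡ q with q ℚ.≟ 0ℚ
... | yes _   = refl
... | no  q≢0 = ℚ.*-zeroˡ ((ℚ.1/ q) {{ℚ.≢-nonZero q≢0}})

module _ {δ δ′ p : ℚ} (0<δ : 0ℚ ℚ.< δ) (0≤δ′ : 0ℚ ≤ δ′) (δδ′ : δ * δ′ ≡ 1ℚ) (δ≤∣p∣ : δ ≤ ∣ p ∣) where

  1/-inverse : (1ℚ ÷₀ p) * p ≡ 1ℚ
  1/-inverse = ÷₀-cancel 1ℚ {p} λ { refl → ℚ.<-irrefl refl (ℚ.<-≤-trans 0<δ δ≤∣p∣) }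

  ∣1/∣≤ : ∣ 1ℚ ÷₀ p ∣ ≤ δ′
  ∣1/∣≤ = begin
    x                  ≡⟨ trans (sym (ℚ.*-identityʳ x)) (cong (x *_) (sym δδ′)) ⟩
    x * (δ * δ′)       ≤⟨ *-mono-≤ {x} {x} (0≤* (ℚ.<⇒≤ 0<δ) 0≤δ′) (ℚ.0≤∣p∣ (1ℚ ÷₀ p)) ℚ.≤-refl
                            (*-mono-≤ {δ} {∣ p ∣} 0≤δ′ (ℚ.0≤∣p∣ p) δ≤∣p∣ ℚ.≤-refl) ⟩
    x * (∣ p ∣ * δ′)   ≡⟨ ℚ.*-assoc x ∣ p ∣ δ′ ⟨
    x * ∣ p ∣ * δ′     ≡⟨ cong (_* δ′) (trans (sym (ℚ.∣p*q∣≡∣p∣*∣q∣ (1ℚ ÷₀ p) p)) (cong ∣_∣ 1/-inverse)) ⟩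
    1ℚ * δ′            ≡⟨ ℚ.*-identityˡ δ′ ⟩
    δ′                 ∎
    where
    open ℚ.≤-Reasoning
    x = ∣ 1ℚ ÷₀ p ∣

min-positive : ∀ {p q} → 0ℚ ℚ.< p → 0ℚ ℚ.< q → ∃[ δ ] 0ℚ ℚ.< δ × δ ≤ p × δ ≤ q
min-positive {p} {q} 0<p 0<q with ℚ.≤-total p q
... | inj₁ p≤q = p , 0<p , ℚ.≤-refl , p≤q
... | inj₂ q≤p = q , 0<q , q≤p , ℚ.≤-refl

two : ℚ
two = 1ℚ + 1ℚ

-- With D = 1/(1 - u) and E = 1/(1 - w), the remainder of the linear approximation is exactly r D² E
-- (w - u)². Restricting w - u to half of δ₀ keeps 1 - w at least ½δ₀ away from 0, which bounds E.
Φ-hasDerivative : ∀ r u (u≠1 : ≠1 u) → HasDerivative (Φ r) u u≠1 (∂Φ r u u≠1)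
Φ-hasDerivative r u u≠1@(δ₀ , 0<δ₀ , N₀ , far) ε 0<ε =
  let C , 0<C , δ₀C = 0<-invert δ₀ 0<δ₀
      -- Bounds r D² E by way of ∣D∣ ≤ C and ∣E∣ ≤ 2C; the added 1 keeps `M` invertible when r = 0.
      M = (∣ r ∣ + 1ℚ) * (C * C * (two * C))
      0<M : 0ℚ ℚ.< M
      0<M = 0<* (ℚ.<-≤-trans (ℚ.positive⁻¹ 1ℚ) (≤-by (ℚ.0≤∣p∣ r) (ℚ.+-comm ∣ r ∣ 1ℚ)))
                (0<* (0<* 0<C 0<C) (0<* (ℚ.positive⁻¹ two) 0<C))
      M′ , 0<M′ , MM′ = 0<-invert M 0<M
      δ , 0<δ , δ≤½δ₀ , δ≤ε/M = min-positive (0<½* 0<δ₀) (0<* 0<ε 0<M′)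
  in δ , 0<δ , λ { w w≠1 (δ₁ , 0<δ₁ , N₁ , close) ε′ 0<ε′ → N₀ ℕ.⊔ N₁ , λ n hn →
       let ∣x∣≤δ = ℚ.≤-trans (≤-by (ℚ.<⇒≤ 0<δ₁) refl) (close n (ℕ.m⊔n≤o⇒n≤o N₀ N₁ hn))
       in ℚ.≤-trans
         (remainder C 0<C δ₀C (seq u n) (seq w n) (far n (ℕ.m⊔n≤o⇒m≤o N₀ N₁ hn))
           (ℚ.≤-trans ∣x∣≤δ δ≤½δ₀)
           (ℚ.≤-trans (*-mono-≤ {_} {_} {M} {M} (ℚ.<⇒≤ 0<M) (ℚ.<⇒≤ 0<δ) ∣x∣≤δ ℚ.≤-refl)
             (ℚ.≤-trans (*-mono-≤ {δ} {ε * M′} {M} {M} (ℚ.<⇒≤ 0<M) (0≤* (ℚ.<⇒≤ 0<ε) (ℚ.<⇒≤ 0<M′)) δ≤ε/M ℚ.≤-refl)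
               (ℚ.≤-reflexive (trans (solve 3 (λ e m m′ → e :* m′ :* m := e :* (m :* m′)) refl ε M M′)
                 (trans (cong (ε *_) MM′) (ℚ.*-identityʳ ε)))))))
         (≤-by (ℚ.<⇒≤ 0<ε′) refl) }
  where
  module _ (C : ℚ) (0<C : 0ℚ ℚ.< C) (δ₀C : δ₀ * C ≡ 1ℚ) (x y : ℚ) where
    d = 1ℚ - x
    e = 1ℚ - y
    D = 1ℚ ÷₀ d
    E = 1ℚ ÷₀ e
    remainder : δ₀ ≤ ∣ d ∣ → ∣ y - x ∣ ≤ ½ * δ₀ → ∣ y - x ∣ * ((∣ r ∣ + 1ℚ) * (C * C * (two * C))) ≤ ε →
      ∣ (y + r * E - (x + r * D)) - (1ℚ + r * (D * D)) * (y - x) ∣ ≤ ε * ∣ y - x ∣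
    remainder δ₀≤∣d∣ ∣y-x∣≤½δ₀ small = begin
      ∣ (y + r * E - (x + r * D)) - (1ℚ + r * (D * D)) * (y - x) ∣
        ≡⟨ cong ∣_∣ identity ⟩
      ∣ r * (D * D * E) * ((y - x) * (y - x)) ∣
        ≤⟨ ∣p*q∣≤ {r * (D * D * E)} {(y - x) * (y - x)} {(∣ r ∣ + 1ℚ) * (C * C * (two * C))}
             (∣p*q∣≤ {r} {D * D * E} (≤-by (ℚ.nonNegative⁻¹ 1ℚ) refl)
               (∣p*q∣≤ {D * D} {E} (∣p*q∣≤ {D} {D} ∣D∣≤ ∣D∣≤) ∣E∣≤))
             (ℚ.≤-reflexive (ℚ.∣p*q∣≡∣p∣*∣q∣ (y - x) (y - x))) ⟩
      (∣ r ∣ + 1ℚ) * (C * C * (two * C)) * (∣ y - x ∣ * ∣ y - x ∣)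
        ≡⟨ solve 2 (λ m z → m :* (z :* z) := z :* m :* z) refl ((∣ r ∣ + 1ℚ) * (C * C * (two * C))) ∣ y - x ∣ ⟩
      ∣ y - x ∣ * ((∣ r ∣ + 1ℚ) * (C * C * (two * C))) * ∣ y - x ∣
        ≤⟨ *-mono-≤ {_} {ε} {∣ y - x ∣} {∣ y - x ∣} (ℚ.0≤∣p∣ (y - x)) (ℚ.<⇒≤ 0<ε) small ℚ.≤-refl ⟩
      ε * ∣ y - x ∣ ∎
      where
      open ℚ.≤-Reasoning
      ½δ₀≤∣e∣ : ½ * δ₀ ≤ ∣ e ∣
      ½δ₀≤∣e∣ = ≤-by (0≤+ (p≤q⇒0≤q-p (ℚ.≤-trans δ₀≤∣d∣ d≤)) (p≤q⇒0≤q-p ∣y-x∣≤½δ₀))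
        (solve 3 (λ e z t → e := con ½ :* t :+ (e :+ z :- t :+ (con ½ :* t :- z))) refl ∣ e ∣ ∣ y - x ∣ δ₀)
        where
        d≤ : ∣ d ∣ ≤ ∣ e ∣ + ∣ y - x ∣
        d≤ = subst (λ z → ∣ z ∣ ≤ ∣ e ∣ + ∣ y - x ∣)
          (solve 2 (λ x y → con 1ℚ :- y :+ (y :- x) := con 1ℚ :- x) refl x y) (ℚ.∣p+q∣≤∣p∣+∣q∣ e (y - x))
      0≤2C = ℚ.<⇒≤ (0<* (ℚ.positive⁻¹ two) 0<C)
      ½δ₀2C : ½ * δ₀ * (two * C) ≡ 1ℚ
      ½δ₀2C = trans (solve 2 (λ t c → con ½ :* t :* (con two :* c) := t :* c) refl δ₀ C) δ₀C
      Dd = 1/-inverse {p = d} 0<δ₀ (ℚ.<⇒≤ 0<C) δ₀C δ₀≤∣d∣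
      Ee = 1/-inverse {p = e} (0<½* 0<δ₀) 0≤2C ½δ₀2C ½δ₀≤∣e∣
      ∣D∣≤ = ∣1/∣≤ {p = d} 0<δ₀ (ℚ.<⇒≤ 0<C) δ₀C δ₀≤∣d∣
      ∣E∣≤ = ∣1/∣≤ {p = e} (0<½* 0<δ₀) 0≤2C ½δ₀2C ½δ₀≤∣e∣
      -- E - D = (d - e) D E and y - x = d - e.
      identity : (y + r * E - (x + r * D)) - (1ℚ + r * (D * D)) * (y - x) ≡ r * (D * D * E) * ((y - x) * (y - x))
      identity = begin-equality
        (y + r * E - (x + r * D)) - (1ℚ + r * (D * D)) * (y - x)
          ≡⟨ solve 5 (λ x y r D E → let o = con 1ℚ in (y :+ r :* E :- (x :+ r :* D)) :- (o :+ r :* (D :* D)) :* (y :- x)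
               := r :* (E :* o :* o :- D :* o :* o :- D :* D :* (y :- x) :* o)) refl x y r D E ⟩
        r * (E * 1ℚ * 1ℚ - D * 1ℚ * 1ℚ - D * D * (y - x) * 1ℚ)
          ≡⟨ cong₂ (λ p q → r * (E * p * p - D * p * q - D * D * (y - x) * q)) (sym Dd) (sym Ee) ⟩
        r * (E * (D * d) * (D * d) - D * (D * d) * (E * e) - D * D * (y - x) * (E * e))
          ≡⟨ solve 5 (λ x y r D E → let d = con 1ℚ :- x; e = con 1ℚ :- y in
               r :* (E :* (D :* d) :* (D :* d) :- D :* (D :* d) :* (E :* e) :- D :* D :* (y :- x) :* (E :* e))
               := r :* (D :* D :* E) :* ((y :- x) :* (y :- x))) refl x y r D E ⟩
        r * (D * D * E) * ((y - x) * (y - x)) ∎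

-- Cauchy sequences and limits

IsCauchy-cong : ∀ {f h : ℕ → ℚ} → (∀ n → f n ≡ h n) → IsCauchy f → IsCauchy h
IsCauchy-cong f≗h c ε 0<ε = let N , osc = c ε 0<ε in N , λ i j hi hj →
  subst₂ (λ x y → ∣ x - y ∣ ≤ ε) (f≗h i) (f≗h j) (osc i j hi hj)

seq⟶ : ∀ {f} (x : ℝ) → (∀ n → f n ≡ seq x n) → f ⟶ x
seq⟶ x f≗x ε 0<ε = let N , osc = cauchy x (½ * ε) (0<½* 0<ε) in N , λ n hn →
  -- One half of ε absorbs the Cauchy error, the other half is the positive gap demanded by `<ʳ`.
  ½ * ε , 0<½* 0<ε , N , λ k hk → ℚ.≤-trans
    (ℚ.+-monoˡ-≤ (½ * ε) (subst (λ z → ∣ z - seq x k ∣ ≤ ½ * ε) (sym (f≗x n)) (osc n k hn hk)))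
    (ℚ.≤-reflexive (solve 1 (λ e → con ½ :* e :+ con ½ :* e := e) refl ε))

≈-reflexive : ∀ x y → (∀ n → seq x n ≡ seq y n) → x ≈ y
≈-reflexive x y x≗y ε 0<ε = 0 , λ n _ →
  subst (λ z → ∣ z ∣ ≤ ε) (sym (trans (cong (_- seq y n) (x≗y n)) (ℚ.+-inverseʳ (seq y n)))) (ℚ.<⇒≤ 0<ε)

-- Ratios and scaled coefficients

ratio-cancel : ∀ {x y} → x ℕ.≤ y → ratio x y * fromℕ→ℚ y ≡ fromℕ→ℚ x
-- A zero denominator forces a zero numerator, in agreement with the convention of `÷₀`. This is the
-- case of index 0, so weights and coefficients agree there too.
ratio-cancel {.0} {zero} z≤n = refl
ratio-cancel {x} {suc y} _   = ÷₀-cancel (fromℕ→ℚ x) {fromℕ→ℚ (suc y)}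
  λ e → ℚ.<-irrefl refl (subst (0ℚ ℚ.<_) e (0<fromℕ→ℚ-suc y))

ratio-unit : ∀ {x y} → x ℕ.≤ y → 0ℚ ≤ ratio x y × ratio x y ≤ 1ℚ
ratio-unit {.0} {zero} z≤n = ℚ.≤-refl , ℚ.nonNegative⁻¹ 1ℚ
ratio-unit {x} {suc y} x≤y =
  *-cancelˡ-≤ ι (0<fromℕ→ℚ-suc y) (subst₂ _≤_ (sym (ℚ.*-zeroʳ ι)) ι*ratio (0≤fromℕ→ℚ x)) ,
  *-cancelˡ-≤ ι (0<fromℕ→ℚ-suc y) (subst₂ _≤_ ι*ratio (sym (ℚ.*-identityʳ ι)) (fromℕ→ℚ-mono-≤ x≤y))
  where
  ι = fromℕ→ℚ (suc y)
  ι*ratio : fromℕ→ℚ x ≡ ι * ratio x (suc y)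
  ι*ratio = trans (sym (ratio-cancel x≤y)) (ℚ.*-comm (ratio x (suc y)) ι)

ratio-+ : ∀ x x′ y → ratio (x ℕ.+ x′) y ≡ ratio x y + ratio x′ y
ratio-+ x x′ y = trans (cong (_÷₀ fromℕ→ℚ y) (fromℕ→ℚ-+ x x′)) (÷₀-distrib-+ (fromℕ→ℚ x) (fromℕ→ℚ x′) (fromℕ→ℚ y))

ratio-0 : ∀ y → ratio 0 y ≡ 0ℚ
ratio-0 y = ÷₀-zeroˡ (fromℕ→ℚ y)

pow : ℚ → ℕ → ℚ
pow x = ℚ.+-*-rawSemiring ^ x

pow-+ : ∀ x m n → pow x (m ℕ.+ n) ≡ pow x m * pow x n
pow-+ x zero    n = sym (ℚ.*-identityˡ (pow x n))
pow-+ x (suc m) n = trans (cong (x *_) (pow-+ x m n)) (sym (ℚ.*-assoc x (pow x m) (pow x n)))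

scaled : ℚ → PowerSeries → ℕ → ℚ
scaled x A n = fromℕ→ℚ (A n) * pow x n

partialSum≡∑ : ∀ A x N → partialSum A x N ≡ ∑ N (scaled x A)
partialSum≡∑ A x zero    = refl
partialSum≡∑ A x (suc N) = cong (_+ scaled x A N) (partialSum≡∑ A x N)

fromℕ→ℚ-sum : ∀ f n → fromℕ→ℚ (sum (map f (upTo n))) ≡ ∑ n (fromℕ→ℚ ∘ f)
fromℕ→ℚ-sum f n = trans (cong (fromℕ→ℚ ∘ sum) (map-upTo f n)) (go f n)
  where
  go : ∀ f n → fromℕ→ℚ (sum (applyUpTo f n)) ≡ ∑ n (fromℕ→ℚ ∘ f)
  go f zero    = refl
  go f (suc n) = trans (fromℕ→ℚ-+ (f 0) (sum (applyUpTo (f ∘ suc) n)))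
    (trans (cong (fromℕ→ℚ (f 0) +_) (go (f ∘ suc) n)) (sym (∑-head n (fromℕ→ℚ ∘ f))))

-- The two end terms of the Cauchy product contain A₀ or B₀ and vanish, which leaves the sum over
-- nonempty left and right parts; the powers of x multiply to a common factor.
scaled-⋆ : ∀ x A B C → A 0 ≡ 0 → B 0 ≡ 0 →
  (∀ n → C (2 ℕ.+ n) ≡ sum (map (λ i → A (suc i) ℕ.* B (suc n ∸ i)) (upTo (suc n)))) →
  ∀ n → scaled x C (2 ℕ.+ n) ≡ (scaled x A ⋆ scaled x B) (2 ℕ.+ n)
scaled-⋆ x A B C A₀ B₀ rec n = sym (begin
  (scaled x A ⋆ scaled x B) (2 ℕ.+ n)
    ≡⟨ ∑-head (2 ℕ.+ n) _ ⟩
  scaled x A 0 * scaled x B (2 ℕ.+ n) + (∑ (suc n) F + scaled x A (2 ℕ.+ n) * scaled x B (suc n ∸ suc n))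
    ≡⟨ cong₂ (λ p q → p * scaled x B (2 ℕ.+ n) + (∑ (suc n) F + scaled x A (2 ℕ.+ n) * q))
         (scaled-0 A A₀) (trans (cong (scaled x B) (ℕ.n∸n≡0 (suc n))) (scaled-0 B B₀)) ⟩
  0ℚ * scaled x B (2 ℕ.+ n) + (∑ (suc n) F + scaled x A (2 ℕ.+ n) * 0ℚ)
    ≡⟨ solve 3 (λ p q r → con 0ℚ :* p :+ (q :+ r :* con 0ℚ) := q) refl (scaled x B (2 ℕ.+ n)) (∑ (suc n) F) (scaled x A (2 ℕ.+ n)) ⟩
  ∑ (suc n) F
    ≡⟨ ∑-cong (suc n) (λ i i<1+n → term i (ℕ.<⇒≤ i<1+n)) ⟩
  ∑ (suc n) (λ i → pow x (2 ℕ.+ n) * fromℕ→ℚ (A (suc i) ℕ.* B (suc n ∸ i)))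
    ≡⟨ *-distribˡ-∑ (pow x (2 ℕ.+ n)) (suc n) (λ i → fromℕ→ℚ (A (suc i) ℕ.* B (suc n ∸ i))) ⟩
  pow x (2 ℕ.+ n) * ∑ (suc n) (λ i → fromℕ→ℚ (A (suc i) ℕ.* B (suc n ∸ i)))
    ≡⟨ cong (pow x (2 ℕ.+ n) *_) (trans (sym (fromℕ→ℚ-sum (λ i → A (suc i) ℕ.* B (suc n ∸ i)) (suc n))) (cong fromℕ→ℚ (sym (rec n)))) ⟩
  pow x (2 ℕ.+ n) * fromℕ→ℚ (C (2 ℕ.+ n))
    ≡⟨ ℚ.*-comm (pow x (2 ℕ.+ n)) (fromℕ→ℚ (C (2 ℕ.+ n))) ⟩
  scaled x C (2 ℕ.+ n) ∎)
  where
  open ≡-Reasoning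
  F : ℕ → ℚ
  F i = scaled x A (suc i) * scaled x B (suc n ∸ i)
  scaled-0 : ∀ A → A 0 ≡ 0 → scaled x A 0 ≡ 0ℚ
  scaled-0 A A₀ = cong (λ z → fromℕ→ℚ z * 1ℚ) A₀
  term : ∀ i → i ℕ.≤ suc n → F i ≡ pow x (2 ℕ.+ n) * fromℕ→ℚ (A (suc i) ℕ.* B (suc n ∸ i))
  term i i≤1+n = trans
    (solve 4 (λ p q r s → p :* q :* (r :* s) := q :* s :* (p :* r)) refl
      (fromℕ→ℚ (A (suc i))) (pow x (suc i)) (fromℕ→ℚ (B (suc n ∸ i))) (pow x (suc n ∸ i)))
    (cong₂ _*_ (trans (sym (pow-+ x (suc i) (suc n ∸ i))) (cong (pow x ∘ suc) (ℕ.m+[n∸m]≡n i≤1+n)))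
               (sym (fromℕ→ℚ-* (A (suc i)) (B (suc n ∸ i)))))

unit-fraction : ∀ d .{{_ : ℕ.NonZero d}} → (ℤ.+ 1 ℚ./ d) * fromℕ→ℚ d ≡ 1ℚ
unit-fraction d@(suc d-1) = ℚ.toℚᵘ-injective (begin
  ℚ.toℚᵘ ((ℤ.+ 1 ℚ./ d) * fromℕ→ℚ d)
    ≈⟨ ℚ.toℚᵘ-homo-* (ℤ.+ 1 ℚ./ d) (fromℕ→ℚ d) ⟩
  ℚ.toℚᵘ (ℤ.+ 1 ℚ./ d) ℚᵘ.* ℚ.toℚᵘ (fromℕ→ℚ d)
    ≈⟨ ℚᵘ.*-cong (ℚ.toℚᵘ-fromℚᵘ (ℚᵘ.mkℚᵘ (ℤ.+ 1) d-1)) (fromℕ→ℚ-toℚᵘ d) ⟩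
  ℚᵘ.mkℚᵘ (ℤ.+ 1) d-1 ℚᵘ.* ℚᵘ.mkℚᵘ (ℤ.+ d) 0
    ≈⟨ ℚᵘ.*≡* (cong ℤ.+_ (trans (ℕ.*-identityʳ _) (cong suc (trans (ℕ.+-identityʳ d-1) (sym (trans (ℕ.+-identityʳ _) (ℕ.*-identityʳ d-1))))))) ⟩
  ℚᵘ.1ℚᵘ ∎)
  where open ℚᵘ.≃-Reasoning

-- The product m r = ¼ is the value of `a 1`, the initial condition that turns the scaled total
-- counts into C_{n-1}/4ⁿ for every m.
radius*4m : ∀ m .{{_ : NonTrivial m}} → fromℕ→ℚ m * radius m ≡ ½ * ½
radius*4m m = begin
  fromℕ→ℚ m * radius m
    ≡⟨ solve 2 (λ p r → p :* r := con (½ * ½) :* (r :* (con (fromℕ→ℚ 4) :* p))) refl (fromℕ→ℚ m) (radius m) ⟩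
  ½ * ½ * (radius m * (fromℕ→ℚ 4 * fromℕ→ℚ m))
    ≡⟨ cong (λ z → ½ * ½ * (radius m * z)) (fromℕ→ℚ-* 4 m) ⟨
  ½ * ½ * (radius m * fromℕ→ℚ (4 ℕ.* m))
    ≡⟨ cong (½ * ½ *_) (unit-fraction (4 ℕ.* m) {{ℕ.m*n≢0 4 m {{_}} {{ℕ.nonTrivial⇒nonZero m}}}}) ⟩
  ½ * ½ ∎
  where open ≡-Reasoning

⋆-cong : ∀ {f f′ h h′ : ℕ → ℚ} → (∀ i → f i ≡ f′ i) → (∀ i → h i ≡ h′ i) → ∀ n → (f ⋆ h) n ≡ (f′ ⋆ h′) n
⋆-cong e e′ n = ∑-cong (suc n) (λ i _ → cong₂ _*_ (e i) (e′ (n ∸ i)))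

-- Error estimates behind the two recursions

module _ {U : ℚ} (U≤½ : U ≤ ½) where

  ½≤∣1-U∣ : ½ ≤ ∣ 1ℚ - U ∣
  ½≤∣1-U∣ = ℚ.≤-trans
    (≤-by (p≤q⇒0≤q-p U≤½) (solve 1 (λ u → con 1ℚ :- u := con ½ :+ (con ½ :- u)) refl U)) (p≤∣p∣ (1ℚ - U))

  private
    w = 1ℚ ÷₀ (1ℚ - U)

    w-inverse : w * (1ℚ - U) ≡ 1ℚ
    w-inverse = 1/-inverse {½} {two} {1ℚ - U} (ℚ.positive⁻¹ ½) (ℚ.nonNegative⁻¹ two) refl ½≤∣1-U∣

    ∣w∣≤2 : ∣ w ∣ ≤ two
    ∣w∣≤2 = ∣1/∣≤ {½} {two} {1ℚ - U} (ℚ.positive⁻¹ ½) (ℚ.nonNegative⁻¹ two) refl ½≤∣1-U∣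

  -- Dividing V(1 - U) ≈ r by 1 - U, whose inverse is at most 2, gives V ≈ r/(1 - U).
  Φ-error : ∀ {V r e} → ∣ V * (1ℚ - U) - r ∣ ≤ e → ∣ U + V - (U + r * w) ∣ ≤ two * e
  Φ-error {V} {r} h = subst (λ z → ∣ z ∣ ≤ _) (sym identity) (∣p*q∣≤ ∣w∣≤2 h)
    where
    open ≡-Reasoning
    identity : U + V - (U + r * w) ≡ w * (V * (1ℚ - U) - r)
    identity = begin
      U + V - (U + r * w)
        ≡⟨ solve 4 (λ u v r w → u :+ v :- (u :+ r :* w) := v :* con 1ℚ :- r :* w) refl U V r w ⟩
      V * 1ℚ - r * w
        ≡⟨ cong (λ z → V * z - r * w) w-inverse ⟨
      V * (w * (1ℚ - U)) - r * w
        ≡⟨ solve 4 (λ v w d r → v :* (w :* d) :- r :* w := w :* (v :* d :- r)) refl V w (1ℚ - U) r ⟩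
      w * (V * (1ℚ - U) - r) ∎

  -- With w = 1/(1 - U), the first hypothesis gives θ ≈ wVρ and the second V ≈ rw, so θ ≈ rw²ρ. The
  -- constants 2 and 4 bound w and w².
  ∂Φ-error : ∀ {V r e e′ ρ θ} → ∣ ρ ∣ ≤ 1ℚ → ∣ θ * (1ℚ - U) - V * ρ ∣ ≤ e → ∣ V * (1ℚ - U) - r ∣ ≤ e′ →
    ∣ ρ + θ - (1ℚ + r * (w * w)) * ρ ∣ ≤ two * e + 1ℚ * (two * two) * e′
  ∂Φ-error {V} {r} {e} {e′} {ρ} {θ} ∣ρ∣≤1 h h′ = subst (λ z → ∣ z ∣ ≤ _) (sym identity)
    (∣p+q∣≤ {w * (θ * (1ℚ - U) - V * ρ)} (∣p*q∣≤ ∣w∣≤2 h)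
      (∣p*q∣≤ {ρ * (w * w)} (∣p*q∣≤ {ρ} ∣ρ∣≤1 (∣p*q∣≤ {w} ∣w∣≤2 ∣w∣≤2)) h′))
    where
    open ≡-Reasoning
    identity : ρ + θ - (1ℚ + r * (w * w)) * ρ ≡ w * (θ * (1ℚ - U) - V * ρ) + ρ * (w * w) * (V * (1ℚ - U) - r)
    identity = begin
      ρ + θ - (1ℚ + r * (w * w)) * ρ
        -- The term wVρ is subtracted and added, and the factors 1 mark the two places where w(1 -
        -- U) is substituted.
        ≡⟨ solve 5 (λ p t r w v → p :+ t :- (con 1ℚ :+ r :* (w :* w)) :* p
             := t :* con 1ℚ :- w :* v :* p :+ p :* w :* v :* con 1ℚ :- r :* (w :* w) :* p) refl ρ θ r w V ⟩
      θ * 1ℚ - w * V * ρ + ρ * w * V * 1ℚ - r * (w * w) * ρ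
        ≡⟨ cong (λ z → θ * z - w * V * ρ + ρ * w * V * z - r * (w * w) * ρ) w-inverse ⟨
      θ * (w * (1ℚ - U)) - w * V * ρ + ρ * w * V * (w * (1ℚ - U)) - r * (w * w) * ρ
        ≡⟨ solve 6 (λ p t r w v d → t :* (w :* d) :- w :* v :* p :+ p :* w :* v :* (w :* d) :- r :* (w :* w) :* p
             := w :* (t :* d :- v :* p) :+ p :* (w :* w) :* (v :* d :- r)) refl ρ θ r w V (1ℚ - U) ⟩
      w * (θ * (1ℚ - U) - V * ρ) + ρ * (w * w) * (V * (1ℚ - U) - r) ∎

-- The limit ratios for the chain with m elements

module LimitRatios (m : ℕ) .{{_ : NonTrivial m}} where

  r : ℚ
  r = radius m

  a : ℕ → ℚ
  a = scaled r (Gtot m)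

  a₀ : a 0 ≡ 0ℚ
  a₀ = cong (λ z → fromℕ→ℚ z * 1ℚ) (H-0 {m} 0 z≤n)

  a₁ : a 1 ≡ ½ * ½
  a₁ = trans (cong₂ _*_ (cong fromℕ→ℚ (Gtot-1 m)) (ℚ.*-identityʳ r)) (radius*4m m)

  a-⋆ : ∀ n → a (2 ℕ.+ n) ≡ (a ⋆ a) (2 ℕ.+ n)
  a-⋆ = scaled-⋆ r (Gtot m) (Gtot m) (Gtot m) (H-0 {m} 0 z≤n) (H-0 {m} 0 z≤n) (Gtot-recurrence m)

  open CatalanWeights a a₀ a₁ a-⋆

  ρ θ : ℕ → ℕ → ℚ
  ρ k n = ratio (H⟨ m ⟩ k n) (Gtot m n)
  θ k n = ratio (g m n k) (Gtot m n)

  H≤Gtot : ∀ k n → H⟨ m ⟩ k n ℕ.≤ Gtot m n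
  H≤Gtot zero    n = ℕ.≤-refl
  H≤Gtot (suc k) n with k ℕ.<? m
  ... | yes k<m = ℕ.≤-trans (subst (H⟨ m ⟩ (suc k) n ℕ.≤_) (sym (H-suc k<m n)) (ℕ.m≤n+m (H⟨ m ⟩ (suc k) n) (g m n k))) (H≤Gtot k n)
  ... | no  k≮m = subst (ℕ._≤ Gtot m n) (sym (H≥m (ℕ.m≤n⇒m≤1+n (ℕ.≮⇒≥ k≮m)) n)) z≤n

  g≤Gtot : ∀ {k} → k < m → ∀ n → g m n k ℕ.≤ Gtot m n
  g≤Gtot {k} k<m n = ℕ.≤-trans (subst (g m n k ℕ.≤_) (sym (H-suc k<m n)) (ℕ.m≤m+n (g m n k) (H⟨ m ⟩ (suc k) n))) (H≤Gtot k n)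

  ρ-unit : ∀ k → InUnit (ρ k)
  ρ-unit k n = ratio-unit (H≤Gtot k n)

  θ-unit : ∀ {k} → k < m → InUnit (θ k)
  θ-unit k<m n = ratio-unit (g≤Gtot k<m n)

  weigh-ratio : ∀ A → (∀ n → A n ℕ.≤ Gtot m n) → ∀ n → weigh (λ n → ratio (A n) (Gtot m n)) n ≡ scaled r A n
  weigh-ratio A A≤ n = trans (sym (ℚ.*-assoc (ratio (A n) (Gtot m n)) (fromℕ→ℚ (Gtot m n)) (pow r n)))
    (cong (_* pow r n) (ratio-cancel (A≤ n)))

  partialSum-H : ∀ k n → partialSum (H⟨ m ⟩ k) r n ≡ ∑ n (weigh (ρ k))
  partialSum-H k n = trans (partialSum≡∑ (H⟨ m ⟩ k) r n)
    (∑-cong n (λ i _ → sym (weigh-ratio (H⟨ m ⟩ k) (H≤Gtot k) i)))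

  ρ+θ : ∀ {k} → k < m → ∀ n → ρ k n ≡ ρ (suc k) n + θ k n
  ρ+θ {k} k<m n = trans (cong (λ z → ratio z (Gtot m n)) (H-suc k<m n))
    (trans (ratio-+ (g m n k) (H⟨ m ⟩ (suc k) n) (Gtot m n)) (ℚ.+-comm (θ k n) (ρ (suc k) n)))

  ρ≡0 : ∀ {k} → m ℕ.≤ k → ∀ n → ρ k n ≡ 0ℚ
  ρ≡0 m≤k n = trans (cong (λ z → ratio z (Gtot m n)) (H≥m m≤k n)) (ratio-0 (Gtot m n))

  module Step {k} (k<m-1 : suc k < m) where

    k<m : k < m
    k<m = ℕ.<⇒≤ k<m-1

    θ-fixpoint : ∀ n → weigh (θ k) (2 ℕ.+ n) ≡ (weigh (ρ (suc k)) ⋆ weigh (θ k)) (2 ℕ.+ n)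
    θ-fixpoint n = begin
      weigh (θ k) (2 ℕ.+ n)
        ≡⟨ weigh-ratio (G⟨ m ⟩ k) (g≤Gtot k<m) (2 ℕ.+ n) ⟩
      scaled r (G⟨ m ⟩ k) (2 ℕ.+ n)
        ≡⟨ scaled-⋆ r (H⟨ m ⟩ (suc k)) (G⟨ m ⟩ k) (G⟨ m ⟩ k) (H-0 (suc k) k<m) refl (g-recurrence k<m-1) n ⟩
      (scaled r (H⟨ m ⟩ (suc k)) ⋆ scaled r (G⟨ m ⟩ k)) (2 ℕ.+ n)
        ≡⟨ ⋆-cong (λ i → sym (weigh-ratio (H⟨ m ⟩ (suc k)) (H≤Gtot (suc k)) i))
                  (λ i → sym (weigh-ratio (G⟨ m ⟩ k) (g≤Gtot k<m) i)) (2 ℕ.+ n) ⟩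
      (weigh (ρ (suc k)) ⋆ weigh (θ k)) (2 ℕ.+ n) ∎
      where open ≡-Reasoning

    weigh-θ₁ : weigh (θ k) 1 ≡ r
    weigh-θ₁ = trans (weigh-ratio (G⟨ m ⟩ k) (g≤Gtot k<m) 1)
      (trans (cong (λ z → fromℕ→ℚ z * (r * 1ℚ)) (g-1 k<m)) (trans (ℚ.*-identityˡ (r * 1ℚ)) (ℚ.*-identityʳ r)))

    open FixedPoint {ρ (suc k)} {θ k} (ρ-unit (suc k)) (θ-unit k<m) θ-fixpoint public

    θ-cauchy′ : IsCauchy (ρ k) → IsCauchy (θ k)
    θ-cauchy′ c = θ-cauchy (IsCauchy-cong (ρ+θ k<m) c)

    ρ-suc-cauchy : IsCauchy (ρ k) → IsCauchy (ρ (suc k))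
    ρ-suc-cauchy c = IsCauchy-cong
      (λ n → trans (cong (_- θ k n) (ρ+θ k<m n)) (solve 2 (λ x y → x :+ y :- y := x) refl (ρ (suc k) n) (θ k n)))
      (cauchy (mkℝ (ρ k) c -ʳ mkℝ (θ k) (θ-cauchy′ c)))

  ρ-0 : ∀ n → ρ 0 (suc n) ≡ 1ℚ
  -- Positivity of the weight `a` excludes a zero total count at positive indices.
  ρ-0 n = ÷₀-self {fromℕ→ℚ (Gtot m (suc n))} λ e → ℚ.<-irrefl refl (subst (0ℚ ℚ.<_) (trans (cong (_* pow r (suc n)) e) (ℚ.*-zeroˡ (pow r (suc n)))) (0<a n))

  -- The induction ascends from H₀ = G, whose ratio is 1 from index 1 on. From k = m on the series
  -- is empty and the ratio is 0.
  ρ-cauchy : ∀ k → IsCauchy (ρ k)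
  ρ-cauchy zero ε 0<ε = 1 , λ where
    (suc i) (suc j) _ _ → subst₂ (λ x y → ∣ x - y ∣ ≤ ε) (sym (ρ-0 i)) (sym (ρ-0 j)) (ℚ.<⇒≤ 0<ε)
  ρ-cauchy (suc k) with suc k ℕ.<? m
  ... | yes k<m-1 = Step.ρ-suc-cauchy k<m-1 (ρ-cauchy k)
  ... | no  k≮m-1 = IsCauchy-cong (λ n → sym (ρ≡0 (ℕ.≮⇒≥ k≮m-1) n)) (cauchy (fromℚ 0ℚ))

  ∑weigh-cauchy : ∀ {β} → InUnit β → IsCauchy (λ n → ∑ n (weigh β))
  ∑weigh-cauchy {β} β-unit ε 0<ε = let N , τ≤ = τ-small ε 0<ε in N , λ i j hi hj →
    subst₂ (λ x y → ∣ x ∣ ≤ y)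
      (solve 3 (λ x y z → x :- z :+ (z :- y) := x :- y) refl (∑ i (weigh β)) (∑ j (weigh β)) (∑ N (weigh β)))
      (solve 1 (λ e → con ½ :* e :+ con ½ :* e := e) refl ε)
      (∣p+q∣≤ (tail N (τ≤ N ℕ.≤-refl) hi)
              (subst (_≤ ½ * ε) (∣p-q∣≡∣q-p∣ (∑ j (weigh β)) (∑ N (weigh β))) (tail N (τ≤ N ℕ.≤-refl) hj)))
    where
    tail : ∀ N {i} → τ N ≤ ε → N ℕ.≤ i → ∣ ∑ i (weigh β) - ∑ N (weigh β) ∣ ≤ ½ * ε
    tail N τ≤ hi = ℚ.≤-trans (∑weigh-tail β-unit hi) (ℚ.*-monoˡ-≤-nonNeg ½ τ≤)

  -- As `q m` is the zero sequence, one formula for `p` also serves the top value.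
  q p H : ℕ → ℝ
  q k = mkℝ (ρ k) (ρ-cauchy k)
  p k = q k -ʳ q (suc k)
  H k = mkℝ (partialSum (H⟨ m ⟩ k) r) (IsCauchy-cong (λ n → sym (partialSum-H k n)) (∑weigh-cauchy (ρ-unit k)))

  H-hasSum : ∀ k → HasSum (H⟨ m ⟩ k) r (H k)
  H-hasSum k = seq⟶ (H k) (λ _ → refl)

  ρ⟶q : ∀ k → ρ k ⟶ q k
  ρ⟶q k = seq⟶ (q k) (λ _ → refl)

  θ⟶p : ∀ {k} → k < m → θ k ⟶ p k
  θ⟶p {k} k<m = seq⟶ (p k) (λ n → trans
    (solve 2 (λ x y → y := x :+ y :- x) refl (ρ (suc k) n) (θ k n)) (cong (_- ρ (suc k) n) (sym (ρ+θ k<m n))))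

  q-top≈p-top : q (m ∸ 1) ≈ p (m ∸ 1)
  q-top≈p-top = ≈-reflexive (q (m ∸ 1)) (p (m ∸ 1)) λ n → sym (trans
    (cong (λ z → ρ (m ∸ 1) n - z) (ρ≡0 (ℕ.m≤n+m∸n m 1) n)) (ℚ.+-identityʳ (ρ (m ∸ 1) n)))

  module Equations {k} (k<m-1 : suc k < m) where

    open Step k<m-1

    private
      U V : ℕ → ℚ
      U n = partialSum (H⟨ m ⟩ (suc k)) r n
      V n = ∑ n (weigh (θ k))

      U≤½ : ∀ n → U n ≤ ½
      U≤½ n = subst (_≤ ½) (sym (partialSum-H (suc k) n)) (∑weigh≤½ (ρ-unit (suc k)) n)

      partialSum-Hk : ∀ n → partialSum (H⟨ m ⟩ k) r n ≡ U n + V n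
      partialSum-Hk n = begin
        partialSum (H⟨ m ⟩ k) r n
          ≡⟨ partialSum-H k n ⟩
        ∑ n (weigh (ρ k))
          ≡⟨ ∑-cong n (λ i _ → trans (cong (_* a i) (ρ+θ k<m i)) (ℚ.*-distribʳ-+ (a i) (ρ (suc k) i) (θ k i))) ⟩
        ∑ n (λ i → weigh (ρ (suc k)) i + weigh (θ k) i)
          ≡⟨ ∑-distrib-+ n (weigh (ρ (suc k))) (weigh (θ k)) ⟩
        ∑ n (weigh (ρ (suc k))) + V n
          ≡⟨ cong (_+ V n) (partialSum-H (suc k) n) ⟨
        U n + V n ∎
        where open ≡-Reasoning

      V-equation : ∀ ε → 0ℚ ℚ.< ε → ∃[ N ] ∀ n → N ℕ.≤ n → ∣ V n * (1ℚ - U n) - r ∣ ≤ ε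
      V-equation ε 0<ε = let N , close = ∑-limit-equation ε 0<ε in N , λ n hn →
        subst₂ (λ x y → ∣ V n * (1ℚ - x) - y ∣ ≤ ε) (sym (partialSum-H (suc k) n)) weigh-θ₁ (close n hn)

      θ-equation : ∀ ε → 0ℚ ℚ.< ε → ∃[ N ] ∀ n → N ℕ.≤ n → ∣ θ k n * (1ℚ - U n) - V n * ρ (suc k) n ∣ ≤ ε
      θ-equation ε 0<ε =
        let N , close = θ-limit-equation (ρ-cauchy (suc k)) (θ-cauchy′ (ρ-cauchy k)) ε 0<ε in N , λ n hn →
        subst (λ x → ∣ θ k n * (1ℚ - x) - V n * ρ (suc k) n ∣ ≤ ε) (sym (partialSum-H (suc k) n)) (close n hn)

    -- Every partial sum of H_{k+1} at r is at most ½, the bound for those of G, so 1 - H_{k+1}(r)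
    -- stays at least ½ from the first term on.
    H≠1 : ≠1 (H (suc k))
    H≠1 = ½ , ℚ.positive⁻¹ ½ , 0 , λ n _ → ½≤∣1-U∣ (U≤½ n)

    H-equation : H k ≈ Φ r (H (suc k)) H≠1
    H-equation ε 0<ε = let N , close = V-equation (½ * ε) (0<½* 0<ε) in N , λ n hn →
      subst₂ (λ x y → ∣ x - (U n + r * (1ℚ ÷₀ (1ℚ - U n))) ∣ ≤ y) (sym (partialSum-Hk n))
        (solve 1 (λ e → con two :* (con ½ :* e) := e) refl ε)
        (Φ-error (U≤½ n) {V n} {r} (close n hn))

    q-equation : q k ≈ ∂Φ r (H (suc k)) H≠1 *ʳ q (suc k)
    q-equation ε 0<ε =
      -- The tolerances ε/4 and ε/8 are scaled by 2 and 4 in `∂Φ-error` and add up to ε.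
      let N₁ , close₁ = θ-equation (½ * (½ * ε)) (0<½* (0<½* 0<ε))
          N₂ , close₂ = V-equation (½ * (½ * (½ * ε))) (0<½* (0<½* (0<½* 0<ε)))
      in N₁ ℕ.⊔ N₂ , λ n hn →
        subst₂ (λ x y → ∣ x - (1ℚ + r * (1ℚ ÷₀ (1ℚ - U n) * (1ℚ ÷₀ (1ℚ - U n)))) * ρ (suc k) n ∣ ≤ y) (sym (ρ+θ k<m n))
          (solve 1 (λ e → let h = λ x → con ½ :* x in
             con two :* h (h e) :+ con 1ℚ :* (con two :* con two) :* h (h (h e)) := e) refl ε)
          (∂Φ-error (U≤½ n) {V n} {r} {ρ = ρ (suc k) n} {θ = θ k n} (∣β∣≤1 (ρ-unit (suc k)) n)
            (close₁ n (ℕ.m⊔n≤o⇒m≤o N₁ N₂ hn)) (close₂ n (ℕ.m⊔n≤o⇒n≤o N₁ N₂ hn)))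

mainTheorem13 : ∀ (m : ℕ) .{{_ : NonTrivial m}} → let r = radius m in
    (∀ u (u≠1 : ≠1 u) → HasDerivative (Φ r) u u≠1 (∂Φ r u u≠1)) ×
    (Σ[ H ∈ (ℕ → ℝ) ] Σ[ q ∈ (ℕ → ℝ) ] Σ[ p ∈ (ℕ → ℝ) ]
    (∀ k → k < m → HasSum (H⟨ m ⟩ k) r (H k)) ×
    (∀ k → k < m → (λ n → ratio (H⟨ m ⟩ k n) (Gtot m n)) ⟶ q k) ×
    (∀ k → k < m → (λ n → ratio (g m n k) (Gtot m n)) ⟶ p k) ×
    q (m ∸ 1) ≈ p (m ∸ 1) ×
    (∀ k → suc k < m →
    Σ[ H≠1 ∈ ≠1 (H (suc k)) ]
    H k ≈ Φ r (H (suc k)) H≠1 ×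
    q k ≈ ∂Φ r (H (suc k)) H≠1 *ʳ q (suc k) ×
    p k ≈ q k -ʳ q (suc k)))
mainTheorem13 m =
  Φ-hasDerivative (radius m) ,
  H , q , p ,
  (λ k _ → H-hasSum k) ,
  (λ k _ → ρ⟶q k) ,
  (λ k k<m → θ⟶p k<m) ,
  q-top≈p-top ,
  λ k k<m-1 → let open Equations k<m-1 in
    H≠1 , H-equation , q-equation , ≈-reflexive (p k) (q k -ʳ q (suc k)) (λ _ → refl)
  where open LimitRatios m
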